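{- Let $k\ge 3$ and $w$ be positive integers with $kw$ odd such that $q=2kw+1$ is a prime power. Then there exist at least $\lceil \frac{w}{4k^4}\rceil$ pairwise orthogonal $k$-cycle systems of order $q$.
   Context: A $k$-cycle $(x_0,\dots,x_{k-1})$ on pairwise distinct vertices is the graph with edges $\{x_0,x_1\},\dots,\{x_{k-2},x_{k-1}\},\{x_{k-1},x_0\}$. A $k$-cycle system of order $n$ is a set of $k$-cycles whose edge sets partition the edge set of the complete graph $K_n$. Two $k$-cycle systems $\mathcal C,\mathcal C'$ of the same order (on the same vertex set) are orthogonal if every cycle of $\mathcal C$ shares at most one edge with every cycle of $\mathcal C'$. -}

module Defs where

open import Data.Fin using (Fin; toℕ)
open import Data.Nat using (ℕ; suc; _*_; _^_; _≤_; NonZero)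
open import Data.Nat.Primality using (Prime)
open import Data.Nat.Properties using (m*n≢0; m^n≢0)
open import Data.Product using (_×_; ∃; ∃₂; ∃!)
open import Data.Sum using (_⊎_)
open import Function.Definitions using (Injective)
open import Relation.Binary.PropositionalEquality using (_≡_; _≢_)

IsPrimePower : ℕ → Set
IsPrimePower q = ∃₂ λ p m → Prime p × 1 ≤ m × q ≡ p ^ m

-- Equality of the unordered pairs {x , y} and {x′ , y′}.
SameEdge : ∀ {n} → (x y x′ y′ : Fin n) → Set
SameEdge x y x′ y′ = (x ≡ x′ × y ≡ y′) ⊎ (x ≡ y′ × y ≡ x′)

-- j = i + 1 modulo k.
CyclicSuc : ∀ {k} → (i j : Fin k) → Set
CyclicSuc {k} i j = (toℕ j ≡ suc (toℕ i)) ⊎ (suc (toℕ i) ≡ k × toℕ j ≡ 0)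

-- A cyclic labelling (x₀ , … , x_{k-1}) of a k-cycle in Kₙ.  Rotations and
-- reflections of a labelling are different elements of this type but describe
-- the same graph; everything below depends on the edges only.
record Cycle (k n : ℕ) : Set where
  field
    vertex   : Fin k → Fin n
    distinct : Injective _≡_ _≡_ vertex

Edge : ∀ {k n} → Cycle k n → (x y : Fin n) → Set
Edge C x y = ∃₂ λ i j → CyclicSuc i j × SameEdge x y (vertex i) (vertex j)
  where open Cycle C

-- For k ≥ 3 every cycle has an edge, so `partition` also forces the cycles at
-- different indices to be different graphs: the family is a set of cycles.
record CycleSystem (k n : ℕ) : Set where
  field
    size      : ℕ
    cycle     : Fin size → Cycle k n
    partition : ∀ {x y} → x ≢ y → ∃! _≡_ λ c → Edge (cycle c) x y

ShareAtMostOneEdge : ∀ {k n} → (C D : Cycle k n) → Set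
ShareAtMostOneEdge C D = ∀ {x y x′ y′} →
  Edge C x y → Edge D x y → Edge C x′ y′ → Edge D x′ y′ → SameEdge x y x′ y′

Orthogonal : ∀ {k n} → (𝒞 𝒟 : CycleSystem k n) → Set
Orthogonal 𝒞 𝒟 = ∀ c d → ShareAtMostOneEdge (cycle 𝒞 c) (cycle 𝒟 d)
  where open CycleSystem

-- For k ≥ 3 and n ≥ 2 no system is orthogonal to itself, so a pairwise
-- orthogonal family has no repetitions.
PairwiseOrthogonal : ∀ {k n N} → (Fin N → CycleSystem k n) → Set
PairwiseOrthogonal 𝒮 = ∀ {i j} → i ≢ j → Orthogonal (𝒮 i) (𝒮 j)

instance
  4*k^4≢0 : ∀ {k} .{{_ : NonZero k}} → NonZero (4 * k ^ 4)
  4*k^4≢0 {k} = m*n≢0 4 (k ^ 4) {{_}} {{m^n≢0 k 4}}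

{-# OPTIONS --safe #-}
module Submission where

-- In 𝔽_q, q = 2kw + 1 with kw odd, a base cycle with differences d₀, …, d_{k−1} develops, by translations and
-- by a set of w multipliers, into a k-cycle system as soon as the products of multipliers and differences
-- represent each nonzero element exactly once up to sign.  Two such systems are orthogonal if no quotient
-- dᵢ / dₗ (i ≠ l) of the first equals a quotient of the second up to sign, because two common edges
-- determine such a quotient.
--
-- One system always exists: take dᵢ proportional to ζⁱ, where ζ has order k.  This settles w ≤ 4k⁴.
-- If w > 4k⁴, the multipliers are the wth roots of unity and the dᵢ are taken in distinct cosets of the
-- subgroup of order 2w.  Given r independent base cycles, a further one is built greedily, each difference
-- avoiding the at most 2k²r forbidden quotients with the earlier ones.  The last vertex x has to
-- satisfy x − s ∈ C and x ∈ C′ for two prescribed cosets; a second-moment estimate over all pairs of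
-- cosets gives more than w / k such x, which is enough as long as 4k⁴r < w.
--
-- The field of order q = pᵐ is a factor of the group algebra A = 𝔽ₚ[X] / (X^(q−1) − 1).  Every a in A satisfies
-- a^q = a, so A is a product of fields; a factor in which ∏ (X^(p^d − 1) − 1), 0 < d < m, does not vanish has at
-- most q elements, as all are roots of T^q − T, and at least q, as X has m conjugates in it.

-- The obstacle is the last vertex. Every earlier vertex faces one coset condition and has 2w
-- candidates, but the last one ends two edges whose differences both have prescribed cosets. Its
-- candidates form one of the k² cells cut out by the classes of x and x - s, of mean size about 2w
-- / k, and this one particular cell must be large. Two elements of a common cell solve two linear
-- equations whose coefficients are (2w)th roots of unity. So there are at most 5q + 4w² collisions,
-- where the mean alone forces q² / k², about 4w². The sum of the squared deviations is thus of
-- order 10kw, while a single cell of at most half the mean size contributes about w² / k². For w ≥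
-- 12k³ no cell can be that small. The parities govern signs. Since w is odd, -1 is not a wth root
-- of unity, and the group of order 2w consists of the wth roots of unity and their negatives. One
-- difference in each of its k cosets therefore represents everything once up to sign. Since k is
-- odd, no two powers of ζ differ by a sign.

-- Double counting with indicators, and a second-moment inequality.

module Counting where
  open import Data.Bool.Base using (if_then_else_)
  open import Data.Fin.Base using (Fin; zero; suc)
  import Data.Fin.Properties as Fin
  open import Data.List.Base as List using (List; length)
  open import Data.List.Membership.Propositional using (_∈_; _∉_)
  open import Data.List.Relation.Unary.Any as Any using (Any)
  import Data.List.Relation.Unary.Any.Properties as Any
  open import Data.Nat.Base
  open import Data.Nat.Properties
  open import Data.Nat.Solver using (module +-*-Solver)
  open import Data.Product.Base using (_×_; _,_; ∃; proj₁; proj₂)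
  open import Data.Sum.Base using (inj₁; inj₂)
  open import Function.Base using (_∘_)
  open import Relation.Binary.PropositionalEquality
  open import Relation.Nullary
  open import Relation.Nullary.Decidable using (_×-dec_; ¬?; decidable-stable)
  open import Relation.Unary using (Decidable)
  open import Algebra.Properties.Semiring.Sum +-*-semiring using (sum; sum-cong-≗; ∑-comm; ∑-distrib-+; *-distribˡ-sum; *-distribʳ-sum; sum-syntax)

  𝟙 : ∀ {a} {A : Set a} → Dec A → ℕ
  𝟙 d = if does d then 1 else 0

  𝟙-yes : ∀ {a} {A : Set a} (d : Dec A) → A → 𝟙 d ≡ 1
  𝟙-yes (yes _) _ = refl
  𝟙-yes (no ¬a) a = contradiction a ¬a

  𝟙-no : ∀ {a} {A : Set a} (d : Dec A) → ¬ A → 𝟙 d ≡ 0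
  𝟙-no (yes a) ¬a = contradiction a ¬a
  𝟙-no (no _)  _  = refl

  𝟙-sym : ∀ {n} (i j : Fin n) → 𝟙 (i Fin.≟ j) ≡ 𝟙 (j Fin.≟ i)
  𝟙-sym i j with i Fin.≟ j
  ... | yes refl = sym (𝟙-yes (j Fin.≟ j) refl)
  ... | no  i≢j  = sym (𝟙-no (j Fin.≟ i) (i≢j ∘ sym))

  𝟙-mono : ∀ {a} {A : Set a} (d : Dec A) {m} → (A → 1 ≤ m) → 𝟙 d ≤ m
  𝟙-mono (yes a) f = f a
  𝟙-mono (no _)  _ = z≤n

  ∑-mono : ∀ {n} {f g : Fin n → ℕ} → (∀ i → f i ≤ g i) → sum f ≤ sum g
  ∑-mono {zero}  _   = z≤n
  ∑-mono {suc n} f≤g = +-mono-≤ (f≤g zero) (∑-mono (f≤g ∘ suc))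

  ∑-const : ∀ n c → ∑[ _ < n ] c ≡ n * c
  ∑-const zero    c = refl
  ∑-const (suc n) c = cong (c +_) (∑-const n c)

  term≤∑ : ∀ {n} (f : Fin n → ℕ) i → f i ≤ sum f
  term≤∑ f zero    = m≤m+n _ _
  term≤∑ f (suc i) = ≤-trans (term≤∑ (f ∘ suc) i) (m≤n+m _ (f zero))

  ∑-select : ∀ {n} (f : Fin n → ℕ) j → ∑[ i < n ] (𝟙 (j Fin.≟ i) * f i) ≡ f j
  ∑-select {suc n} f zero    = begin
    f zero + 0 + ∑[ i < n ] 0  ≡⟨ cong₂ _+_ (+-identityʳ _) (trans (∑-const n 0) (*-zeroʳ n)) ⟩
    f zero + 0 ≡⟨ +-identityʳ _ ⟩
    f zero ∎
    where open ≡-Reasoning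
  ∑-select {suc n} f (suc j) = trans (sum-cong-≗ (λ i → cong (_* f (suc i)) (step i))) (∑-select (f ∘ suc) j)
    where
    step : ∀ i → 𝟙 (suc j Fin.≟ suc i) ≡ 𝟙 (j Fin.≟ i)
    step i with j Fin.≟ i
    ... | yes _ = refl
    ... | no  _ = refl

  ∑-𝟙-≟ : ∀ {n} (j : Fin n) → ∑[ i < n ] 𝟙 (j Fin.≟ i) ≡ 1
  ∑-𝟙-≟ j = trans (sum-cong-≗ (λ i → sym (*-identityʳ (𝟙 (j Fin.≟ i))))) (∑-select (λ _ → 1) j)

  count : ∀ {n p} {P : Fin n → Set p} → Decidable P → ℕ
  count P? = sum (𝟙 ∘ P?)

  module _ {n p} {P : Fin n → Set p} (P? : Decidable P) where

    count-cover : (E : List (Fin n)) → (∀ x → P x → x ∈ E) → count P? ≤ length E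
    count-cover E P⊆E = begin
      ∑[ x < n ] 𝟙 (P? x) ≤⟨ ∑-mono (λ x → 𝟙-mono (P? x) (hit x ∘ P⊆E x)) ⟩
      ∑[ x < n ] ∑[ i < length E ] 𝟙 (at i Fin.≟ x) ≡⟨ ∑-comm (λ x i → 𝟙 (at i Fin.≟ x)) ⟩
      ∑[ i < length E ] ∑[ x < n ] 𝟙 (at i Fin.≟ x) ≡⟨ sum-cong-≗ (∑-𝟙-≟ ∘ at) ⟩
      ∑[ i < length E ] 1 ≡⟨ ∑-const (length E) 1 ⟩
      length E * 1 ≡⟨ *-identityʳ _ ⟩
      length E ∎
      where
      open ≤-Reasoning
      at = List.lookup E
      hit : ∀ x → x ∈ E → 1 ≤ ∑[ i < length E ] 𝟙 (at i Fin.≟ x)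
      hit x x∈E = begin
        1 ≡⟨ 𝟙-yes (at i Fin.≟ x) (sym (Any.lookup-index x∈E)) ⟨
        𝟙 (at i Fin.≟ x) ≤⟨ term≤∑ _ i ⟩
        ∑[ i < length E ] 𝟙 (at i Fin.≟ x) ∎
        where i = Any.index x∈E

    -- The form in which every greedy choice is made: more candidates than excluded elements.
    avoiding : (E : List (Fin n)) → length E < count P? → ∃ λ x → P x × x ∉ E
    avoiding E |E|<count with Fin.any? (λ x → P? x ×-dec ¬? (Any.any? (x Fin.≟_) E))
    ... | yes found = found
    ... | no  none  = contradiction (count-cover E inside) (<⇒≱ |E|<count)
      where
      inside : ∀ x → P x → x ∈ E
      inside x px = decidable-stable (Any.any? (x Fin.≟_) E) (λ x∉E → none (x , px , x∉E))

    count-injection : ∀ {m} (f : Fin m → Fin n) → (∀ {i j} → f i ≡ f j → i ≡ j) →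
                      (∀ i → P (f i)) → m ≤ count P?
    count-injection {m} f f-injective Pf = begin
      m ≡⟨ *-identityʳ m ⟨
      m * 1 ≡⟨ ∑-const m 1 ⟨
      ∑[ i < m ] 1 ≡⟨ sum-cong-≗ (λ i → sym (trans (∑-select (𝟙 ∘ P?) (f i)) (𝟙-yes (P? (f i)) (Pf i)))) ⟩
      ∑[ i < m ] ∑[ x < n ] (𝟙 (f i Fin.≟ x) * 𝟙 (P? x)) ≡⟨ ∑-comm (λ i x → 𝟙 (f i Fin.≟ x) * 𝟙 (P? x)) ⟩
      ∑[ x < n ] ∑[ i < m ] (𝟙 (f i Fin.≟ x) * 𝟙 (P? x)) ≤⟨ ∑-mono fibre ⟩
      ∑[ x < n ] 𝟙 (P? x) ∎
      where
      open ≤-Reasoning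
      at-most-one : ∀ {m} (f : Fin m → Fin n) → (∀ {i j} → f i ≡ f j → i ≡ j) →
                    ∀ x → ∑[ i < m ] 𝟙 (f i Fin.≟ x) ≤ 1
      at-most-one {zero}  f inj x = z≤n
      at-most-one {suc m} f inj x with f zero Fin.≟ x
      ... | yes refl = s≤s (≤-reflexive (trans (sum-cong-≗ (λ i → 𝟙-no (f (suc i) Fin.≟ x) (λ eq → contradiction (inj eq) λ ())))
                                                 (trans (∑-const m 0) (*-zeroʳ m))))
      ... | no  _    = at-most-one (f ∘ suc) (Fin.suc-injective ∘ inj) x
      fibre : ∀ x → ∑[ i < m ] (𝟙 (f i Fin.≟ x) * 𝟙 (P? x)) ≤ 𝟙 (P? x)
      fibre x = begin
        ∑[ i < m ] (𝟙 (f i Fin.≟ x) * 𝟙 (P? x)) ≡⟨ *-distribʳ-sum (𝟙 (P? x)) (λ i → 𝟙 (f i Fin.≟ x)) ⟨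
        (∑[ i < m ] 𝟙 (f i Fin.≟ x)) * 𝟙 (P? x) ≤⟨ *-monoˡ-≤ (𝟙 (P? x)) (at-most-one f f-injective x) ⟩
        1 * 𝟙 (P? x) ≡⟨ *-identityˡ _ ⟩
        𝟙 (P? x) ∎

  count₂-cover : ∀ {m n p} {P : Fin m → Fin n → Set p} (P? : ∀ x y → Dec (P x y)) →
                 (E : List (Fin m × Fin n)) → (∀ x y → P x y → (x , y) ∈ E) →
                 ∑[ x < m ] count (P? x) ≤ length E
  count₂-cover {m} {n} P? E P⊆E = begin
    ∑[ x < m ] ∑[ y < n ] 𝟙 (P? x y) ≤⟨ ∑-mono (λ x → ∑-mono (λ y → 𝟙-mono (P? x y) (hit x y ∘ P⊆E x y))) ⟩
    ∑[ x < m ] ∑[ y < n ] ∑[ i < length E ] (δ₁ i x * δ₂ i y) ≡⟨ sum-cong-≗ (λ x → ∑-comm (λ y i → δ₁ i x * δ₂ i y)) ⟩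
    ∑[ x < m ] ∑[ i < length E ] ∑[ y < n ] (δ₁ i x * δ₂ i y) ≡⟨ ∑-comm (λ x i → ∑[ y < n ] (δ₁ i x * δ₂ i y)) ⟩
    ∑[ i < length E ] ∑[ x < m ] ∑[ y < n ] (δ₁ i x * δ₂ i y) ≡⟨ sum-cong-≗ total ⟩
    ∑[ i < length E ] 1 ≡⟨ ∑-const (length E) 1 ⟩
    length E * 1 ≡⟨ *-identityʳ _ ⟩
    length E ∎
    where
    open ≤-Reasoning
    at = List.lookup E
    δ₁ : Fin (length E) → Fin m → ℕ
    δ₁ i x = 𝟙 (proj₁ (at i) Fin.≟ x)
    δ₂ : Fin (length E) → Fin n → ℕ
    δ₂ i y = 𝟙 (proj₂ (at i) Fin.≟ y)
    total : ∀ i → ∑[ x < m ] ∑[ y < n ] (δ₁ i x * δ₂ i y) ≡ 1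
    total i = trans (sum-cong-≗ (λ x → trans (sym (*-distribˡ-sum (δ₁ i x) (δ₂ i)))
                                             (trans (cong (δ₁ i x *_) (∑-𝟙-≟ (proj₂ (at i)))) (*-identityʳ _))))
                    (∑-𝟙-≟ (proj₁ (at i)))
    hit : ∀ x y → (x , y) ∈ E → 1 ≤ ∑[ i < length E ] (δ₁ i x * δ₂ i y)
    hit x y xy∈E = begin
      1 ≡⟨ cong₂ _*_ (𝟙-yes (proj₁ (at i) Fin.≟ x) (cong proj₁ eq)) (𝟙-yes (proj₂ (at i) Fin.≟ y) (cong proj₂ eq)) ⟨
      δ₁ i x * δ₂ i y ≤⟨ term≤∑ _ i ⟩
      ∑[ i < length E ] (δ₁ i x * δ₂ i y) ∎
      where
      i  = Any.index xy∈E
      eq = sym (Any.lookup-index xy∈E)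

  -- Both bounds are (b − a t)² ≥ 0 with the subtraction removed.
  square-deficit : ∀ a t δ → 2 * a * (a * t + δ) * t + δ * δ ≡ a * a * (t * t) + (a * t + δ) * (a * t + δ)
  square-deficit = solve 3 (λ a t δ → con 2 :* a :* (a :* t :+ δ) :* t :+ δ :* δ
                                     := a :* a :* (t :* t) :+ (a :* t :+ δ) :* (a :* t :+ δ)) refl
    where open +-*-Solver

  2abt≤a²t²+b² : ∀ a b t → 2 * a * b * t ≤ a * a * (t * t) + b * b
  2abt≤a²t²+b² a b t with ≤-total (a * t) b
  ... | inj₁ at≤b with δ , refl ← m≤n⇒∃[o]m+o≡n at≤b =
    ≤-trans (m≤m+n _ (δ * δ)) (≤-reflexive (square-deficit a t δ))
  ... | inj₂ b≤at with δ , b+δ≡at ← m≤n⇒∃[o]m+o≡n b≤at = begin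
    2 * a * b * t ≡⟨ rearrange a b t ⟩
    2 * b * (a * t) ≡⟨ cong (2 * b *_) b+δ≡at ⟨
    2 * b * (b + δ) ≤⟨ m≤m+n _ (δ * δ) ⟩
    2 * b * (b + δ) + δ * δ ≡⟨ expand b δ ⟩
    (b + δ) * (b + δ) + b * b ≡⟨ cong (λ z → z * z + b * b) b+δ≡at ⟩
    a * t * (a * t) + b * b ≡⟨ cong (_+ b * b) (regroup a t) ⟩
    a * a * (t * t) + b * b ∎
    where
    open ≤-Reasoning
    open +-*-Solver
    rearrange : ∀ a b t → 2 * a * b * t ≡ 2 * b * (a * t)
    rearrange = solve 3 (λ a b t → con 2 :* a :* b :* t := con 2 :* b :* (a :* t)) refl
    expand : ∀ b δ → 2 * b * (b + δ) + δ * δ ≡ (b + δ) * (b + δ) + b * b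
    expand = solve 2 (λ b δ → con 2 :* b :* (b :+ δ) :+ δ :* δ := (b :+ δ) :* (b :+ δ) :+ b :* b) refl
    regroup : ∀ a t → a * t * (a * t) ≡ a * a * (t * t)
    regroup = solve 2 (λ a t → a :* t :* (a :* t) := a :* a :* (t :* t)) refl

  module Fibres {n m} (c : Fin n → Fin m) where

    fibre : Fin m → ℕ
    fibre i = count (λ y → c y Fin.≟ i)

    collisions : ℕ
    collisions = ∑[ y < n ] count (λ y′ → c y Fin.≟ c y′)

    ∑-fibre : sum fibre ≡ n
    ∑-fibre = begin
      ∑[ i < m ] ∑[ y < n ] 𝟙 (c y Fin.≟ i)  ≡⟨ ∑-comm (λ i y → 𝟙 (c y Fin.≟ i)) ⟩
      ∑[ y < n ] ∑[ i < m ] 𝟙 (c y Fin.≟ i)  ≡⟨ sum-cong-≗ (∑-𝟙-≟ ∘ c) ⟩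
      ∑[ y < n ] 1 ≡⟨ ∑-const n 1 ⟩
      n * 1 ≡⟨ *-identityʳ n ⟩
      n ∎
      where open ≡-Reasoning

    ∑-fibre² : ∑[ i < m ] (fibre i * fibre i) ≡ collisions
    ∑-fibre² = begin
      ∑[ i < m ] (fibre i * fibre i) ≡⟨ sum-cong-≗ (λ i → *-distribʳ-sum (fibre i) (λ y → 𝟙 (c y Fin.≟ i))) ⟩
      ∑[ i < m ] ∑[ y < n ] (𝟙 (c y Fin.≟ i) * fibre i) ≡⟨ ∑-comm (λ i y → 𝟙 (c y Fin.≟ i) * fibre i) ⟩
      ∑[ y < n ] ∑[ i < m ] (𝟙 (c y Fin.≟ i) * fibre i) ≡⟨ sum-cong-≗ (∑-select fibre ∘ c) ⟩
      ∑[ y < n ] fibre (c y) ≡⟨ sum-cong-≗ (λ y → sum-cong-≗ (λ y′ → 𝟙-sym (c y′) (c y))) ⟩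
      collisions ∎
      where
      open ≡-Reasoning

    -- The sum over j of (b - a · `fibre j`)² is at least its term at j = i, which is δ². Expanding
    -- the squares with `∑-fibre` and `∑-fibre²` and moving the cross term to the left gives the
    -- inequality. It bounds how far a single fibre can fall below b / a.
    second-moment : ∀ a i δ → let b = a * fibre i + δ in
                    2 * a * b * n + δ * δ ≤ a * a * collisions + m * (b * b)
    second-moment a i δ = begin
      2 * a * b * n + δ * δ ≡⟨ cong₂ (λ s t → 2 * a * b * s + t) (sym ∑-fibre) (sym (∑-select (λ _ → δ * δ) i)) ⟩
      2 * a * b * sum fibre + ∑[ j < m ] (𝟙 (i Fin.≟ j) * (δ * δ)) ≡⟨ cong (_+ _) (*-distribˡ-sum (2 * a * b) fibre) ⟩
      ∑[ j < m ] (2 * a * b * fibre j) + ∑[ j < m ] (𝟙 (i Fin.≟ j) * (δ * δ)) ≡⟨ ∑-distrib-+ (λ j → 2 * a * b * fibre j) (λ j → 𝟙 (i Fin.≟ j) * (δ * δ)) ⟨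
      ∑[ j < m ] (2 * a * b * fibre j + 𝟙 (i Fin.≟ j) * (δ * δ))  ≤⟨ ∑-mono pointwise ⟩
      ∑[ j < m ] (a * a * (fibre j * fibre j) + b * b) ≡⟨ ∑-distrib-+ (λ j → a * a * (fibre j * fibre j)) (λ _ → b * b) ⟩
      ∑[ j < m ] (a * a * (fibre j * fibre j)) + ∑[ _ < m ] (b * b) ≡⟨ cong₂ _+_ (sym (*-distribˡ-sum (a * a) (λ j → fibre j * fibre j))) (∑-const m (b * b)) ⟩
      a * a * ∑[ j < m ] (fibre j * fibre j) + m * (b * b) ≡⟨ cong (λ s → a * a * s + m * (b * b)) ∑-fibre² ⟩
      a * a * collisions + m * (b * b) ∎
      where
      open ≤-Reasoning
      b = a * fibre i + δ
      pointwise : ∀ j → 2 * a * b * fibre j + 𝟙 (i Fin.≟ j) * (δ * δ) ≤ a * a * (fibre j * fibre j) + b * b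
      pointwise j with i Fin.≟ j
      ... | yes refl = ≤-reflexive (trans (cong (2 * a * b * fibre j +_) (*-identityˡ (δ * δ))) (square-deficit a (fibre j) δ))
      ... | no  _    = ≤-trans (≤-reflexive (+-identityʳ _)) (2abt≤a²t²+b² a b (fibre j))

-- A ring solver with integer coefficients for every commutative ring.

module RingSolving where
  open import Algebra.Bundles using (CommutativeRing)
  import Algebra.Properties.AbelianGroup as AbelianGroupProperties
  import Algebra.Properties.Group as GroupProperties
  import Algebra.Properties.Ring as RingProperties
  import Algebra.Properties.Semiring.Mult.TCOptimised as SemiringMult
  import Algebra.Solver.Ring as RingSolver
  open import Algebra.Solver.Ring.AlmostCommutativeRing using (fromCommutativeRing; _-Raw-AlmostCommutative⟶_)
  open import Data.Integer.Base as ℤ using (ℤ; +_; -[1+_]; _⊖_)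
  import Data.Integer.Properties as ℤ
  import Data.Sign.Base as Sign
  open import Data.Maybe.Base using (Maybe; just; nothing)
  open import Data.Nat.Base as ℕ using (ℕ; zero; suc)
  import Data.Nat.Properties as ℕ
  open import Relation.Binary.PropositionalEquality as ≡ using (_≡_)
  open import Relation.Nullary using (yes; no)

  module IntegerCoefficients {c ℓ} (R : CommutativeRing c ℓ) where
    open CommutativeRing R
    open SemiringMult semiring using (_×_; 1+×; ×-homo-+; ×1-homo-*)
    open RingProperties ring using (-‿distribˡ-*; -‿distribʳ-*)
    open GroupProperties +-group using (ε⁻¹≈ε; ⁻¹-involutive)
    open AbelianGroupProperties +-abelianGroup using (⁻¹-∙-comm)
    open import Relation.Binary.Reasoning.Setoid setoid

    -- The optimised multiple makes `1 × 1#` reduce to `1#`, so the constants 0 and 1 of a solver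
    -- expression evaluate to the ring's own.
    fromℤ : ℤ → Carrier
    fromℤ (+ n)      = n × 1#
    fromℤ -[1+ n ]   = - (suc n × 1#)

    cancel-head : ∀ x y z → (x + y) - (x + z) ≈ y - z
    cancel-head x y z = begin
      (x + y) + - (x + z) ≈⟨ +-cong (+-comm x y) (sym (⁻¹-∙-comm x z)) ⟩
      (y + x) + (- x + - z) ≈⟨ +-assoc y x _ ⟩
      y + (x + (- x + - z)) ≈⟨ +-congˡ (+-assoc x (- x) (- z)) ⟨
      y + ((x + - x) + - z) ≈⟨ +-congˡ (+-congʳ (-‿inverseʳ x)) ⟩
      y + (0# + - z) ≈⟨ +-congˡ (+-identityˡ (- z)) ⟩
      y + - z ∎

    fromℤ-⊖ : ∀ m n → fromℤ (m ⊖ n) ≈ m × 1# - n × 1#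
    fromℤ-⊖ zero    zero    = sym (-‿inverseʳ 0#)
    fromℤ-⊖ zero    (suc n) = sym (+-identityˡ _)
    fromℤ-⊖ (suc m) zero    = sym (trans (+-congˡ ε⁻¹≈ε) (+-identityʳ _))
    fromℤ-⊖ (suc m) (suc n) = begin
      fromℤ (suc m ⊖ suc n) ≡⟨ ≡.cong fromℤ (ℤ.[1+m]⊖[1+n]≡m⊖n m n) ⟩
      fromℤ (m ⊖ n) ≈⟨ fromℤ-⊖ m n ⟩
      m × 1# - n × 1# ≈⟨ cancel-head 1# _ _ ⟨
      (1# + m × 1#) - (1# + n × 1#) ≈⟨ +-cong (1+× m 1#) (-‿cong (1+× n 1#)) ⟨
      suc m × 1# - suc n × 1# ∎

    fromℤ-neg : ∀ i → fromℤ (ℤ.- i) ≈ - fromℤ i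
    fromℤ-neg (+ zero)  = sym ε⁻¹≈ε
    fromℤ-neg (+ suc n) = refl
    fromℤ-neg -[1+ n ]  = sym (⁻¹-involutive _)

    fromℤ-+ : ∀ i j → fromℤ (i ℤ.+ j) ≈ fromℤ i + fromℤ j
    fromℤ-+ (+ m)    (+ n)    = ×-homo-+ 1# m n
    fromℤ-+ (+ m)    -[1+ n ] = fromℤ-⊖ m (suc n)
    fromℤ-+ -[1+ m ] (+ n)    = trans (fromℤ-⊖ n (suc m)) (+-comm _ _)
    fromℤ-+ -[1+ m ] -[1+ n ] = begin
      - (suc (suc (m ℕ.+ n)) × 1#) ≡⟨ ≡.cong (λ z → - (suc z × 1#)) (ℕ.+-suc m n) ⟨
      - ((suc m ℕ.+ suc n) × 1#) ≈⟨ -‿cong (×-homo-+ 1# (suc m) (suc n)) ⟩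
      - (suc m × 1# + suc n × 1#) ≈⟨ ⁻¹-∙-comm _ _ ⟨
      - (suc m × 1#) + - (suc n × 1#) ∎

    fromℤ-* : ∀ i j → fromℤ (i ℤ.* j) ≈ fromℤ i * fromℤ j
    fromℤ-* (+ m)    (+ n)    = trans (reflexive (≡.cong fromℤ (ℤ.+◃n≡+n (m ℕ.* n)))) (×1-homo-* m n)
    fromℤ-* (+ m)    -[1+ n ] = begin
      fromℤ (Sign.- ℤ.◃ (m ℕ.* suc n)) ≡⟨ ≡.cong fromℤ (ℤ.-◃n≡-n (m ℕ.* suc n)) ⟩
      fromℤ (ℤ.- (+ (m ℕ.* suc n))) ≈⟨ fromℤ-neg (+ (m ℕ.* suc n)) ⟩
      - ((m ℕ.* suc n) × 1#) ≈⟨ -‿cong (×1-homo-* m (suc n)) ⟩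
      - (m × 1# * suc n × 1#) ≈⟨ -‿distribʳ-* _ _ ⟩
      m × 1# * - (suc n × 1#) ∎
    fromℤ-* -[1+ m ] (+ n)    = begin
      fromℤ (Sign.- ℤ.◃ (suc m ℕ.* n)) ≡⟨ ≡.cong fromℤ (ℤ.-◃n≡-n (suc m ℕ.* n)) ⟩
      fromℤ (ℤ.- (+ (suc m ℕ.* n))) ≈⟨ fromℤ-neg (+ (suc m ℕ.* n)) ⟩
      - ((suc m ℕ.* n) × 1#) ≈⟨ -‿cong (×1-homo-* (suc m) n) ⟩
      - (suc m × 1# * n × 1#) ≈⟨ -‿distribˡ-* _ _ ⟩
      - (suc m × 1#) * n × 1# ∎
    fromℤ-* -[1+ m ] -[1+ n ] = begin
      fromℤ (Sign.+ ℤ.◃ (suc m ℕ.* suc n)) ≡⟨ ≡.cong fromℤ (ℤ.+◃n≡+n (suc m ℕ.* suc n)) ⟩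
      (suc m ℕ.* suc n) × 1# ≈⟨ ×1-homo-* (suc m) (suc n) ⟩
      suc m × 1# * suc n × 1# ≈⟨ ⁻¹-involutive _ ⟨
      - - (suc m × 1# * suc n × 1#) ≈⟨ -‿cong (-‿distribʳ-* _ _) ⟩
      - (suc m × 1# * - (suc n × 1#)) ≈⟨ -‿distribˡ-* _ _ ⟩
      - (suc m × 1#) * - (suc n × 1#) ∎

    morphism : ℤ.+-*-rawRing -Raw-AlmostCommutative⟶ fromCommutativeRing R
    morphism = record
      { ⟦_⟧    = fromℤ
      ; +-homo = fromℤ-+
      ; *-homo = fromℤ-*
      ; -‿homo = fromℤ-neg
      ; 0-homo = refl
      ; 1-homo = refl
      }

    -- Equality in ℤ is sufficient but not necessary: in characteristic p different integers may
    -- have the same image. Only identities valid in all commutative rings are solved this way.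
    coefficient≟ : ∀ i j → Maybe (fromℤ i ≈ fromℤ j)
    coefficient≟ i j with i ℤ.≟ j
    ... | yes ≡.refl = just refl
    ... | no  _      = nothing

    open RingSolver ℤ.+-*-rawRing (fromCommutativeRing R) morphism coefficient≟ public
      using (solve; _:=_; _:+_; _:*_; _:-_; :-_; con)

-- Finite fields on `Fin q`, polynomials as coefficient vectors, and their roots.

module FiniteFields where
  open Counting
  open RingSolving
  open import Algebra.Bundles using (CommutativeRing)
  open import Algebra.Structures using (IsCommutativeRing)
  import Algebra.Properties.Ring as RingProperties
  import Algebra.Properties.Group as GroupProperties
  import Algebra.Properties.Semiring.Exp as SemiringExp
  import Algebra.Properties.CommutativeSemiring.Exp as CommutativeSemiringExp
  open import Data.Fin.Base as Fin using (Fin; zero; suc; fromℕ)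
  import Data.Fin.Properties as Fin
  open import Data.Nat.Base as ℕ using (ℕ; zero; suc)
  open import Data.Integer.Base using (0ℤ)
  open import Data.Product.Base using (_,_; ∃)
  open import Function.Base using (_∘_)
  open import Level using (0ℓ)
  open import Relation.Binary.PropositionalEquality
  open import Relation.Nullary

  injective⇒surjective : ∀ {n} (f : Fin n → Fin n) → (∀ {i j} → f i ≡ f j → i ≡ j) → ∀ y → ∃ λ i → f i ≡ y
  injective⇒surjective {suc n} f f-injective y with Fin.any? (λ i → f i Fin.≟ y)
  ... | yes found = found
  ... | no  none  = contradiction (Fin.injective⇒≤ punch-injective) (ℕ.<-irrefl refl)
    where
    import Data.Nat.Properties as ℕ
    y≢f : ∀ i → y ≢ f i
    y≢f i y≡fi = none (i , sym y≡fi)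
    punch-injective : ∀ {i j} → Fin.punchOut (y≢f i) ≡ Fin.punchOut (y≢f j) → i ≡ j
    punch-injective {i} {j} = f-injective ∘ Fin.punchOut-injective (y≢f i) (y≢f j)

  record FiniteField (q : ℕ) : Set where
    infix  9 _⁻¹
    infix  8 -_
    infixl 7 _*_
    infixl 6 _+_
    field
      _+_ _*_           : Fin q → Fin q → Fin q
      -_ _⁻¹            : Fin q → Fin q
      0# 1#             : Fin q
      isCommutativeRing : IsCommutativeRing _≡_ _+_ _*_ -_ 0# 1#
      1≢0               : 1# ≢ 0#
      *-inverseʳ        : ∀ {x} → x ≢ 0# → x * x ⁻¹ ≡ 1#

    commutativeRing : CommutativeRing 0ℓ 0ℓ
    commutativeRing = record { isCommutativeRing = isCommutativeRing }

    open CommutativeRing commutativeRing public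
      using (_-_; +-comm; +-identityˡ; +-identityʳ; *-comm; *-assoc; *-identityˡ; *-identityʳ; zeroˡ; zeroʳ; ring; semiring; commutativeSemiring; +-group; -‿inverseʳ)
    open SemiringExp semiring public using (_^_; ^-homo-*; ^-assocʳ)
    open CommutativeSemiringExp commutativeSemiring public using (^-distrib-*)
    open IntegerCoefficients commutativeRing public using (solve; _:=_; _:+_; _:*_; _:-_; :-_; con)

  module FieldProperties {q} (𝔽 : FiniteField q) where
    open FiniteField 𝔽
    open RingProperties ring public using (-‿distribˡ-*; -‿distribʳ-*)
    open GroupProperties +-group public using (ε⁻¹≈ε; ⁻¹-involutive) renaming (x∙y⁻¹≈ε⇒x≈y to x-y≡0⇒x≡y; x≈y⇒x∙y⁻¹≈ε to x≡y⇒x-y≡0)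
    open ≡-Reasoning

    *-cancelˡ-≢0 : ∀ {x y z} → x ≢ 0# → x * y ≡ x * z → y ≡ z
    *-cancelˡ-≢0 {x} {y} {z} x≢0 xy≡xz = trans (sym (undo y)) (trans (cong (x ⁻¹ *_) xy≡xz) (undo z))
      where
      undo : ∀ y → x ⁻¹ * (x * y) ≡ y
      undo y = trans (solve 3 (λ i x y → i :* (x :* y) := x :* i :* y) refl (x ⁻¹) x y)
                     (trans (cong (_* y) (*-inverseʳ x≢0)) (*-identityˡ y))

    x*y≡0⇒y≡0 : ∀ {x y} → x ≢ 0# → x * y ≡ 0# → y ≡ 0#
    x*y≡0⇒y≡0 {x} x≢0 xy≡0 = *-cancelˡ-≢0 x≢0 (trans xy≡0 (sym (zeroʳ x)))

    *-≢0 : ∀ {x y} → x ≢ 0# → y ≢ 0# → x * y ≢ 0#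
    *-≢0 x≢0 y≢0 = y≢0 ∘ x*y≡0⇒y≡0 x≢0

    ^-≢0 : ∀ {x} → x ≢ 0# → ∀ n → x ^ n ≢ 0#
    ^-≢0 x≢0 zero    = 1≢0
    ^-≢0 x≢0 (suc n) = *-≢0 x≢0 (^-≢0 x≢0 n)

    -‿≢0 : ∀ {x} → x ≢ 0# → - x ≢ 0#
    -‿≢0 x≢0 -x≡0 = x≢0 (trans (sym (⁻¹-involutive _)) (trans (cong -_ -x≡0) ε⁻¹≈ε))

    1^n≡1 : ∀ n → 1# ^ n ≡ 1#
    1^n≡1 zero    = refl
    1^n≡1 (suc n) = trans (*-identityˡ _) (1^n≡1 n)

    ^-*-≡1 : ∀ x m n → x ^ m ≡ 1# → x ^ (m ℕ.* n) ≡ 1#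
    ^-*-≡1 x m n xᵐ≡1 = trans (sym (^-assocʳ x m n)) (trans (cong (_^ n) xᵐ≡1) (1^n≡1 n))

    eval : ∀ {d} → (Fin d → Fin q) → Fin q → Fin q
    eval {zero}  f x = 0#
    eval {suc d} f x = f zero + x * eval (f ∘ suc) x

    -- The quotient of f by x − a: its coefficients are the values at a of the tails of f.
    quotient : ∀ {d} → (Fin (suc d) → Fin q) → Fin q → Fin d → Fin q
    quotient f a zero    = eval (f ∘ suc) a
    quotient f a (suc i) = quotient (f ∘ suc) a i

    eval-quotient : ∀ {d} (f : Fin (suc d) → Fin q) a x → eval f x - eval f a ≡ (x - a) * eval (quotient f a) x
    eval-quotient {zero}  f a x = solve 3 (λ c a x → c :+ x :* con 0ℤ :- (c :+ a :* con 0ℤ) := (x :- a) :* con 0ℤ) refl (f zero) a x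
    eval-quotient {suc d} f a x = begin
      f zero + x * eval g x - (f zero + a * eval g a) ≡⟨ solve 5 (λ c x a u v → c :+ x :* u :- (c :+ a :* v) := (x :- a) :* v :+ x :* (u :- v)) refl (f zero) x a (eval g x) (eval g a) ⟩
      (x - a) * eval g a + x * (eval g x - eval g a) ≡⟨ cong (λ z → (x - a) * eval g a + x * z) (eval-quotient g a x) ⟩
      (x - a) * eval g a + x * ((x - a) * eval (quotient g a) x) ≡⟨ solve 4 (λ d v x w → d :* v :+ x :* (d :* w) := d :* (v :+ x :* w)) refl (x - a) (eval g a) x (eval (quotient g a) x) ⟩
      (x - a) * (eval g a + x * eval (quotient g a) x) ∎
      where g = f ∘ suc

    -- From f = (x - a) · `quotient f a` + f(a), read coefficient by coefficient: over a finite
    -- field the values of a polynomial need not determine its coefficients, so `eval-quotient`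
    -- alone would not suffice.
    quotient≡0⇒f≡0 : ∀ {d} (f : Fin (suc d) → Fin q) a → (∀ i → quotient f a i ≡ 0#) → eval f a ≡ 0# → ∀ i → f i ≡ 0#
    quotient≡0⇒f≡0 {zero}  f a _ fa≡0 zero = trans (sym (trans (cong (f zero +_) (zeroʳ a)) (+-identityʳ _))) fa≡0
    quotient≡0⇒f≡0 {suc d} f a q≡0 fa≡0 zero = begin
      f zero ≡⟨ solve 2 (λ c a → c := c :+ a :* con 0ℤ) refl (f zero) a ⟩
      f zero + a * 0# ≡⟨ cong (λ z → f zero + a * z) (q≡0 zero) ⟨
      eval f a ≡⟨ fa≡0 ⟩
      0# ∎
    quotient≡0⇒f≡0 {suc d} f a q≡0 fa≡0 (suc i) = quotient≡0⇒f≡0 (f ∘ suc) a (q≡0 ∘ suc) (q≡0 zero) i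

    -- d coefficients mean degree below d. Dividing by x - r₀ removes one coefficient and one root;
    -- the other roots survive because r is injective.
    many-roots⇒zero : ∀ {d} (f r : Fin d → Fin q) → (∀ {i j} → r i ≡ r j → i ≡ j) →
                      (∀ i → eval f (r i) ≡ 0#) → ∀ i → f i ≡ 0#
    many-roots⇒zero {suc d} f r r-injective root =
      quotient≡0⇒f≡0 f a (many-roots⇒zero (quotient f a) (r ∘ suc) (Fin.suc-injective ∘ r-injective) root′) (root zero)
      where
      a = r zero
      root′ : ∀ i → eval (quotient f a) (r (suc i)) ≡ 0#
      root′ i = x*y≡0⇒y≡0 (λ eq → contradiction (r-injective (x-y≡0⇒x≡y _ _ eq)) λ ())
        (trans (sym (eval-quotient f a (r (suc i)))) (trans (cong₂ _-_ (root (suc i)) (root zero)) (-‿inverseʳ 0#)))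

    monomial : ∀ d → Fin (suc d) → Fin q
    monomial zero    _       = 1#
    monomial (suc d) zero    = 0#
    monomial (suc d) (suc i) = monomial d i

    eval-monomial : ∀ d x → eval (monomial d) x ≡ x ^ d
    eval-monomial zero    x = trans (cong (λ z → 1# + z) (zeroʳ x)) (+-identityʳ 1#)
    eval-monomial (suc d) x = trans (+-identityˡ _) (cong (x *_) (eval-monomial d x))

    monomial-top : ∀ d → monomial d (fromℕ d) ≡ 1#
    monomial-top zero    = refl
    monomial-top (suc d) = monomial-top d

    few-dth-roots : ∀ {d c} → 0 ℕ.< d → (r : Fin (suc d) → Fin q) → (∀ {i j} → r i ≡ r j → i ≡ j) →
                    ¬ (∀ i → r i ^ d ≡ c)
    few-dth-roots {suc d} {c} _ r r-injective rᵈ≡c =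
      1≢0 (trans (sym (monomial-top d)) (many-roots⇒zero f r r-injective root (suc (fromℕ d))))
      where
      f : Fin (suc (suc d)) → Fin q
      f zero    = - c
      f (suc i) = monomial d i
      root : ∀ i → eval f (r i) ≡ 0#
      root i = begin
        - c + r i * eval (monomial d) (r i)  ≡⟨ cong (λ z → - c + r i * z) (eval-monomial d (r i)) ⟩
        - c + r i ^ suc d ≡⟨ cong (- c +_) (rᵈ≡c i) ⟩
        - c + c ≡⟨ solve 1 (λ c → :- c :+ c := con 0ℤ) refl c ⟩
        0# ∎

    little-fermat : ∀ n → (∀ x → x ^ suc n ≡ x) → ∀ {x} → x ≢ 0# → x ^ n ≡ 1#
    little-fermat n x^q≡x {x} x≢0 = *-cancelˡ-≢0 x≢0 (trans (x^q≡x x) (sym (*-identityʳ x)))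

-- The Frobenius map in characteristic p.

module FrobeniusMap where
  open import Algebra.Bundles using (CommutativeRing)
  import Algebra.Properties.CommutativeSemiring.Binomial as Binomial
  import Algebra.Properties.Semiring.Exp as SemiringExp
  import Algebra.Properties.Semiring.Mult as UnoptimisedMult
  import Algebra.Properties.Semiring.Sum as SemiringSum
  import Data.Fin.Properties as Fin
  open import Data.Fin.Base as Fin using (Fin; zero; suc; toℕ; fromℕ; inject₁)
  open import Data.Nat.Base as ℕ using (ℕ; zero; suc; NonZero; s≤s; z<s; _!)
  import Data.Nat.Properties as ℕ
  open import Data.Nat.Combinatorics using (_C_; nCk≡n!/k![n-k]!; k![n∸k]!∣n!; nCn≡1)
  open import Data.Nat.Divisibility using (_∣_; _∤_; divides; ∣⇒≤; m∣m*n; ∣1⇒≡1)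
  open import Data.Nat.DivMod using (m/n*n≡m)
  open import Data.Nat.Primality using (Prime; euclidsLemma; prime⇒nonZero; ¬prime[1])
  open import Data.Product.Base using (_×_; _,_)
  open import Data.Sum.Base using ([_,_]′)
  open import Data.Vec.Functional using (init)
  open import Function.Base using (_∘_)
  open import Relation.Binary.PropositionalEquality as ≡ using (_≡_; cong; subst)
  open import Relation.Nullary

  prime-∤-! : ∀ {p} → Prime p → ∀ m → m ℕ.< p → p ∤ m !
  prime-∤-! p-prime zero    _   p∣1 = contradiction (subst Prime (∣1⇒≡1 p∣1) p-prime) ¬prime[1]
  prime-∤-! p-prime (suc m) m<p p∣! =
    [ (λ p∣1+m → ℕ.<⇒≱ m<p (∣⇒≤ p∣1+m)) , prime-∤-! p-prime m (ℕ.<-trans (ℕ.n<1+n m) m<p) ]′ (euclidsLemma (suc m) (m !) p-prime p∣!)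

  -- p divides p! = (p C k) · k! · (p - k)!, but neither of the two factorials, whose factors are
  -- all below p.
  prime-∣-C : ∀ {p k} → Prime p → 0 ℕ.< k → k ℕ.< p → p ∣ p C k
  prime-∣-C {p@(suc p-1)} {k@(suc _)} p-prime _ k<p =
    [ (λ p∣C → p∣C) , (λ p∣k![p-k]! → contradiction p∣k![p-k]! ∤denominator) ]′ (euclidsLemma (p C k) (k ! ℕ.* (p ℕ.∸ k) !) p-prime p∣product)
    where
    instance
      denominator≢0 : NonZero (k ! ℕ.* (p ℕ.∸ k) !)
      denominator≢0 = k ℕ.!* (p ℕ.∸ k) !≢0
    k≤p : k ℕ.≤ p
    k≤p = ℕ.<⇒≤ k<p
    p∣product : p ∣ (p C k) ℕ.* (k ! ℕ.* (p ℕ.∸ k) !)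
    p∣product = subst (p ∣_) (≡.sym (≡.trans (cong (ℕ._* (k ! ℕ.* (p ℕ.∸ k) !)) (nCk≡n!/k![n-k]! k≤p)) (m/n*n≡m (k![n∸k]!∣n! k≤p)))) (m∣m*n (p-1 !))
    ∤denominator : p ∤ k ! ℕ.* (p ℕ.∸ k) !
    ∤denominator p∣ = [ prime-∤-! p-prime k k<p , prime-∤-! p-prime (p ℕ.∸ k) (ℕ.∸-monoʳ-< {o = 0} z<s k≤p) ]′ (euclidsLemma (k !) ((p ℕ.∸ k) !) p-prime p∣)

  module Frobenius {c ℓ} (R : CommutativeRing c ℓ) (p : ℕ) (p-prime : Prime p)
    (p×1≈0 : CommutativeRing._≈_ R (UnoptimisedMult._×_ (CommutativeRing.semiring R) p (CommutativeRing.1# R)) (CommutativeRing.0# R)) where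
    open CommutativeRing R hiding (zero)
    open UnoptimisedMult semiring renaming (_×_ to _·_)
    open SemiringExp semiring
    open SemiringSum semiring using (sum; sum-cong-≋; sum-init-last; sum-replicate-zero)
    open Binomial commutativeSemiring using (theorem; binomialTerm)
    open import Relation.Binary.Reasoning.Setoid setoid

    p·x≈0 : ∀ x → p · x ≈ 0#
    p·x≈0 x = begin
      p · x ≈⟨ ×-congʳ p (*-identityˡ x) ⟨
      p · (1# * x) ≈⟨ ×-assoc-* p 1# x ⟨
      (p · 1#) * x ≈⟨ *-congʳ p×1≈0 ⟩
      0# * x ≈⟨ zeroˡ x ⟩
      0# ∎

    multiple·x≈0 : ∀ {j} x → p ∣ j → j · x ≈ 0#
    multiple·x≈0 {j} x (divides c ≡.refl) = begin
      (c ℕ.* p) · x ≡⟨ cong (_· x) (ℕ.*-comm c p) ⟩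
      (p ℕ.* c) · x ≈⟨ ×-assocˡ x p c ⟨
      p · (c · x) ≈⟨ p·x≈0 (c · x) ⟩
      0# ∎

    frobenius-+ : ∀ x y → (x + y) ^ p ≈ x ^ p + y ^ p
    frobenius-+ x y = expand (ℕ.suc-pred p {{prime⇒nonZero p-prime}})
      where
      expand : ∀ {m} → suc m ≡ p → (x + y) ^ p ≈ x ^ p + y ^ p
      expand {m} ≡.refl = begin
        (x + y) ^ p ≈⟨ theorem p x y ⟩
        term zero + sum (term ∘ suc) ≈⟨ +-congˡ (sum-init-last (term ∘ suc)) ⟩
        term zero + (sum (init (term ∘ suc)) + term (suc (fromℕ m)))
          ≈⟨ +-cong first (+-cong (trans (sum-cong-≋ middle) (sum-replicate-zero m)) final) ⟩
        y ^ p + (0# + x ^ p) ≈⟨ +-congˡ (+-identityˡ (x ^ p)) ⟩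
        y ^ p + x ^ p ≈⟨ +-comm (y ^ p) (x ^ p) ⟩
        x ^ p + y ^ p ∎
        where
        term : Fin (suc p) → Carrier
        term = binomialTerm x y p
        first : term zero ≈ y ^ p
        first = trans (×-homo-1 _) (*-identityˡ (y ^ p))
        middle : ∀ i → term (suc (inject₁ i)) ≈ 0#
        middle i = multiple·x≈0 _ (prime-∣-C p-prime z<s
          (≡.subst (λ j → suc j ℕ.< p) (≡.sym (Fin.toℕ-inject₁ i)) (s≤s (Fin.toℕ<n i))))
        final : term (suc (fromℕ m)) ≈ x ^ p
        final = begin
          (p C toℕ (fromℕ p)) · (x ^ toℕ (fromℕ p) * y ^ (p ℕ.∸ toℕ (fromℕ p)))
            ≡⟨ cong (λ j → (p C j) · (x ^ j * y ^ (p ℕ.∸ j))) (Fin.toℕ-fromℕ p) ⟩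
          (p C p) · (x ^ p * y ^ (p ℕ.∸ p))  ≡⟨ ≡.cong₂ (λ c e → c · (x ^ p * y ^ e)) (nCn≡1 p) (ℕ.n∸n≡0 p) ⟩
          1 · (x ^ p * 1#) ≈⟨ ×-homo-1 _ ⟩
          x ^ p * 1# ≈⟨ *-identityʳ (x ^ p) ⟩
          x ^ p ∎

-- The group algebra of a cyclic group over the prime field.

module GroupAlgebras where
  open Counting
  open FrobeniusMap
  open import Algebra.Bundles using (CommutativeRing)
  open import Data.Fin.Base as Fin using (Fin; zero; suc; toℕ; fromℕ<; finToFun; funToFin)
  import Data.Fin.Properties as Fin
  open import Data.List.Base as List using (List; []; _∷_; _++_; map; allFin)
  open import Data.List.Membership.Propositional.Properties using (∈-allFin)
  open import Data.List.Relation.Unary.All as All using ([]; _∷_; All)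
  open import Data.List.Relation.Unary.Any as Any using (Any)
  import Data.List.Relation.Unary.Any.Properties as Any
  open import Data.Nat.Base as ℕ using (ℕ; zero; suc; NonZero; _+_; _*_; _%_; _<_; z≤n; s≤s; z<s; _≤_)
  import Data.Nat.Properties as ℕ
  open import Algebra.Properties.Semiring.Sum ℕ.+-*-semiring using (sum; sum-cong-≗; ∑-distrib-+; sum-syntax)
  open import Data.Nat.DivMod using (%-distribˡ-+; %-distribˡ-*; m%n%n≡m%n; m%n<n; [m+n]%n≡m%n; m≡m%n+[m/n]*n; m<n⇒m%n≡m; m*n%n≡0)
  open import Data.Nat.Solver using (module +-*-Solver)
  open import Data.Product.Base using (_,_; _×_)
  open import Function.Base using (_∘_)
  open import Level using (0ℓ)
  open import Relation.Binary.PropositionalEquality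
  open import Relation.Nullary
  open import Relation.Nullary.Decidable using (map′)
  import Algebra.Properties.Semiring.Exp as SemiringExp
  import Algebra.Properties.Semiring.Mult as UnoptimisedMult
  import Data.List.Relation.Unary.All.Properties as All
  open import Data.Nat.Primality using (Prime; prime⇒nonTrivial)

  ∑ₗ : List ℕ → (ℕ → ℕ) → ℕ
  ∑ₗ []      h = 0
  ∑ₗ (i ∷ a) h = h i + ∑ₗ a h

  ∑ₗ-++ : ∀ a b h → ∑ₗ (a ++ b) h ≡ ∑ₗ a h + ∑ₗ b h
  ∑ₗ-++ []      b h = refl
  ∑ₗ-++ (i ∷ a) b h = trans (cong (h i +_) (∑ₗ-++ a b h)) (sym (ℕ.+-assoc (h i) _ _))

  ∑ₗ-map : ∀ f a h → ∑ₗ (map f a) h ≡ ∑ₗ a (h ∘ f)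
  ∑ₗ-map f []      h = refl
  ∑ₗ-map f (i ∷ a) h = cong (h (f i) +_) (∑ₗ-map f a h)

  ∑ₗ-cong : ∀ a {h h′} → (∀ i → h i ≡ h′ i) → ∑ₗ a h ≡ ∑ₗ a h′
  ∑ₗ-cong []      h≗h′ = refl
  ∑ₗ-cong (i ∷ a) h≗h′ = cong₂ _+_ (h≗h′ i) (∑ₗ-cong a h≗h′)

  ∑ₗ-+ : ∀ a h h′ → ∑ₗ a (λ i → h i + h′ i) ≡ ∑ₗ a h + ∑ₗ a h′
  ∑ₗ-+ []      h h′ = refl
  ∑ₗ-+ (i ∷ a) h h′ = trans (cong (h i + h′ i +_) (∑ₗ-+ a h h′))
    (solve 4 (λ x y u v → x :+ y :+ (u :+ v) := x :+ u :+ (y :+ v)) refl (h i) (h′ i) (∑ₗ a h) (∑ₗ a h′))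
    where open +-*-Solver

  ∑ₗ-zero : ∀ a → ∑ₗ a (λ _ → 0) ≡ 0
  ∑ₗ-zero []      = refl
  ∑ₗ-zero (i ∷ a) = ∑ₗ-zero a

  ∑ₗ-swap : ∀ a b (f : ℕ → ℕ → ℕ) → ∑ₗ a (λ i → ∑ₗ b (f i)) ≡ ∑ₗ b (λ j → ∑ₗ a (λ i → f i j))
  ∑ₗ-swap []      b f = sym (∑ₗ-zero b)
  ∑ₗ-swap (i ∷ a) b f = trans (cong (∑ₗ b (f i) +_) (∑ₗ-swap a b f)) (sym (∑ₗ-+ b (f i) (λ j → ∑ₗ a (λ i → f i j))))

  ∑ₗ-∑ : ∀ a {m} (f : ℕ → Fin m → ℕ) → ∑ₗ a (λ i → sum (f i)) ≡ ∑[ r < m ] ∑ₗ a (λ i → f i r)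
  ∑ₗ-∑ []      {m} f = sym (trans (∑-const m 0) (ℕ.*-zeroʳ m))
  ∑ₗ-∑ (i ∷ a)     f = trans (cong (sum (f i) +_) (∑ₗ-∑ a f)) (sym (∑-distrib-+ (f i) (λ r → ∑ₗ a (λ i → f i r))))

  ∑ₗ-* : ∀ a c h → ∑ₗ a (λ i → c * h i) ≡ c * ∑ₗ a h
  ∑ₗ-* []      c h = sym (ℕ.*-zeroʳ c)
  ∑ₗ-* (i ∷ a) c h = trans (cong (c * h i +_) (∑ₗ-* a c h)) (sym (ℕ.*-distribˡ-+ c (h i) (∑ₗ a h)))

  copies : ℕ → List ℕ → List ℕ
  copies zero    a = []
  copies (suc m) a = a ++ copies m a

  ∑ₗ-copies : ∀ m a h → ∑ₗ (copies m a) h ≡ m * ∑ₗ a h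
  ∑ₗ-copies zero    a h = refl
  ∑ₗ-copies (suc m) a h = trans (∑ₗ-++ a (copies m a) h) (cong (∑ₗ a h +_) (∑ₗ-copies m a h))

  infixl 7 _⊗_
  _⊗_ : List ℕ → List ℕ → List ℕ
  []      ⊗ b = []
  (i ∷ a) ⊗ b = map (i +_) b ++ a ⊗ b

  ∑ₗ-⊗ : ∀ a b h → ∑ₗ (a ⊗ b) h ≡ ∑ₗ a (λ i → ∑ₗ b (λ j → h (i + j)))
  ∑ₗ-⊗ []      b h = refl
  ∑ₗ-⊗ (i ∷ a) b h = trans (∑ₗ-++ (map (i +_) b) (a ⊗ b) h) (cong₂ _+_ (∑ₗ-map (i +_) b h) (∑ₗ-⊗ a b h))

  -- The group algebra 𝔽ₚ[X] / (Xⁿ − 1): a list of exponents stands for the sum of the corresponding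
  -- powers of X, and two lists are identified if they have the same pairing modulo p with every
  -- n-periodic function.
  module GroupAlgebra (p n : ℕ) .{{_ : NonZero p}} .{{_ : NonZero n}} where

    Periodic : (ℕ → ℕ) → Set
    Periodic h = ∀ i → h (i + n) ≡ h i

    infix 4 _≈_
    record _≈_ (a b : List ℕ) : Set where
      constructor mk≈
      field pairing : ∀ h → Periodic h → ∑ₗ a h % p ≡ ∑ₗ b h % p
    open _≈_ public

    exact : ∀ {a b} → (∀ h → Periodic h → ∑ₗ a h ≡ ∑ₗ b h) → a ≈ b
    exact eq = mk≈ (λ h periodic → cong (_% p) (eq h periodic))

    ≈-refl : ∀ {a} → a ≈ a
    ≈-refl = mk≈ (λ _ _ → refl)
    ≈-sym : ∀ {a b} → a ≈ b → b ≈ a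
    ≈-sym a≈b = mk≈ (λ h periodic → sym (pairing a≈b h periodic))
    ≈-trans : ∀ {a b c} → a ≈ b → b ≈ c → a ≈ c
    ≈-trans a≈b b≈c = mk≈ (λ h periodic → trans (pairing a≈b h periodic) (pairing b≈c h periodic))

    %-cong-+ : ∀ {x x′ y y′} → x % p ≡ x′ % p → y % p ≡ y′ % p → (x + y) % p ≡ (x′ + y′) % p
    %-cong-+ {x} {x′} {y} {y′} x≡ y≡ = trans (%-distribˡ-+ x y p) (trans (cong₂ (λ a b → (a + b) % p) x≡ y≡) (sym (%-distribˡ-+ x′ y′ p)))

    %-cong-* : ∀ {x x′ y y′} → x % p ≡ x′ % p → y % p ≡ y′ % p → (x * y) % p ≡ (x′ * y′) % p
    %-cong-* {x} {x′} {y} {y′} x≡ y≡ = trans (%-distribˡ-* x y p) (trans (cong₂ (λ a b → (a * b) % p) x≡ y≡) (sym (%-distribˡ-* x′ y′ p)))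

    inner-periodic : ∀ {h} → Periodic h → ∀ b → Periodic (λ i → ∑ₗ b (λ j → h (i + j)))
    inner-periodic {h} periodic b i = ∑ₗ-cong b (λ j → trans (cong h (solve 3 (λ i n j → i :+ n :+ j := i :+ j :+ n) refl i n j)) (periodic (i + j)))
      where open +-*-Solver

    ++-cong : ∀ {a a′ b b′} → a ≈ a′ → b ≈ b′ → a ++ b ≈ a′ ++ b′
    ++-cong {a} {a′} {b} {b′} a≈a′ b≈b′ = mk≈ λ h periodic →
      subst₂ (λ s t → s % p ≡ t % p) (sym (∑ₗ-++ a b h)) (sym (∑ₗ-++ a′ b′ h))
        (%-cong-+ {∑ₗ a h} {∑ₗ a′ h} {∑ₗ b h} {∑ₗ b′ h} (pairing a≈a′ h periodic) (pairing b≈b′ h periodic))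

    ++-comm : ∀ a b → a ++ b ≈ b ++ a
    ++-comm a b = exact λ h _ → trans (∑ₗ-++ a b h) (trans (ℕ.+-comm (∑ₗ a h) (∑ₗ b h)) (sym (∑ₗ-++ b a h)))

    copies-cong : ∀ m {a a′} → a ≈ a′ → copies m a ≈ copies m a′
    copies-cong zero    a≈a′ = ≈-refl
    copies-cong (suc m) a≈a′ = ++-cong a≈a′ (copies-cong m a≈a′)

    copies-p : ∀ a → copies p a ≈ []
    copies-p a = mk≈ λ h _ → trans (cong (_% p) (trans (∑ₗ-copies p a h) (ℕ.*-comm p (∑ₗ a h)))) (trans (m*n%n≡0 (∑ₗ a h) p) (sym (m*n%n≡0 0 p)))

    -- In characteristic p, -a is (p - 1) a.
    negate : List ℕ → List ℕ
    negate = copies (ℕ.pred p)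

    negate-inverse : ∀ a → a ++ negate a ≈ []
    negate-inverse a = subst (λ m → copies m a ≈ []) (sym (ℕ.suc-pred p)) (copies-p a)

    ⊗-comm : ∀ a b → a ⊗ b ≈ b ⊗ a
    ⊗-comm a b = exact λ h _ → begin
      ∑ₗ (a ⊗ b) h ≡⟨ ∑ₗ-⊗ a b h ⟩
      ∑ₗ a (λ i → ∑ₗ b (λ j → h (i + j))) ≡⟨ ∑ₗ-swap a b (λ i j → h (i + j)) ⟩
      ∑ₗ b (λ j → ∑ₗ a (λ i → h (i + j))) ≡⟨ ∑ₗ-cong b (λ j → ∑ₗ-cong a (λ i → cong h (ℕ.+-comm i j))) ⟩
      ∑ₗ b (λ j → ∑ₗ a (λ i → h (j + i))) ≡⟨ ∑ₗ-⊗ b a h ⟨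
      ∑ₗ (b ⊗ a) h ∎
      where open ≡-Reasoning

    -- Pairing a ⊗ b with h is pairing a with the function i ↦ ∑ h(i + j) over j in b, which is
    -- periodic again. Congruence in the other argument follows by commutativity.
    ⊗-congʳ : ∀ {a a′} b → a ≈ a′ → a ⊗ b ≈ a′ ⊗ b
    ⊗-congʳ {a} {a′} b a≈a′ = mk≈ λ h periodic →
      subst₂ (λ s t → s % p ≡ t % p) (sym (∑ₗ-⊗ a b h)) (sym (∑ₗ-⊗ a′ b h)) (pairing a≈a′ _ (inner-periodic periodic b))

    ⊗-cong : ∀ {a a′ b b′} → a ≈ a′ → b ≈ b′ → a ⊗ b ≈ a′ ⊗ b′
    ⊗-cong {a} {a′} {b} {b′} a≈a′ b≈b′ =
      ≈-trans (⊗-congʳ b a≈a′) (≈-trans (⊗-comm a′ b) (≈-trans (⊗-congʳ a′ b≈b′) (⊗-comm b′ a′)))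

    ⊗-assoc : ∀ a b c → (a ⊗ b) ⊗ c ≈ a ⊗ (b ⊗ c)
    ⊗-assoc a b c = exact λ h _ → begin
      ∑ₗ ((a ⊗ b) ⊗ c) h ≡⟨ ∑ₗ-⊗ (a ⊗ b) c h ⟩
      ∑ₗ (a ⊗ b) (λ s → ∑ₗ c (λ l → h (s + l))) ≡⟨ ∑ₗ-⊗ a b _ ⟩
      ∑ₗ a (λ i → ∑ₗ b (λ j → ∑ₗ c (λ l → h (i + j + l)))) ≡⟨ ∑ₗ-cong a (λ i → ∑ₗ-cong b (λ j → ∑ₗ-cong c (λ l → cong h (ℕ.+-assoc i j l)))) ⟩
      ∑ₗ a (λ i → ∑ₗ b (λ j → ∑ₗ c (λ l → h (i + (j + l))))) ≡⟨ ∑ₗ-cong a (λ i → ∑ₗ-⊗ b c (λ t → h (i + t))) ⟨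
      ∑ₗ a (λ i → ∑ₗ (b ⊗ c) (λ t → h (i + t))) ≡⟨ ∑ₗ-⊗ a (b ⊗ c) h ⟨
      ∑ₗ (a ⊗ (b ⊗ c)) h ∎
      where open ≡-Reasoning

    one : List ℕ
    one = 0 ∷ []

    ⊗-identityˡ : ∀ a → one ⊗ a ≈ a
    ⊗-identityˡ a = exact λ h _ → trans (∑ₗ-⊗ one a h) (ℕ.+-identityʳ (∑ₗ a h))

    ⊗-distribʳ : ∀ c a b → (a ++ b) ⊗ c ≈ a ⊗ c ++ b ⊗ c
    ⊗-distribʳ c a b = exact λ h _ → begin
      ∑ₗ ((a ++ b) ⊗ c) h ≡⟨ ∑ₗ-⊗ (a ++ b) c h ⟩
      ∑ₗ (a ++ b) _ ≡⟨ ∑ₗ-++ a b _ ⟩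
      ∑ₗ a _ + ∑ₗ b _ ≡⟨ cong₂ _+_ (∑ₗ-⊗ a c h) (∑ₗ-⊗ b c h) ⟨
      ∑ₗ (a ⊗ c) h + ∑ₗ (b ⊗ c) h ≡⟨ ∑ₗ-++ (a ⊗ c) (b ⊗ c) h ⟨
      ∑ₗ (a ⊗ c ++ b ⊗ c) h ∎
      where open ≡-Reasoning

    commutativeRing : CommutativeRing 0ℓ 0ℓ
    commutativeRing = record
      { Carrier = List ℕ
      ; _≈_ = _≈_
      ; _+_ = _++_
      ; _*_ = _⊗_
      ; -_  = negate
      ; 0#  = []
      ; 1#  = one
      ; isCommutativeRing = record
        { isRing = record
          { +-isAbelianGroup = record
            { isGroup = record
              { isMonoid = record
                { isSemigroup = record
                  { isMagma = record
                    { isEquivalence = record { refl = ≈-refl ; sym = ≈-sym ; trans = ≈-trans }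
                    ; ∙-cong = ++-cong }
                  ; assoc = λ a b c → exact λ h _ → cong (λ d → ∑ₗ d h) (++-assoc a b c) }
                ; identity = (λ _ → ≈-refl) , (λ a → ≈-trans (++-comm a []) ≈-refl) }
              ; inverse = (λ a → ≈-trans (++-comm (negate a) a) (negate-inverse a)) , negate-inverse
              ; ⁻¹-cong = copies-cong (ℕ.pred p) }
            ; comm = ++-comm }
          ; *-cong = ⊗-cong
          ; *-assoc = ⊗-assoc
          ; *-identity = ⊗-identityˡ , (λ a → ≈-trans (⊗-comm a one) (⊗-identityˡ a))
          ; distrib = (λ c a b → ≈-trans (⊗-comm c (a ++ b)) (≈-trans (⊗-distribʳ c a b) (++-cong (⊗-comm a c) (⊗-comm b c)))) , ⊗-distribʳ }
        ; *-comm = ⊗-comm } }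
      where open import Data.List.Properties using (++-assoc)

    residue : ℕ → Fin n
    residue i = fromℕ< (m%n<n i n)

    indicator : Fin n → ℕ → ℕ
    indicator r i = 𝟙 (residue i Fin.≟ r)

    residue-periodic : ∀ i → residue (i + n) ≡ residue i
    residue-periodic i = Fin.fromℕ<-cong _ _ ([m+n]%n≡m%n i n) _ _

    indicator-periodic : ∀ r → Periodic (indicator r)
    indicator-periodic r i = cong (λ s → 𝟙 (s Fin.≟ r)) (residue-periodic i)

    periodic-multiples : ∀ {h} → Periodic h → ∀ i c → h (i + c * n) ≡ h i
    periodic-multiples {h} periodic i zero    = cong h (ℕ.+-identityʳ i)
    periodic-multiples {h} periodic i (suc c) = trans (cong h (solve 3 (λ i n c → i :+ (n :+ c) := i :+ c :+ n) refl i n (c * n)))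
      (trans (periodic (i + c * n)) (periodic-multiples periodic i c))
      where open +-*-Solver

    periodic-mod : ∀ {h} → Periodic h → ∀ i → h i ≡ h (toℕ (residue i))
    periodic-mod {h} periodic i = trans (cong h (m≡m%n+[m/n]*n i n))
      (trans (periodic-multiples periodic (i % n) (i ℕ./ n)) (cong h (sym (Fin.toℕ-fromℕ< (m%n<n i n)))))

    ∑ₗ-by-residue : ∀ {h} → Periodic h → ∀ a → ∑ₗ a h ≡ ∑[ r < n ] (h (toℕ r) * ∑ₗ a (indicator r))
    ∑ₗ-by-residue {h} periodic a = begin
      ∑ₗ a h ≡⟨ ∑ₗ-cong a (λ i → trans (periodic-mod periodic i) (sym (∑-select (h ∘ toℕ) (residue i)))) ⟩
      ∑ₗ a (λ i → ∑[ r < n ] (indicator r i * h (toℕ r))) ≡⟨ ∑ₗ-∑ a (λ i r → indicator r i * h (toℕ r)) ⟩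
      ∑[ r < n ] ∑ₗ a (λ i → indicator r i * h (toℕ r)) ≡⟨ sum-cong-≗ (λ r → trans (∑ₗ-cong a (λ i → ℕ.*-comm (indicator r i) _)) (∑ₗ-* a (h (toℕ r)) (indicator r))) ⟩
      ∑[ r < n ] (h (toℕ r) * ∑ₗ a (indicator r)) ∎
      where open ≡-Reasoning

    ∑-cong-% : ∀ {m} {f g : Fin m → ℕ} → (∀ i → f i % p ≡ g i % p) → sum f % p ≡ sum g % p
    ∑-cong-% {zero}          f≡g = refl
    ∑-cong-% {suc m} {f} {g} f≡g = %-cong-+ {f zero} {g zero} (f≡g zero) (∑-cong-% (f≡g ∘ suc))

    -- The n indicators of residues span the n-periodic functions. So finitely many pairings
    -- determine an element, which makes `_≈_` decidable and the algebra finite.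
    from-coefficients : ∀ {a b} → (∀ r → ∑ₗ a (indicator r) % p ≡ ∑ₗ b (indicator r) % p) → a ≈ b
    from-coefficients {a} {b} eq = mk≈ λ h periodic →
      subst₂ (λ s t → s % p ≡ t % p) (sym (∑ₗ-by-residue periodic a)) (sym (∑ₗ-by-residue periodic b))
        (∑-cong-% (λ r → %-cong-* {h (toℕ r)} {h (toℕ r)} {∑ₗ a (indicator r)} {∑ₗ b (indicator r)} refl (eq r)))

    _≈?_ : ∀ a b → Dec (a ≈ b)
    a ≈? b = map′ from-coefficients (λ a≈b r → pairing a≈b (indicator r) (indicator-periodic r))
      (Fin.all? (λ r → (∑ₗ a (indicator r) % p) ℕ.≟ (∑ₗ b (indicator r) % p)))

    fromCoefficients : ∀ {m} → (Fin m → ℕ) → (Fin m → ℕ) → List ℕ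
    fromCoefficients {zero}  c e = []
    fromCoefficients {suc m} c e = copies (c zero) (e zero ∷ []) ++ fromCoefficients (c ∘ suc) (e ∘ suc)

    ∑ₗ-fromCoefficients : ∀ {m} (c e : Fin m → ℕ) h → ∑ₗ (fromCoefficients c e) h ≡ ∑[ r < m ] (c r * h (e r))
    ∑ₗ-fromCoefficients {zero}  c e h = refl
    ∑ₗ-fromCoefficients {suc m} c e h = trans (∑ₗ-++ (copies (c zero) (e zero ∷ [])) (fromCoefficients (c ∘ suc) (e ∘ suc)) h)
      (cong₂ _+_ (trans (∑ₗ-copies (c zero) (e zero ∷ []) h) (cong (c zero *_) (ℕ.+-identityʳ (h (e zero))))) (∑ₗ-fromCoefficients (c ∘ suc) (e ∘ suc) h))

    residue-toℕ : ∀ r → residue (toℕ r) ≡ r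
    residue-toℕ r = Fin.toℕ-injective (trans (Fin.toℕ-fromℕ< _) (m<n⇒m%n≡m (Fin.toℕ<n r)))

    coefficient-fromCoefficients : ∀ c s → ∑ₗ (fromCoefficients {n} c toℕ) (indicator s) ≡ c s
    coefficient-fromCoefficients c s = begin
      ∑ₗ (fromCoefficients c toℕ) (indicator s) ≡⟨ ∑ₗ-fromCoefficients c toℕ (indicator s) ⟩
      ∑[ r < n ] (c r * indicator s (toℕ r)) ≡⟨ sum-cong-≗ (λ r → trans (ℕ.*-comm (c r) _) (cong (_* c r) (trans (cong (λ t → 𝟙 (t Fin.≟ s)) (residue-toℕ r)) (𝟙-sym r s)))) ⟩
      ∑[ r < n ] (𝟙 (s Fin.≟ r) * c r) ≡⟨ ∑-select c s ⟩
      c s ∎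
      where open ≡-Reasoning

    elements : List (List ℕ)
    elements = map (λ e → fromCoefficients (toℕ ∘ finToFun {p} {n} e) toℕ) (allFin (p ℕ.^ n))

    elements-complete : ∀ a → Any (a ≈_) elements
    elements-complete a = Any.map⁺ (Any.map (λ { refl → from-coefficients coefficients≡ }) (∈-allFin (funToFin code)))
      where
      code : Fin n → Fin p
      code r = fromℕ< (m%n<n (∑ₗ a (indicator r)) p)
      coefficients≡ : ∀ s → ∑ₗ a (indicator s) % p ≡ ∑ₗ (fromCoefficients (toℕ ∘ finToFun {p} {n} (funToFin code)) toℕ) (indicator s) % p
      coefficients≡ s = sym (begin
        ∑ₗ (fromCoefficients (toℕ ∘ finToFun {p} {n} (funToFin code)) toℕ) (indicator s) % p  ≡⟨ cong (_% p) (coefficient-fromCoefficients (toℕ ∘ finToFun {p} {n} (funToFin code)) s) ⟩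
        toℕ (finToFun {p} {n} (funToFin code) s) % p ≡⟨ cong (λ c → toℕ c % p) (Fin.finToFun-funToFin code s) ⟩
        toℕ (code s) % p ≡⟨ cong (_% p) (Fin.toℕ-fromℕ< (m%n<n (∑ₗ a (indicator s)) p)) ⟩
        ∑ₗ a (indicator s) % p % p ≡⟨ m%n%n≡m%n (∑ₗ a (indicator s)) p ⟩
        ∑ₗ a (indicator s) % p ∎)
        where open ≡-Reasoning

  module PrimeGroupAlgebra (p n m : ℕ) (p-prime : Prime p) .{{_ : NonZero p}} .{{_ : NonZero n}}
    (pᵐ≡1+n : p ℕ.^ m ≡ suc n) where
    open GroupAlgebra p n
    open CommutativeRing commutativeRing using (semiring; *-congˡ; setoid)
    open UnoptimisedMult semiring renaming (_×_ to _·_)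
    open SemiringExp semiring using (_^_; ^-congˡ; ^-assocʳ)

    characteristic : p · one ≈ []
    characteristic = ≈-trans (≈-reflexive (as-copies p)) (copies-p one)
      where
      ≈-reflexive : ∀ {a b} → a ≡ b → a ≈ b
      ≈-reflexive refl = ≈-refl
      as-copies : ∀ j → j · one ≡ copies j one
      as-copies zero    = refl
      as-copies (suc j) = cong (0 ∷_) (as-copies j)

    open Frobenius commutativeRing p p-prime characteristic

    X^_ : ℕ → List ℕ
    X^ i = i ∷ []

    X^-^ : ∀ i e → (X^ i) ^ e ≈ X^ (i * e)
    X^-^ i zero    = exact λ h _ → cong (λ j → h j + 0) (sym (ℕ.*-zeroʳ i))
    X^-^ i (suc e) = ≈-trans (*-congˡ {X^ i} (X^-^ i e)) (exact λ h _ → cong (λ j → h j + 0) (sym (ℕ.*-suc i e)))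

    []^ : ∀ e → 0 < e → [] ^ e ≈ []
    []^ (suc e) _ = ≈-refl

    -- A coefficient is a repetition count, so additivity of the Frobenius map and its effect on
    -- single powers of X give the whole formula.
    ^p : ∀ a → a ^ p ≈ map (_* p) a
    ^p []      = []^ p (ℕ.>-nonZero⁻¹ p)
    ^p (i ∷ a) = ≈-trans (frobenius-+ (X^ i) a) (++-cong (X^-^ i p) (^p a))

    ^pʲ : ∀ j a → a ^ (p ℕ.^ j) ≈ map (_* p ℕ.^ j) a
    ^pʲ zero    a = ≈-trans (CommutativeRing.*-identityʳ commutativeRing a)
      (exact λ h _ → trans (∑ₗ-cong a (λ i → cong h (sym (ℕ.*-identityʳ i)))) (sym (∑ₗ-map (_* 1) a h)))
    ^pʲ (suc j) a = ≈-trans (≈-sym (^-assocʳ a p (p ℕ.^ j))) (≈-trans (^-congˡ (p ℕ.^ j) (^p a)) (≈-trans (^pʲ j (map (_* p) a))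
      (exact λ h _ → trans (∑ₗ-map (_* p ℕ.^ j) (map (_* p) a) h) (trans (∑ₗ-map (_* p) a _)
        (trans (∑ₗ-cong a (λ i → cong h (ℕ.*-assoc i p (p ℕ.^ j)))) (sym (∑ₗ-map (_* (p * p ℕ.^ j)) a h)))))))

    -- The qth power multiplies each exponent i by q = n + 1, and i · (n + 1) is congruent to i
    -- modulo n.
    ^q : ∀ a → a ^ suc n ≈ a
    ^q a = subst (λ q → a ^ q ≈ a) pᵐ≡1+n (≈-trans (^pʲ m a) (exact λ h periodic →
      trans (∑ₗ-map (_* p ℕ.^ m) a h) (∑ₗ-cong a (λ i →
        trans (cong h (trans (cong (i *_) pᵐ≡1+n) (ℕ.*-suc i n))) (periodic-multiples periodic i i)))))

    exponent : ℕ → ℕ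
    exponent d = ℕ.pred (p ℕ.^ d)

    X^exponent-1 : ℕ → List ℕ
    X^exponent-1 d = X^ exponent d ++ negate one

    separator : ℕ → List ℕ
    separator zero    = one
    separator (suc d) = X^exponent-1 (suc d) ⊗ separator d

    degree : ℕ → ℕ
    degree zero    = 0
    degree (suc d) = exponent (suc d) + degree d

    -- `split` holds for every h, periodic or not, and as an equation of natural numbers. It
    -- therefore speaks of the polynomial before reduction modulo p and Xⁿ - 1, where a degree makes
    -- sense.
    record Monic (D : ℕ) (a : List ℕ) : Set where
      field
        lower  : List ℕ
        lower< : All (_< D) lower
        split  : ∀ h → ∑ₗ a h ≡ h D + ∑ₗ lower h

    instance
      p^≢0 : ∀ {d} → NonZero (p ℕ.^ d)
      p^≢0 {d} = ℕ.m^n≢0 p d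

    1<p : 1 < p
    1<p = ℕ.nonTrivial⇒n>1 p {{prime⇒nonTrivial p-prime}}

    1+exponent≡p^ : ∀ d → suc (exponent d) ≡ p ℕ.^ d
    1+exponent≡p^ d = ℕ.suc-pred (p ℕ.^ d) {{p^≢0 {d}}}

    exponent-grows : ∀ d → suc (2 * exponent d) ≤ exponent (suc d)
    exponent-grows d = ℕ.s≤s⁻¹ (begin
      suc (suc (2 * exponent d)) ≡⟨ solve 1 (λ e → con 2 :+ con 2 :* e := con 2 :* (con 1 :+ e)) refl (exponent d) ⟩
      2 * suc (exponent d) ≡⟨ cong (2 *_) (1+exponent≡p^ d) ⟩
      2 * p ℕ.^ d ≤⟨ ℕ.*-monoˡ-≤ (p ℕ.^ d) 1<p ⟩
      p * p ℕ.^ d ≡⟨ 1+exponent≡p^ (suc d) ⟨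
      suc (exponent (suc d)) ∎)
      where
      open ℕ.≤-Reasoning
      open +-*-Solver

    -- The numbers p^i - 1 more than double from one i to the next, so their sum up to d stays below
    -- the next one. For d + 1 = m that bound is n, so the separator is already reduced modulo Xⁿ -
    -- 1.
    degree< : ∀ d → degree d < exponent (suc d)
    degree< zero    = ℕ.≤-trans (s≤s z≤n) (exponent-grows 0)
    degree< (suc d) = begin-strict
      exponent (suc d) + degree d <⟨ ℕ.+-monoʳ-< (exponent (suc d)) (degree< d) ⟩
      exponent (suc d) + exponent (suc d) ≡⟨ cong (exponent (suc d) +_) (ℕ.+-identityʳ (exponent (suc d))) ⟨
      2 * exponent (suc d) <⟨ exponent-grows (suc d) ⟩
      exponent (suc (suc d)) ∎
      where open ℕ.≤-Reasoning

    0<exponent : ∀ d → 0 < exponent (suc d)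
    0<exponent d = ℕ.≤-<-trans z≤n (degree< d)

    -- With e = `exponent (suc d)` and s = X^D + lower, the product (X^e - 1) s has leading term
    -- X^(e + D). The rest is X^e · lower and p - 1 copies of X^D + lower, all of degree below e + D
    -- because e > 0.
    separator-monic : ∀ d → Monic (degree d) (separator d)
    separator-monic zero    = record { lower = [] ; lower< = [] ; split = λ _ → refl }
    separator-monic (suc d) = record
      { lower  = map (exponent (suc d) +_) lower ++ copies (ℕ.pred p) (D ∷ lower)
      ; lower< = All.++⁺ (All.map⁺ (All.map (ℕ.+-monoʳ-< (exponent (suc d))) lower<))
                         (All-copies (ℕ.pred p) (ℕ.m<n+m D (0<exponent d) ∷ All.map (λ i<D → ℕ.<-≤-trans i<D (ℕ.m≤n+m D (exponent (suc d)))) lower<))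
      ; split  = λ h → begin
          ∑ₗ (X^exponent-1 (suc d) ⊗ separator d) h
            ≡⟨ ∑ₗ-⊗ (X^exponent-1 (suc d)) (separator d) h ⟩
          ∑ₗ (separator d) (λ j → h (exponent (suc d) + j)) + ∑ₗ (negate one) (λ i → ∑ₗ (separator d) (λ j → h (i + j)))
            ≡⟨ cong₂ _+_ (split (λ j → h (exponent (suc d) + j))) (∑ₗ-copies (ℕ.pred p) one (λ i → ∑ₗ (separator d) (λ j → h (i + j)))) ⟩
          h (exponent (suc d) + D) + ∑ₗ lower (λ j → h (exponent (suc d) + j)) + ℕ.pred p * (∑ₗ (separator d) h + 0)
            ≡⟨ cong₂ (λ s t → h (exponent (suc d) + D) + s + ℕ.pred p * t) (∑ₗ-map (exponent (suc d) +_) lower h) (sym (trans (ℕ.+-identityʳ _) (split h))) ⟨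
          h (exponent (suc d) + D) + ∑ₗ (map (exponent (suc d) +_) lower) h + ℕ.pred p * ∑ₗ (D ∷ lower) h
            ≡⟨ cong (λ t → h (exponent (suc d) + D) + ∑ₗ (map (exponent (suc d) +_) lower) h + t) (∑ₗ-copies (ℕ.pred p) (D ∷ lower) h) ⟨
          h (exponent (suc d) + D) + ∑ₗ (map (exponent (suc d) +_) lower) h + ∑ₗ (copies (ℕ.pred p) (D ∷ lower)) h
            ≡⟨ ℕ.+-assoc (h (exponent (suc d) + D)) _ _ ⟩
          h (exponent (suc d) + D) + (∑ₗ (map (exponent (suc d) +_) lower) h + ∑ₗ (copies (ℕ.pred p) (D ∷ lower)) h)
            ≡⟨ cong (h (exponent (suc d) + D) +_) (∑ₗ-++ (map (exponent (suc d) +_) lower) (copies (ℕ.pred p) (D ∷ lower)) h) ⟨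
          h (exponent (suc d) + D) + ∑ₗ (map (exponent (suc d) +_) lower ++ copies (ℕ.pred p) (D ∷ lower)) h ∎
      }
      where
      open ≡-Reasoning
      open Monic (separator-monic d)
      D : ℕ
      D = degree d
      All-copies : ∀ {P : ℕ → Set} c {a} → All P a → All P (copies c a)
      All-copies zero    pa = []
      All-copies (suc c) pa = All.++⁺ pa (All-copies c pa)

    -- Pairing with the indicator of the residue of D isolates the leading coefficient: all
    -- exponents are below n, so no lower one shares that residue. The result is 1, not 0, modulo p.
    monic≉[] : ∀ {D a} → D < n → Monic D a → ¬ (a ≈ [])
    monic≉[] {D} {a} D<n monic a≈[] = contradiction (begin
      1 ≡⟨ m<n⇒m%n≡m 1<p ⟨
      1 % p ≡⟨ cong (_% p) (cong₂ _+_ (𝟙-yes (residue D Fin.≟ residue D) refl) (vanishes lower<)) ⟨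
      (indicator (residue D) D + ∑ₗ lower (indicator (residue D))) % p ≡⟨ cong (_% p) (split (indicator (residue D))) ⟨
      ∑ₗ a (indicator (residue D)) % p ≡⟨ pairing a≈[] (indicator (residue D)) (indicator-periodic (residue D)) ⟩
      0 % p ≡⟨ m<n⇒m%n≡m (ℕ.<-trans z<s 1<p) ⟩
      0 ∎) λ ()
      where
      open ≡-Reasoning
      open Monic monic
      residue-injective : ∀ {i} → i < D → residue i ≢ residue D
      residue-injective {i} i<D eq = ℕ.<⇒≢ i<D (begin
        i ≡⟨ m<n⇒m%n≡m (ℕ.<-trans i<D D<n) ⟨
        i % n ≡⟨ Fin.toℕ-fromℕ< (m%n<n i n) ⟨
        toℕ (residue i) ≡⟨ cong toℕ eq ⟩
        toℕ (residue D) ≡⟨ Fin.toℕ-fromℕ< (m%n<n D n) ⟩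
        D % n ≡⟨ m<n⇒m%n≡m D<n ⟩
        D ∎)
      vanishes : ∀ {b} → All (_< D) b → ∑ₗ b (indicator (residue D)) ≡ 0
      vanishes []            = refl
      vanishes {i ∷ b} (i<D ∷ b<D) = cong₂ _+_ (𝟙-no (residue i Fin.≟ residue D) (residue-injective i<D)) (vanishes b<D)

    separator≉[] : ∀ {d} → suc d ≡ m → ¬ (separator d ≈ [])
    separator≉[] {d} refl = monic≉[] (subst (degree d <_) (cong ℕ.pred pᵐ≡1+n) (degree< d)) (separator-monic d)

-- Cutting a field out of a ring by an idempotent.

module IdempotentQuotients where
  open RingSolving
  open import Algebra.Bundles using (CommutativeRing)
  import Algebra.Properties.Semiring.Exp as SemiringExp
  import Algebra.Properties.CommutativeSemiring.Exp as CommutativeSemiringExp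
  open import Data.List.Base as List using (List; []; _∷_)
  open import Data.List.Relation.Unary.All as All using (All; []; _∷_)
  open import Data.List.Relation.Unary.Any as Any using (Any)
  open import Data.Nat.Base as ℕ using (ℕ; zero; suc)
  open import Data.Integer.Base using (0ℤ)
  open import Data.Product.Base using (_×_; _,_; ∃; proj₁; proj₂)
  open import Data.Sum.Base using (_⊎_; inj₁; inj₂; [_,_]′; map)
  open import Function.Base using (_∘_)
  open import Level using (0ℓ)
  import Relation.Binary.PropositionalEquality as ≡
  open ≡ using (_≡_)
  open import Relation.Nullary

  -- In a ring with a ^ (n + 1) ≈ a the powers a ^ n are idempotent.  An idempotent e below u ^ n on which
  -- every b ^ n acts as 0 or 1 cuts out a field e R in which u is nonzero; e R is represented by R itself
  -- with the coarser equality e a ≈ e b.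
  module IdempotentQuotient (R : CommutativeRing 0ℓ 0ℓ) where
    open CommutativeRing R hiding (zero)

    module Factor (_≈?_ : ∀ a b → Dec (a ≈ b)) (elements : List Carrier) (complete : ∀ a → Any (a ≈_) elements)
      (n : ℕ) (0<n : 0 ℕ.< n) (a^[1+n]≈a : ∀ a → SemiringExp._^_ semiring a (suc n) ≈ a)
      (u : Carrier) (u≉0 : ¬ (u ≈ 0#)) where
      open SemiringExp semiring using (_^_; ^-congˡ)
      open CommutativeSemiringExp commutativeSemiring using (^-distrib-*)
      open IntegerCoefficients R using (solve; _:=_; _:+_; _:*_; _:-_; :-_; con)
      open import Relation.Binary.Reasoning.Setoid setoid

      ^n-idempotent : ∀ a → a ^ n * a ^ n ≈ a ^ n
      ^n-idempotent a = go n 0<n (a^[1+n]≈a a)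
        where
        go : ∀ n → 0 ℕ.< n → a ^ suc n ≈ a → a ^ n * a ^ n ≈ a ^ n
        go (suc n) _ eq = begin
          (a * a ^ n) * (a * a ^ n) ≈⟨ solve 2 (λ a b → (a :* b) :* (a :* b) := b :* (a :* (a :* b))) refl a (a ^ n) ⟩
          a ^ n * (a * (a * a ^ n)) ≈⟨ *-congˡ eq ⟩
          a ^ n * a ≈⟨ *-comm (a ^ n) a ⟩
          a * a ^ n ∎

      record Splits (e : Carrier) : Set where
        field
          idempotent : e * e ≈ e
          nonzero    : ¬ (e ≈ 0#)
          below      : e * u ^ n ≈ e

      Decides : Carrier → Carrier → Set
      Decides e b = e * b ^ n ≈ 0# ⊎ e * b ^ n ≈ e

      -- For each b in turn, e is replaced by e bⁿ unless that product is 0. In both cases bⁿ acts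
      -- on the resulting e as 0 or 1, and a decision once reached survives multiplication of e by
      -- anything.
      refine : ∀ xs → ∃ λ e → Splits e × All (Decides e) xs
      refine []       = u ^ n , record
        { idempotent = ^n-idempotent u
        ; nonzero    = λ uⁿ≈0 → u≉0 (trans (sym (a^[1+n]≈a u)) (trans (*-congˡ uⁿ≈0) (zeroʳ u)))
        ; below      = ^n-idempotent u
        } , []
      refine (b ∷ xs) = extend (refine xs)
        where
        extend : (∃ λ e → Splits e × All (Decides e) xs) → ∃ λ e → Splits e × All (Decides e) (b ∷ xs)
        extend (e , splits , decides) with (e * b ^ n) ≈? 0#
        ... | yes ebⁿ≈0 = e , splits , inj₁ ebⁿ≈0 ∷ decides
        ... | no  ebⁿ≉0 = e * b ^ n , record
          { idempotent = trans (solve 2 (λ e b → (e :* b) :* (e :* b) := (e :* e) :* (b :* b)) refl e (b ^ n)) (*-cong idempotent (^n-idempotent b))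
          ; nonzero    = ebⁿ≉0
          ; below      = trans (swap (u ^ n)) (*-congʳ below)
          } , inj₂ (trans (*-assoc e (b ^ n) (b ^ n)) (*-congˡ (^n-idempotent b))) ∷ All.map still decides
          where
          open Splits splits
          swap : ∀ c → (e * b ^ n) * c ≈ (e * c) * b ^ n
          swap = solve 3 (λ e b c → (e :* b) :* c := (e :* c) :* b) refl e (b ^ n)
          still : ∀ {c} → Decides e c → Decides (e * b ^ n) c
          still {c} = map (λ ecⁿ≈0 → trans (swap (c ^ n)) (trans (*-congʳ ecⁿ≈0) (zeroˡ (b ^ n))))
                          (λ ecⁿ≈e → trans (swap (c ^ n)) (*-congʳ ecⁿ≈e))

      opaque
        e : Carrier
        e = proj₁ (refine elements)

        e-splits : Splits e
        e-splits = proj₁ (proj₂ (refine elements))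

        e-decides : ∀ b → Decides e b
        e-decides b = respects (All.lookupAny (proj₂ (proj₂ (refine elements))) (complete b))
          where
          respects : Decides e (Any.lookup (complete b)) × b ≈ Any.lookup (complete b) → Decides e b
          respects (decides , b≈c) = map (trans (*-congˡ (^-congˡ n b≈c))) (trans (*-congˡ (^-congˡ n b≈c))) decides

      open Splits e-splits public

      infix 4 _∼_
      record _∼_ (a b : Carrier) : Set where
        constructor mk∼
        field on-e : e * a ≈ e * b
      open _∼_ public

      ≈⇒∼ : ∀ {a b} → a ≈ b → a ∼ b
      ≈⇒∼ a≈b = mk∼ (*-congˡ a≈b)

      _∼?_ : ∀ a b → Dec (a ∼ b)
      a ∼? b with (e * a) ≈? (e * b)
      ... | yes eq = yes (mk∼ eq)
      ... | no neq = no (neq ∘ on-e)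

      +-cong-∼ : ∀ {a a′ b b′} → a ∼ a′ → b ∼ b′ → a + b ∼ a′ + b′
      +-cong-∼ {a} {a′} {b} {b′} a∼a′ b∼b′ = mk∼ (trans (distribˡ e a b) (trans (+-cong (on-e a∼a′) (on-e b∼b′)) (sym (distribˡ e a′ b′))))

      *-congʳ-∼ : ∀ {a a′} b → a ∼ a′ → a * b ∼ a′ * b
      *-congʳ-∼ {a} {a′} b a∼a′ = mk∼ (trans (sym (*-assoc e a b)) (trans (*-congʳ (on-e a∼a′)) (*-assoc e a′ b)))

      ∼-trans : ∀ {a b c} → a ∼ b → b ∼ c → a ∼ c
      ∼-trans a∼b b∼c = mk∼ (trans (on-e a∼b) (on-e b∼c))

      ∼-sym : ∀ {a b} → a ∼ b → b ∼ a
      ∼-sym a∼b = mk∼ (sym (on-e a∼b))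

      *-cong-∼ : ∀ {a a′ b b′} → a ∼ a′ → b ∼ b′ → a * b ∼ a′ * b′
      *-cong-∼ {a} {a′} {b} {b′} a∼a′ b∼b′ =
        ∼-trans (*-congʳ-∼ b a∼a′) (∼-trans (≈⇒∼ (*-comm a′ b)) (∼-trans (*-congʳ-∼ a′ b∼b′) (≈⇒∼ (*-comm b′ a′))))

      -‿cong-∼ : ∀ {a a′} → a ∼ a′ → - a ∼ - a′
      -‿cong-∼ {a} {a′} a∼a′ = mk∼ (begin
        e * - a ≈⟨ solve 2 (λ e a → e :* :- a := :- (e :* a)) refl e a ⟩
        - (e * a) ≈⟨ -‿cong (on-e a∼a′) ⟩
        - (e * a′) ≈⟨ solve 2 (λ e a → e :* :- a := :- (e :* a)) refl e a′ ⟨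
        e * - a′ ∎)

      quotientRing : CommutativeRing 0ℓ 0ℓ
      quotientRing = record
        { Carrier = Carrier
        ; _≈_ = _∼_
        ; _+_ = _+_
        ; _*_ = _*_
        ; -_  = -_
        ; 0#  = 0#
        ; 1#  = 1#
        ; isCommutativeRing = record
          { isRing = record
            { +-isAbelianGroup = record
              { isGroup = record
                { isMonoid = record
                  { isSemigroup = record
                    { isMagma = record
                      { isEquivalence = record { refl = mk∼ refl ; sym = ∼-sym ; trans = ∼-trans }
                      ; ∙-cong = +-cong-∼ }
                    ; assoc = λ a b c → ≈⇒∼ (+-assoc a b c) }
                  ; identity = (λ a → ≈⇒∼ (+-identityˡ a)) , (λ a → ≈⇒∼ (+-identityʳ a)) }
                ; inverse = (λ a → ≈⇒∼ (-‿inverseˡ a)) , (λ a → ≈⇒∼ (-‿inverseʳ a))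
                ; ⁻¹-cong = -‿cong-∼ }
              ; comm = λ a b → ≈⇒∼ (+-comm a b) }
            ; *-cong = *-cong-∼
            ; *-assoc = λ a b c → ≈⇒∼ (*-assoc a b c)
            ; *-identity = (λ a → ≈⇒∼ (*-identityˡ a)) , (λ a → ≈⇒∼ (*-identityʳ a))
            ; distrib = (λ a b c → ≈⇒∼ (distribˡ a b c)) , (λ a b c → ≈⇒∼ (distribʳ a b c)) }
          ; *-comm = λ a b → ≈⇒∼ (*-comm a b) } }

      1≁0 : ¬ (1# ∼ 0#)
      1≁0 1∼0 = nonzero (trans (sym (*-identityʳ e)) (trans (on-e 1∼0) (zeroʳ e)))

      -- The alternative e aⁿ ≈ 0 would give e a ≈ e aⁿ⁺¹ ≈ 0, that is, a ∼ 0.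
      ^n∼1 : ∀ {a} → ¬ (a ∼ 0#) → a ^ n ∼ 1#
      ^n∼1 {a} a≁0 = [ (λ eaⁿ≈0 → contradiction (mk∼ (begin
          e * a ≈⟨ *-congˡ (a^[1+n]≈a a) ⟨
          e * (a * a ^ n) ≈⟨ solve 3 (λ e a b → e :* (a :* b) := a :* (e :* b)) refl e a (a ^ n) ⟩
          a * (e * a ^ n) ≈⟨ *-congˡ eaⁿ≈0 ⟩
          a * 0# ≈⟨ solve 2 (λ a e → a :* con 0ℤ := e :* con 0ℤ) refl a e ⟩
          e * 0# ∎)) a≁0)
        , (λ eaⁿ≈e → mk∼ (trans eaⁿ≈e (sym (*-identityʳ e)))) ]′ (e-decides a)

      u≁0 : ¬ (u ∼ 0#)
      u≁0 u∼0 = nonzero (begin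
        e ≈⟨ below ⟨
        e * u ^ n ≈⟨ vanishes n 0<n ⟩
        0# ∎)
        where
        vanishes : ∀ n → 0 ℕ.< n → e * u ^ n ≈ 0#
        vanishes (suc n) _ = trans (sym (*-assoc e u (u ^ n))) (trans (*-congʳ (trans (on-e u∼0) (zeroʳ e))) (zeroˡ (u ^ n)))

      inverse : Carrier → Carrier
      inverse a = a ^ ℕ.pred n

      *-inverse : ∀ {a} → ¬ (a ∼ 0#) → a * inverse a ∼ 1#
      *-inverse {a} a≁0 = go n 0<n (^n∼1 a≁0)
        where
        go : ∀ n → 0 ℕ.< n → a ^ n ∼ 1# → a * a ^ ℕ.pred n ∼ 1#
        go (suc n) _ eq = eq

-- Transport of a finite field to an initial segment of ℕ.

module FieldsOnFin where
  open FiniteFields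
  open import Algebra.Bundles using (CommutativeRing; RawRing)
  open import Algebra.Morphism.Structures using (IsRingMonomorphism)
  import Algebra.Morphism.RingMonomorphism as RingMonomorphism
  import Algebra.Properties.Semiring.Exp as SemiringExp
  import Algebra.Properties.Semiring.Mult as UnoptimisedMult
  open import Data.Fin.Base as Fin using (Fin; zero; suc)
  open import Data.List.Base as List using (List; _∷_; length; lookup; deduplicate)
  open import Data.List.Membership.Propositional.Properties using (∈-lookup)
  open import Data.List.Relation.Unary.All as All using (All; _∷_)
  open import Data.List.Relation.Unary.AllPairs using (AllPairs; _∷_)
  open import Data.List.Relation.Unary.Any as Any using (Any)
  import Data.List.Relation.Unary.Any.Properties as Any
  import Data.List.Relation.Unary.Unique.DecSetoid.Properties as Unique
  open import Data.Nat.Base as ℕ using (ℕ; zero; suc)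
  open import Function.Base using (_∘_)
  open import Level using (0ℓ)
  open import Relation.Binary.Bundles using (DecSetoid)
  open import Relation.Binary.PropositionalEquality as ≡ using (_≡_)
  open import Relation.Nullary

  module FiniteRing (K : CommutativeRing 0ℓ 0ℓ) where
    open CommutativeRing K hiding (zero)

    module FieldOnFin (_≈?_ : ∀ a b → Dec (a ≈ b)) (elements : List Carrier) (complete : ∀ a → Any (a ≈_) elements)
      (1≉0 : ¬ (1# ≈ 0#)) (inverse : Carrier → Carrier) (*-inverse : ∀ {a} → ¬ (a ≈ 0#) → a * inverse a ≈ 1#) where

      opaque
        representatives : List Carrier
        representatives = deduplicate _≈?_ elements

        representatives-complete : ∀ a → Any (a ≈_) representatives
        representatives-complete a = Any.deduplicate⁺ _≈?_ (λ y≈x a≈x → trans a≈x (sym y≈x)) (complete a)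

        representatives-distinct : AllPairs (λ a b → ¬ (a ≈ b)) representatives
        representatives-distinct = Unique.deduplicate-! decSetoid elements
          where
          decSetoid : DecSetoid 0ℓ 0ℓ
          decSetoid = record { isDecEquivalence = record { isEquivalence = isEquivalence ; _≟_ = _≈?_ } }

      order : ℕ
      order = length representatives

      to : Fin order → Carrier
      to = lookup representatives

      from : Carrier → Fin order
      from a = Any.index (representatives-complete a)

      to-from : ∀ a → to (from a) ≈ a
      to-from a = sym (Any.lookup-index (representatives-complete a))

      lookup-injective : ∀ {xs} → AllPairs (λ a b → ¬ (a ≈ b)) xs → ∀ i j → lookup xs i ≈ lookup xs j → i ≡ j
      lookup-injective (_ ∷ _)         zero    zero    _  = ≡.refl
      lookup-injective (x≉xs ∷ _)      zero    (suc j) eq = contradiction eq (All.lookup x≉xs (∈-lookup j))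
      lookup-injective (x≉xs ∷ _)      (suc i) zero    eq = contradiction (sym eq) (All.lookup x≉xs (∈-lookup i))
      lookup-injective (_ ∷ distinct)  (suc i) (suc j) eq = ≡.cong suc (lookup-injective distinct i j eq)

      to-injective : ∀ {i j} → to i ≈ to j → i ≡ j
      to-injective = lookup-injective representatives-distinct _ _

      finRing : RawRing 0ℓ 0ℓ
      finRing = record
        { Carrier = Fin order
        ; _≈_ = _≡_
        ; _+_ = λ i j → from (to i + to j)
        ; _*_ = λ i j → from (to i * to j)
        ; -_  = λ i → from (- to i)
        ; 0#  = from 0#
        ; 1#  = from 1#
        }

      to-isRingMonomorphism : IsRingMonomorphism finRing rawRing to
      to-isRingMonomorphism = record
        { isRingHomomorphism = record
          { isSemiringHomomorphism = record
            { isNearSemiringHomomorphism = record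
              { +-isMonoidHomomorphism = record
                { isMagmaHomomorphism = record
                  { isRelHomomorphism = record { cong = reflexive ∘ ≡.cong to }
                  ; homo = λ i j → to-from (to i + to j) }
                ; ε-homo = to-from 0# }
              ; *-homo = λ i j → to-from (to i * to j) }
            ; 1#-homo = to-from 1# }
          ; -‿homo = λ i → to-from (- to i) }
        ; injective = to-injective }

      field-on-Fin : FiniteField order
      field-on-Fin = record
        { _+_ = RawRing._+_ finRing
        ; _*_ = RawRing._*_ finRing
        ; -_  = RawRing.-_ finRing
        ; _⁻¹ = λ i → from (inverse (to i))
        ; 0#  = from 0#
        ; 1#  = from 1#
        ; isCommutativeRing = RingMonomorphism.isCommutativeRing to-isRingMonomorphism isCommutativeRing
        ; 1≢0 = λ eq → 1≉0 (trans (sym (to-from 1#)) (trans (reflexive (≡.cong to eq)) (to-from 0#)))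
        ; *-inverseʳ = λ {i} i≢0 → to-injective (trans (to-from _) (trans (*-congˡ (to-from _))
            (trans (*-inverse (λ toi≈0 → i≢0 (to-injective (trans toi≈0 (sym (to-from 0#)))))) (sym (to-from 1#)))))
        }

      open FiniteField field-on-Fin public using () renaming (_^_ to _^ᶠ_; semiring to semiringᶠ; 0# to 0ᶠ; 1# to 1ᶠ)
      open SemiringExp semiring using (_^_)
      open UnoptimisedMult semiring using (_×_)
      open UnoptimisedMult semiringᶠ public using () renaming (_×_ to _×ᶠ_)

      to-^ : ∀ i n → to (i ^ᶠ n) ≈ to i ^ n
      to-^ i zero    = to-from 1#
      to-^ i (suc n) = trans (to-from _) (*-congˡ (to-^ i n))

      to-× : ∀ n → to (n ×ᶠ 1ᶠ) ≈ n × 1#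
      to-× zero    = to-from 0#
      to-× (suc n) = trans (to-from _) (+-cong (to-from 1#) (to-× n))

-- The order of the factor, and existence of the field with pᵐ elements.

module GaloisFields where
  open FiniteFields
  open FrobeniusMap
  open GroupAlgebras
  open IdempotentQuotients
  open FieldsOnFin
  open import Algebra.Bundles using (CommutativeRing)
  import Algebra.Properties.Semiring.Exp as SemiringExp
  import Algebra.Properties.Semiring.Mult as UnoptimisedMult
  open import Data.Fin.Base as Fin using (Fin; zero; suc; toℕ; fromℕ; finToFun; funToFin)
  import Data.Fin.Properties as Fin
  open import Data.Integer.Base using (0ℤ; 1ℤ)
  open import Data.List.Base using (List; [])
  import Data.List.Relation.Unary.Any as Any
  open import Data.Nat.Base as ℕ using (ℕ; zero; suc; NonZero; z≤n; s≤s; z<s)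
  import Data.Nat.Properties as ℕ
  open import Data.Nat.Coprimality using (coprime⇒GCD≡1; prime⇒coprime)
  open import Data.Nat.GCD using (module Bézout)
  open import Data.Nat.Primality using (Prime; prime⇒nonZero; prime⇒nonTrivial)
  open import Data.Product.Base using (_×_; _,_; Σ-syntax)
  open import Data.Sum.Base using ([_,_]′)
  open import Function.Base using (_∘_)
  open import Relation.Binary.PropositionalEquality
  open import Relation.Binary.Definitions using (Tri; tri<; tri≈; tri>)
  open import Relation.Nullary

  module FieldSize {Q} (𝔽 : FiniteField Q) where
    open FiniteField 𝔽

    module Count {p m} (p-prime : Prime p) (0<m : 0 ℕ.< m)
      (p×1≡0 : UnoptimisedMult._×_ semiring p 1# ≡ 0#) (x^q≡x : ∀ x → x ^ (p ℕ.^ m) ≡ x)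
      (α : Fin Q) (α-moved : ∀ {d} → 0 ℕ.< d → d ℕ.< m → α ^ (p ℕ.^ d) ≢ α) where
      open FieldProperties 𝔽
      open UnoptimisedMult semiring renaming (_×_ to _·_)
      open Frobenius commutativeRing p p-prime p×1≡0
      open ≡-Reasoning

      1<p : 1 ℕ.< p
      1<p = ℕ.nonTrivial⇒n>1 p {{prime⇒nonTrivial p-prime}}

      -- `f` lists the coefficients of T^q - T. For q ≥ 2 its leading coefficient 1 does not meet
      -- the -1 at degree 1, so q + 1 distinct roots are too many.
      few-fixed-points : ∀ {q} → 1 ℕ.< q → (∀ x → x ^ q ≡ x) → Q ℕ.≤ q
      few-fixed-points {suc zero} (s≤s ())
      few-fixed-points {suc (suc q)} _ x^q≡x = ℕ.≮⇒≥ λ q<Q →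
        let r = λ (i : Fin (suc (suc (suc q)))) → Fin.inject≤ i q<Q in
        1≢0 (trans (sym (monomial-top q)) (many-roots⇒zero f r (Fin.inject≤-injective q<Q q<Q _ _) (root ∘ r) (suc (suc (fromℕ q)))))
        where
        f : Fin (suc (suc (suc q))) → Fin Q
        f zero          = 0#
        f (suc zero)    = - 1#
        f (suc (suc i)) = monomial q i
        root : ∀ x → eval f x ≡ 0#
        root x = begin
          0# + x * (- 1# + x * eval (monomial q) x)  ≡⟨ cong (λ y → 0# + x * (- 1# + x * y)) (eval-monomial q x) ⟩
          0# + x * (- 1# + x * x ^ q) ≡⟨ solve 2 (λ x y → con 0ℤ :+ x :* (:- con 1ℤ :+ x :* y) := x :* (x :* y) :- x) refl x (x ^ q) ⟩
          x ^ suc (suc q) - x ≡⟨ x≡y⇒x-y≡0 (x^q≡x x) ⟩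
          0# ∎

      0^p≡0 : 0# ^ p ≡ 0#
      0^p≡0 = trans (cong (0# ^_) (sym (ℕ.suc-pred p {{prime⇒nonZero p-prime}}))) (zeroˡ (0# ^ ℕ.pred p))

      constant-^p : ∀ j → (j · 1#) ^ p ≡ j · 1#
      constant-^p zero    = 0^p≡0
      constant-^p (suc j) = trans (frobenius-+ 1# (j · 1#)) (cong₂ _+_ (1^n≡1 p) (constant-^p j))

      -- If the difference d is positive, it is below p and hence coprime to p. Bézout then writes 1
      -- in terms of p and d, whose images in the field both vanish.
      constant-injective-≤ : ∀ {a b} → a ℕ.≤ b → b ℕ.< p → a · 1# ≡ b · 1# → a ≡ b
      constant-injective-≤ {a} {b} a≤b b<p eq with d , refl ← ℕ.m≤n⇒∃[o]m+o≡n a≤b = go d refl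
        where
        go : ∀ d′ → d′ ≡ d → a ≡ a ℕ.+ d
        go zero      refl = sym (ℕ.+-identityʳ a)
        go (suc d-1) refl = contradiction (bezout (Bézout.identity (coprime⇒GCD≡1 (prime⇒coprime p-prime (ℕ.≤-<-trans (ℕ.m≤n+m d a) b<p))))) 1≢0
          where
          d·1≡0 : d · 1# ≡ 0#
          d·1≡0 = begin
            d · 1# ≡⟨ solve 2 (λ x y → x := (y :+ x) :- y) refl (d · 1#) (a · 1#) ⟩
            (a · 1# + d · 1#) - a · 1# ≡⟨ cong₂ _-_ (sym (×-homo-+ 1# a d)) refl ⟩
            (a ℕ.+ d) · 1# - a · 1# ≡⟨ x≡y⇒x-y≡0 (sym eq) ⟩
            0# ∎
          multiple≡0 : ∀ y {c} → c · 1# ≡ 0# → (y ℕ.* c) · 1# ≡ 0#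
          multiple≡0 y {c} c·1≡0 = trans (×1-homo-* y c) (trans (cong (y · 1# *_) c·1≡0) (zeroʳ (y · 1#)))
          one≡0 : ∀ {x y c c′} → c · 1# ≡ 0# → c′ · 1# ≡ 0# → 1 ℕ.+ y ℕ.* c ≡ x ℕ.* c′ → 1# ≡ 0#
          one≡0 {x} {y} {c} {c′} c≡0 c′≡0 eq = begin
            1# ≡⟨ +-identityʳ 1# ⟨
            1# + 0# ≡⟨ cong (λ z → 1# + z) (multiple≡0 y c≡0) ⟨
            (1 ℕ.+ y ℕ.* c) · 1# ≡⟨ cong (_· 1#) eq ⟩
            (x ℕ.* c′) · 1# ≡⟨ multiple≡0 x c′≡0 ⟩
            0# ∎
          bezout : Bézout.Identity 1 p d → 1# ≡ 0#
          bezout (Bézout.+- x y eq) = one≡0 {x} {y} d·1≡0 p×1≡0 eq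
          bezout (Bézout.-+ x y eq) = one≡0 {y} {x} p×1≡0 d·1≡0 eq

      constant-injective : ∀ {a b} → a ℕ.< p → b ℕ.< p → a · 1# ≡ b · 1# → a ≡ b
      constant-injective {a} {b} a<p b<p eq = [ (λ a≤b → constant-injective-≤ a≤b b<p eq) , (λ b≤a → sym (constant-injective-≤ b≤a a<p (sym eq))) ]′ (ℕ.≤-total a b)

      constants : ∀ {d} → (Fin d → Fin p) → Fin d → Fin Q
      constants c i = toℕ (c i) · 1#

      eval-^p : ∀ {d} (c : Fin d → Fin p) x → eval (constants c) x ^ p ≡ eval (constants c) (x ^ p)
      eval-^p {zero}  c x = 0^p≡0
      eval-^p {suc d} c x = begin
        (constants c zero + x * eval (constants (c ∘ suc)) x) ^ p ≡⟨ frobenius-+ _ _ ⟩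
        constants c zero ^ p + (x * eval (constants (c ∘ suc)) x) ^ p ≡⟨ cong₂ _+_ (constant-^p (toℕ (c zero))) (^-distrib-* x _ p) ⟩
        constants c zero + x ^ p * eval (constants (c ∘ suc)) x ^ p ≡⟨ cong (λ y → constants c zero + x ^ p * y) (eval-^p (c ∘ suc) x) ⟩
        constants c zero + x ^ p * eval (constants (c ∘ suc)) (x ^ p) ∎

      conjugate : ℕ → Fin Q
      conjugate d = α ^ (p ℕ.^ d)

      conjugate-suc : ∀ d → conjugate (suc d) ≡ conjugate d ^ p
      conjugate-suc d = trans (cong (α ^_) (ℕ.*-comm p (p ℕ.^ d))) (sym (^-assocʳ α (p ℕ.^ d) p))

      same-at-conjugates : ∀ {c c′ : Fin m → Fin p} → eval (constants c) α ≡ eval (constants c′) α →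
                           ∀ d → eval (constants c) (conjugate d) ≡ eval (constants c′) (conjugate d)
      same-at-conjugates {c} {c′} eq zero    = subst (λ x → eval (constants c) x ≡ eval (constants c′) x) (sym (*-identityʳ α)) eq
      same-at-conjugates {c} {c′} eq (suc d) = subst (λ x → eval (constants c) x ≡ eval (constants c′) x) (sym (conjugate-suc d))
        (trans (sym (eval-^p c (conjugate d))) (trans (cong (_^ p) (same-at-conjugates {c} {c′} eq d)) (eval-^p c′ (conjugate d))))

      -- Raising an equality of the ath and bth conjugates to the power p^(m - a) turns the first
      -- into α^(p^m) = α and the second into α^(p^(m + b - a)) = α^(p^(b - a)). Then α would be
      -- fixed by a power of Frobenius that moves it.
      conjugates-distinct : ∀ {a b} → a ℕ.< b → b ℕ.< m → conjugate a ≢ conjugate b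
      conjugates-distinct {a} {b} a<b b<m eq = α-moved (ℕ.m<n⇒0<n∸m a<b) (ℕ.≤-<-trans (ℕ.m∸n≤m b a) b<m) (begin
        α ^ (p ℕ.^ (b ℕ.∸ a)) ≡⟨ cong (_^ (p ℕ.^ (b ℕ.∸ a))) (x^q≡x α) ⟨
        (α ^ (p ℕ.^ m)) ^ (p ℕ.^ (b ℕ.∸ a)) ≡⟨ compose m (b ℕ.∸ a) ⟩
        α ^ (p ℕ.^ (m ℕ.+ (b ℕ.∸ a))) ≡⟨ cong (λ e → α ^ (p ℕ.^ e)) exponents ⟩
        α ^ (p ℕ.^ (b ℕ.+ (m ℕ.∸ a))) ≡⟨ compose b (m ℕ.∸ a) ⟨
        conjugate b ^ (p ℕ.^ (m ℕ.∸ a)) ≡⟨ cong (_^ (p ℕ.^ (m ℕ.∸ a))) eq ⟨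
        conjugate a ^ (p ℕ.^ (m ℕ.∸ a)) ≡⟨ compose a (m ℕ.∸ a) ⟩
        α ^ (p ℕ.^ (a ℕ.+ (m ℕ.∸ a))) ≡⟨ cong (λ e → α ^ (p ℕ.^ e)) (ℕ.m+[n∸m]≡n a≤m) ⟩
        α ^ (p ℕ.^ m) ≡⟨ x^q≡x α ⟩
        α ∎)
        where
        a≤m : a ℕ.≤ m
        a≤m = ℕ.<⇒≤ (ℕ.<-trans a<b b<m)
        compose : ∀ i j → (α ^ (p ℕ.^ i)) ^ (p ℕ.^ j) ≡ α ^ (p ℕ.^ (i ℕ.+ j))
        compose i j = trans (^-assocʳ α (p ℕ.^ i) (p ℕ.^ j)) (cong (α ^_) (sym (ℕ.^-distribˡ-+-* p i j)))
        exponents : m ℕ.+ (b ℕ.∸ a) ≡ b ℕ.+ (m ℕ.∸ a)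
        exponents = trans (sym (ℕ.+-∸-assoc m (ℕ.<⇒≤ a<b))) (trans (cong (ℕ._∸ a) (ℕ.+-comm m b)) (ℕ.+-∸-assoc b a≤m))

      eval-- : ∀ {d} (f g : Fin d → Fin Q) x → eval (λ i → f i - g i) x ≡ eval f x - eval g x
      eval-- {zero}  f g x = sym (-‿inverseʳ 0#)
      eval-- {suc d} f g x = trans (cong (λ y → f zero - g zero + x * y) (eval-- (f ∘ suc) (g ∘ suc) x))
        (solve 5 (λ a b x u v → a :- b :+ x :* (u :- v) := a :+ x :* u :- (b :+ x :* v)) refl (f zero) (g zero) x (eval (f ∘ suc) x) (eval (g ∘ suc) x))

      -- 1, α, …, α^(m−1) are linearly independent over the prime field: a relation of degree < m would
      -- vanish at the m conjugates of α.
      independent-powers : ∀ {c c′ : Fin m → Fin p} → eval (constants c) α ≡ eval (constants c′) α → ∀ i → c i ≡ c′ i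
      independent-powers {c} {c′} eq i = Fin.toℕ-injective (constant-injective (Fin.toℕ<n (c i)) (Fin.toℕ<n (c′ i))
        (x-y≡0⇒x≡y _ _ (many-roots⇒zero (λ i → constants c i - constants c′ i) (conjugate ∘ toℕ) conjugates-injective root i)))
        where
        root : ∀ i → eval (λ i → constants c i - constants c′ i) (conjugate (toℕ i)) ≡ 0#
        root i = trans (eval-- (constants c) (constants c′) (conjugate (toℕ i))) (x≡y⇒x-y≡0 (same-at-conjugates {c} {c′} eq (toℕ i)))
        conjugates-injective : ∀ {i j : Fin m} → conjugate (toℕ i) ≡ conjugate (toℕ j) → i ≡ j
        conjugates-injective {i} {j} eq = by-order (Fin.<-cmp i j)
          where
          by-order : Tri (i Fin.< j) (i ≡ j) (j Fin.< i) → i ≡ j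
          by-order (tri< i<j _ _) = contradiction eq (conjugates-distinct i<j (Fin.toℕ<n j))
          by-order (tri≈ _ i≡j _) = i≡j
          by-order (tri> _ _ j<i) = contradiction (sym eq) (conjugates-distinct j<i (Fin.toℕ<n i))

      p^m≤Q : p ℕ.^ m ℕ.≤ Q
      p^m≤Q = Fin.injective⇒≤ {f = λ e → eval (constants (finToFun {p} {m} e)) α} λ {e} {e′} eq →
        trans (sym (Fin.funToFin-finToFin {m} {p} e)) (trans (funToFin-cong {m} (independent-powers eq)) (Fin.funToFin-finToFin {m} {p} e′))
        where
        funToFin-cong : ∀ {d} {f g : Fin d → Fin p} → (∀ i → f i ≡ g i) → funToFin f ≡ funToFin g
        funToFin-cong {zero}  f≗g = refl
        funToFin-cong {suc d} f≗g = cong₂ Fin.combine (f≗g zero) (funToFin-cong (f≗g ∘ suc))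

      1<q : 1 ℕ.< p ℕ.^ m
      1<q = ℕ.<-≤-trans 1<p (ℕ.≤-trans (ℕ.≤-reflexive (sym (ℕ.^-identityʳ p))) (ℕ.^-monoʳ-≤ p {{prime⇒nonZero p-prime}} 0<m))

      Q≡p^m : Q ≡ p ℕ.^ m
      Q≡p^m = ℕ.≤-antisym (few-fixed-points 1<q x^q≡x) p^m≤Q

  GaloisField : ℕ → Set
  GaloisField q = Σ[ 𝔽 ∈ FiniteField q ] (∀ x → FiniteField._^_ 𝔽 x q ≡ x)

  module Construction {p m n} (p-prime : Prime p) .{{_ : NonZero p}} .{{_ : NonZero n}} (pᵐ≡1+n : p ℕ.^ suc m ≡ suc n) where
    open GroupAlgebra p n using (_≈_; mk≈; exact; one; negate; negate-inverse; _≈?_; elements; elements-complete) renaming (commutativeRing to A)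
    open PrimeGroupAlgebra p n (suc m) p-prime pᵐ≡1+n
    module A = CommutativeRing A
    open UnoptimisedMult A.semiring using () renaming (_×_ to _×ᴬ_)
    open SemiringExp A.semiring using () renaming (_^_ to _^ᴬ_)

    open IdempotentQuotient.Factor A _≈?_ elements elements-complete n (ℕ.>-nonZero⁻¹ n) ^q (separator m) (separator≉[] refl)
    module K = CommutativeRing quotientRing
    open UnoptimisedMult K.semiring using () renaming (_×_ to _×ᴷ_)
    open SemiringExp K.semiring using () renaming (_^_ to _^ᴷ_)

    ×ᴷ≡×ᴬ : ∀ j a → j ×ᴷ a ≡ j ×ᴬ a
    ×ᴷ≡×ᴬ zero    a = refl
    ×ᴷ≡×ᴬ (suc j) a = cong (a A.+_) (×ᴷ≡×ᴬ j a)

    ^ᴷ≡^ᴬ : ∀ a j → a ^ᴷ j ≡ a ^ᴬ j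
    ^ᴷ≡^ᴬ a zero    = refl
    ^ᴷ≡^ᴬ a (suc j) = cong (a A.*_) (^ᴷ≡^ᴬ a j)

    X : List ℕ
    X = X^ 1

    X*Xⁿ⁻¹≈1 : X A.* X^ ℕ.pred n ≈ one
    X*Xⁿ⁻¹≈1 = exact λ h periodic → cong (ℕ._+ 0) (trans (cong h (ℕ.suc-pred n)) (periodic 0))

    factor∼0⇒separator∼0 : ∀ {d} j → d ℕ.≤ j → 0 ℕ.< d → X^exponent-1 d ∼ [] → separator j ∼ []
    factor∼0⇒separator∼0 zero    z≤n () _
    factor∼0⇒separator∼0 {d} (suc j) d≤1+j 0<d factor∼0 = [ older , newest ]′ (ℕ.m≤n⇒m<n∨m≡n d≤1+j)
      where
      older : d ℕ.< suc j → separator (suc j) ∼ []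
      older d≤j = K.trans (K.*-congˡ {X^exponent-1 (suc j)} (factor∼0⇒separator∼0 j (ℕ.s≤s⁻¹ d≤j) 0<d factor∼0)) (K.zeroʳ (X^exponent-1 (suc j)))
      newest : d ≡ suc j → separator (suc j) ∼ []
      newest refl = K.*-congʳ {separator j} factor∼0

    -- X is invertible, so X^(p^d) ∼ X would give X^(p^d - 1) ∼ 1. A factor of the separator would
    -- vanish, and with it the separator, which is the u kept nonzero by the idempotent.
    X-moved : ∀ {d} → 0 ℕ.< d → d ℕ.< suc m → ¬ (X ^ᴬ (p ℕ.^ d) ∼ X)
    X-moved {d} 0<d d≤m fixed = u≁0 (factor∼0⇒separator∼0 m (ℕ.s≤s⁻¹ d≤m) 0<d
      (K.trans (K.+-congʳ {negate one} Xᵉ∼1) (≈⇒∼ (negate-inverse one))))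
      where
      Xᵉ : List ℕ
      Xᵉ = X^ exponent d
      X*Xᵉ∼X : X A.* Xᵉ ∼ X
      X*Xᵉ∼X = K.trans (≈⇒∼ (A.trans (A.reflexive (cong X^_ (trans (1+exponent≡p^ d) (sym (ℕ.+-identityʳ (p ℕ.^ d)))))) (A.sym (X^-^ 1 (p ℕ.^ d))))) fixed
      Xᵉ∼1 : Xᵉ ∼ one
      Xᵉ∼1 = K.trans (≈⇒∼ (begin
        Xᵉ ≈⟨ A.*-identityˡ Xᵉ ⟨
        one A.* Xᵉ ≈⟨ A.*-congʳ {Xᵉ} X*Xⁿ⁻¹≈1 ⟨
        (X A.* X^ ℕ.pred n) A.* Xᵉ ≈⟨ A.*-congʳ {Xᵉ} (A.*-comm X (X^ ℕ.pred n)) ⟩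
        (X^ ℕ.pred n A.* X) A.* Xᵉ ≈⟨ A.*-assoc (X^ ℕ.pred n) X Xᵉ ⟩
        X^ ℕ.pred n A.* (X A.* Xᵉ) ∎))
        (K.trans (K.*-congˡ {X^ ℕ.pred n} X*Xᵉ∼X) (≈⇒∼ (A.trans (A.*-comm (X^ ℕ.pred n) X) X*Xⁿ⁻¹≈1)))
        where open import Relation.Binary.Reasoning.Setoid A.setoid

    open FiniteRing.FieldOnFin quotientRing _∼?_ elements (λ a → Any.map ≈⇒∼ (elements-complete a)) 1≁0 inverse *-inverse

    to-^ᴬ : ∀ i j → to (i ^ᶠ j) ∼ to i ^ᴬ j
    to-^ᴬ i j = K.trans (to-^ i j) (K.reflexive (^ᴷ≡^ᴬ (to i) j))

    characteristicᶠ : p ×ᶠ 1ᶠ ≡ 0ᶠ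
    characteristicᶠ = to-injective (K.trans (to-× p) (K.trans (K.reflexive (×ᴷ≡×ᴬ p one)) (K.trans (≈⇒∼ characteristic) (K.sym (to-from [])))))

    ^qᶠ : ∀ i → i ^ᶠ (p ℕ.^ suc m) ≡ i
    ^qᶠ i = to-injective (K.trans (to-^ᴬ i (p ℕ.^ suc m)) (K.trans (K.reflexive (cong (to i ^ᴬ_) pᵐ≡1+n)) (≈⇒∼ (^q (to i)))))

    α-moved : ∀ {d} → 0 ℕ.< d → d ℕ.< suc m → from X ^ᶠ (p ℕ.^ d) ≢ from X
    α-moved {d} 0<d d≤m eq = X-moved 0<d d≤m (K.trans (^ᴬ-cong (p ℕ.^ d) (K.sym (to-from X))) (K.trans (K.sym (to-^ᴬ (from X) (p ℕ.^ d))) (K.trans (K.reflexive (cong to eq)) (to-from X))))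
      where
      ^ᴬ-cong : ∀ j {a b} → a ∼ b → a ^ᴬ j ∼ b ^ᴬ j
      ^ᴬ-cong zero    a∼b = K.refl
      ^ᴬ-cong (suc j) a∼b = K.*-cong a∼b (^ᴬ-cong j a∼b)

    galois-field : GaloisField (p ℕ.^ suc m)
    galois-field = resize (FieldSize.Count.Q≡p^m field-on-Fin p-prime z<s characteristicᶠ ^qᶠ (from X) α-moved) field-on-Fin ^qᶠ
      where
      resize : ∀ {Q q} → Q ≡ q → (𝔽 : FiniteField Q) → (∀ x → FiniteField._^_ 𝔽 x q ≡ x) → GaloisField q
      resize refl 𝔽 x^q≡x = 𝔽 , x^q≡x

  galois-field : ∀ {p m} → Prime p → 0 ℕ.< m → GaloisField (p ℕ.^ m)
  galois-field {p} {suc m} p-prime _ = Construction.galois-field {p} {m} {ℕ.pred (p ℕ.^ suc m)} p-prime (sym (ℕ.suc-pred (p ℕ.^ suc m)))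
    where
    instance
      p≢0 : NonZero p
      p≢0 = prime⇒nonZero p-prime
      q≢0 : NonZero (p ℕ.^ suc m)
      q≢0 = ℕ.m^n≢0 p (suc m)
      n≢0 : NonZero (ℕ.pred (p ℕ.^ suc m))
      n≢0 = ℕ.>-nonZero (ℕ.s≤s⁻¹ (subst (1 ℕ.<_) (sym (ℕ.suc-pred (p ℕ.^ suc m))) (ℕ.<-≤-trans 1<p (ℕ.m≤m*n p (p ℕ.^ m) {{ℕ.m^n≢0 p m}}))))
        where
        1<p : 1 ℕ.< p
        1<p = ℕ.nonTrivial⇒n>1 p {{prime⇒nonTrivial p-prime}}

-- A generator of the multiplicative group, and discrete logarithms.

module PrimitiveRoots where
  open Counting
  open FiniteFields
  open import Data.Fin.Base as Fin using (Fin; zero; suc; toℕ)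
  import Data.Fin.Properties as Fin
  open import Data.List.Base using ([]; _∷_)
  open import Data.List.Relation.Unary.All using ([]; _∷_)
  open import Data.Nat.Base as ℕ using (ℕ; zero; suc; NonZero; s≤s)
  import Data.Nat.Properties as ℕ
  open import Data.Nat.Coprimality using (Coprime; coprime⇒GCD≡1)
  open import Data.Nat.Divisibility using (_∣_; _∤_; _∣?_; divides; ∣⇒≤; m∣m*n; n∣m*n; ∣1⇒≡1)
  open import Data.Nat.GCD using (module Bézout; gcd; gcd-GCD; gcd[m,n]∣m; gcd[m,n]∣n)
  open import Data.Nat.Induction using (<-rec)
  open import Data.Nat.Primality using (Prime; prime?; euclidsLemma; prime⇒irreducible; prime⇒nonZero; prime⇒nonTrivial; ¬prime[1])
  open import Data.Nat.ListAction using (product)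
  open import Data.Nat.Primality.Factorisation using (factorise)
  open import Data.Product.Base using (_×_; _,_; ∃; ∃₂; proj₁; proj₂)
  open import Data.Sum.Base using (inj₁; inj₂; [_,_]′)
  open import Data.Nat.Solver using (module +-*-Solver)
  open import Function.Base using (_∘_)
  open import Relation.Binary.PropositionalEquality
  open import Relation.Nullary

  prime-divisor : ∀ {s} → 1 ℕ.< s → ∃ λ ℓ → Prime ℓ × ℓ ∣ s
  prime-divisor {s@(suc _)} 1<s with factorise s
  ... | record { factors = []     ; isFactorisation = s≡1 } = contradiction (sym s≡1) (ℕ.<⇒≢ 1<s)
  ... | record { factors = ℓ ∷ ps ; isFactorisation = s≡ℓ*m ; factorsPrime = ℓ-prime ∷ _ } = ℓ , ℓ-prime , subst (ℓ ∣_) (sym s≡ℓ*m) (m∣m*n (product ps))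

  remove-factor : ∀ {t} → 1 ℕ.< t → ∀ n → .{{NonZero n}} → ∃₂ λ a r → n ≡ t ℕ.^ a ℕ.* r × t ∤ r
  remove-factor {t} 1<t = <-rec (λ n → .{{NonZero n}} → ∃₂ λ a r → n ≡ t ℕ.^ a ℕ.* r × t ∤ r) go
    where
    go : ∀ n → (∀ {m} → m ℕ.< n → .{{NonZero m}} → ∃₂ λ a r → m ≡ t ℕ.^ a ℕ.* r × t ∤ r) →
         .{{NonZero n}} → ∃₂ λ a r → n ≡ t ℕ.^ a ℕ.* r × t ∤ r
    go n rec with t ∣? n
    ... | no t∤n = 0 , n , sym (ℕ.*-identityˡ n) , t∤n
    ... | yes (divides m@(suc _) refl) with a , r , m≡ , t∤r ← rec (ℕ.m<m*n m t 1<t) =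
      suc a , r , trans (ℕ.*-comm m t) (trans (cong (t ℕ.*_) m≡) (sym (ℕ.*-assoc t (t ℕ.^ a) r))) , t∤r

  prime-∣-^ : ∀ {ℓ t} → Prime ℓ → ∀ a → ℓ ∣ t ℕ.^ a → ℓ ∣ t
  prime-∣-^ ℓ-prime zero    ℓ∣1 = contradiction (subst Prime (∣1⇒≡1 ℓ∣1) ℓ-prime) ¬prime[1]
  prime-∣-^ ℓ-prime (suc a) ℓ∣  = [ (λ ℓ∣t → ℓ∣t) , prime-∣-^ ℓ-prime a ]′ (euclidsLemma _ _ ℓ-prime ℓ∣)

  prime-∣-prime : ∀ {ℓ t} → Prime ℓ → Prime t → ℓ ∣ t → ℓ ≡ t
  prime-∣-prime ℓ-prime t-prime ℓ∣t with prime⇒irreducible t-prime ℓ∣t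
  ... | inj₁ refl = contradiction ℓ-prime ¬prime[1]
  ... | inj₂ ℓ≡t  = ℓ≡t

  prime-∤⇒coprime : ∀ {t r} → Prime t → t ∤ r → Coprime t r
  prime-∤⇒coprime t-prime t∤r {d} (d∣t , d∣r) with prime⇒irreducible t-prime d∣t
  ... | inj₁ d≡1  = d≡1
  ... | inj₂ refl = contradiction d∣r t∤r

  -- An order that divides n properly also divides n / ℓ for some prime ℓ. Hence the powers n / ℓ
  -- suffice to recognise a generator.
  proper-divisor : ∀ {e n} → e ∣ n → e ℕ.< n → ∃₂ λ ℓ c → Prime ℓ × n ≡ ℓ ℕ.* c × e ∣ c
  proper-divisor {e} (divides s refl) e<se with ℓ , ℓ-prime , divides s′ refl ← prime-divisor {s} (ℕ.≰⇒> λ s≤1 → ℕ.<⇒≱ e<se (ℕ.≤-trans (ℕ.*-monoˡ-≤ e s≤1) (ℕ.≤-reflexive (ℕ.*-identityˡ e)))) =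
    ℓ , s′ ℕ.* e , ℓ-prime , solve 3 (λ s l e → s :* l :* e := l :* (s :* e)) refl s′ ℓ e , n∣m*n s′
    where
    open +-*-Solver

  multiple-below : ∀ {m n} → m ∣ n → n ℕ.< m → n ≡ 0
  multiple-below {n = zero}  _   _   = refl
  multiple-below {n = suc n} m∣n n<m = contradiction (∣⇒≤ m∣n) (ℕ.<⇒≱ n<m)

  module PrimitiveRoot {n} (𝔽 : FiniteField (suc n)) (0<n : 0 ℕ.< n)
    (fermat : ∀ {x} → x ≢ FiniteField.0# 𝔽 → FiniteField._^_ 𝔽 x n ≡ FiniteField.1# 𝔽) where
    open FiniteField 𝔽
    open FieldProperties 𝔽
    private
      instance
        n≢0 : NonZero n
        n≢0 = ℕ.>-nonZero 0<n

    ^-gcd : ∀ x {a b d} → Bézout.Identity d a b → x ^ a ≡ 1# → x ^ b ≡ 1# → x ^ d ≡ 1#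
    ^-gcd x {a} {b} {d} (Bézout.+- i j d+jb≡ia) xᵃ≡1 xᵇ≡1 = begin
      x ^ d ≡⟨ *-identityʳ _ ⟨
      x ^ d * 1# ≡⟨ cong (x ^ d *_) (^-*-≡1 x b j xᵇ≡1) ⟨
      x ^ d * x ^ (b ℕ.* j) ≡⟨ ^-homo-* x d (b ℕ.* j) ⟨
      x ^ (d ℕ.+ b ℕ.* j) ≡⟨ cong (x ^_) (trans (cong (d ℕ.+_) (ℕ.*-comm b j)) (trans d+jb≡ia (ℕ.*-comm i a))) ⟩
      x ^ (a ℕ.* i) ≡⟨ ^-*-≡1 x a i xᵃ≡1 ⟩
      1# ∎
      where open ≡-Reasoning
    ^-gcd x (Bézout.-+ i j d+ia≡jb) xᵃ≡1 xᵇ≡1 = ^-gcd x (Bézout.+- j i d+ia≡jb) xᵇ≡1 xᵃ≡1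

    nonroot : ∀ {c} → 0 ℕ.< c → c ℕ.< n → ∃ λ x → x ≢ 0# × x ^ c ≢ 1#
    -- `punchIn 0#` enumerates the n nonzero elements, and `inject≤` selects c + 1 of them; they
    -- cannot all be roots of x^c = 1.
    nonroot {c} 0<c c<n with Fin.all? (λ i → Fin.punchIn 0# (Fin.inject≤ i c<n) ^ c Fin.≟ 1#)
    ... | yes all = contradiction all (few-dth-roots 0<c _ (λ eq → Fin.inject≤-injective c<n c<n _ _ (Fin.punchIn-injective 0# _ _ eq)))
    ... | no ¬all with i , ≢1 ← Fin.¬∀⟶∃¬ _ _ (λ i → Fin.punchIn 0# (Fin.inject≤ i c<n) ^ c Fin.≟ 1#) ¬all =
      _ , Fin.punchInᵢ≢i 0# _ , ≢1

    -- At t = n + 1 every prime divisor of n is covered, and a nonzero z with this property has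
    -- order exactly n.
    AvoidsPrimesBelow : ℕ → Fin (suc n) → Set
    AvoidsPrimesBelow t z = ∀ {ℓ c} → ℓ ℕ.< t → Prime ℓ → n ≡ ℓ ℕ.* c → z ^ c ≢ 1#

    avoids-next : ∀ {t z} → AvoidsPrimesBelow t z → (∀ {c} → Prime t → n ≡ t ℕ.* c → z ^ c ≢ 1#) →
                  AvoidsPrimesBelow (suc t) z
    avoids-next below at ℓ<1+t with ℕ.m≤n⇒m<n∨m≡n (ℕ.s≤s⁻¹ ℓ<1+t)
    ... | inj₁ ℓ<t  = below ℓ<t
    ... | inj₂ refl = at

    -- If z fails at the prime t, it is multiplied by a power of some x with x ^ (n / t) ≢ 1#, namely
    -- by the part of x of t-power order, which does not disturb the smaller primes.
    avoids-primes-below : ∀ t → ∃ λ z → z ≢ 0# × AvoidsPrimesBelow t z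
    avoids-primes-below zero = 1# , 1≢0 , λ ()
    avoids-primes-below (suc t) with avoids-primes-below t | prime? t | t ∣? n
    ... | z , z≢0 , good | no ¬prime   | _      = z , z≢0 , avoids-next good (λ t-prime → contradiction t-prime ¬prime)
    ... | z , z≢0 , good | yes _       | no t∤n = z , z≢0 , avoids-next good (λ _ n≡ → contradiction (subst (t ∣_) (sym n≡) (m∣m*n _)) t∤n)
    ... | z , z≢0 , good | yes t-prime | yes (divides c n≡ct) = result
      where
      1<t : 1 ℕ.< t
      1<t = ℕ.nonTrivial⇒n>1 t {{prime⇒nonTrivial t-prime}}
      0<c : 0 ℕ.< c
      0<c = ℕ.n≢0⇒n>0 λ { refl → contradiction (sym n≡ct) (ℕ.<⇒≢ 0<n) }
      c<n : c ℕ.< n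
      c<n = subst (c ℕ.<_) (sym n≡ct) (ℕ.m<m*n c t {{ℕ.>-nonZero 0<c}} 1<t)
      split : ∃₂ λ a r → n ≡ t ℕ.^ a ℕ.* r × t ∤ r
      split = remove-factor 1<t n
      a = proj₁ split
      r = proj₁ (proj₂ split)
      n≡tᵃr = proj₁ (proj₂ (proj₂ split))
      t∤r   = proj₂ (proj₂ (proj₂ split))
      x   = proj₁ (nonroot 0<c c<n)
      x≢0 = proj₁ (proj₂ (nonroot 0<c c<n))
      xᶜ≢1 = proj₂ (proj₂ (nonroot 0<c c<n))
      y = x ^ r
      unique : ∀ {d} → n ≡ t ℕ.* d → d ≡ c
      unique n≡td = ℕ.*-cancelˡ-≡ _ c t {{prime⇒nonZero t-prime}} (trans (sym n≡td) (trans n≡ct (ℕ.*-comm c t)))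
      open ≡-Reasoning
      below : ∀ {ℓ d} → ℓ ℕ.< t → Prime ℓ → n ≡ ℓ ℕ.* d → (z * y) ^ d ≢ 1#
      below {ℓ} {d} ℓ<t ℓ-prime n≡ℓd eq with euclidsLemma (t ℕ.^ a) r ℓ-prime (divides d (trans (sym n≡tᵃr) (trans n≡ℓd (ℕ.*-comm ℓ d))))
      ... | inj₁ ℓ∣tᵃ = contradiction (prime-∣-prime ℓ-prime t-prime (prime-∣-^ ℓ-prime a ℓ∣tᵃ)) (ℕ.<⇒≢ ℓ<t)
      -- Here ℓ divides r, so r · (n / ℓ) is a multiple of n and y^(n / ℓ) = 1: the new factor has
      -- no effect at ℓ.
      ... | inj₂ (divides r′ r≡r′ℓ) = good ℓ<t ℓ-prime n≡ℓd (begin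
        z ^ d ≡⟨ *-identityʳ _ ⟨
        z ^ d * 1# ≡⟨ cong (z ^ d *_) yᵈ≡1 ⟨
        z ^ d * y ^ d ≡⟨ ^-distrib-* z y d ⟨
        (z * y) ^ d ≡⟨ eq ⟩
        1# ∎)
        where
        yᵈ≡1 : y ^ d ≡ 1#
        yᵈ≡1 = begin
          (x ^ r) ^ d ≡⟨ ^-assocʳ x r d ⟩
          x ^ (r ℕ.* d) ≡⟨ cong (x ^_) (trans (cong (ℕ._* d) r≡r′ℓ) (trans (ℕ.*-assoc r′ ℓ d) (trans (cong (r′ ℕ.*_) (sym n≡ℓd)) (ℕ.*-comm r′ n)))) ⟩
          x ^ (n ℕ.* r′) ≡⟨ ^-*-≡1 x n r′ (fermat x≢0) ⟩
          1# ∎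
      -- Let u = x^c. Always u^t = x^n = 1, and z^c = (z y)^c = 1 would give u^r = y^c = 1. Since t
      -- and r are coprime, u = 1, against the choice of x.
      at-t : z ^ c ≡ 1# → (z * y) ^ c ≢ 1#
      at-t zᶜ≡1 eq = xᶜ≢1 (trans (sym (*-identityʳ _)) (^-gcd (x ^ c) (Bézout.identity (coprime⇒GCD≡1 (prime-∤⇒coprime t-prime t∤r))) uᵗ≡1 uʳ≡1))
        where
        uᵗ≡1 : (x ^ c) ^ t ≡ 1#
        uᵗ≡1 = trans (^-assocʳ x c t) (trans (cong (x ^_) (sym n≡ct)) (fermat x≢0))
        uʳ≡1 : (x ^ c) ^ r ≡ 1#
        uʳ≡1 = begin
          (x ^ c) ^ r ≡⟨ ^-assocʳ x c r ⟩
          x ^ (c ℕ.* r) ≡⟨ cong (x ^_) (ℕ.*-comm c r) ⟩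
          x ^ (r ℕ.* c) ≡⟨ ^-assocʳ x r c ⟨
          y ^ c ≡⟨ *-identityˡ _ ⟨
          1# * y ^ c ≡⟨ cong (_* y ^ c) zᶜ≡1 ⟨
          z ^ c * y ^ c ≡⟨ ^-distrib-* z y c ⟨
          (z * y) ^ c ≡⟨ eq ⟩
          1# ∎
      result : ∃ λ z → z ≢ 0# × AvoidsPrimesBelow (suc t) z
      result with z ^ c Fin.≟ 1#
      ... | no  zᶜ≢1 = z , z≢0 , avoids-next good (λ _ n≡ → zᶜ≢1 ∘ subst (λ c → z ^ c ≡ 1#) (unique n≡))
      ... | yes zᶜ≡1 = z * y , *-≢0 z≢0 (^-≢0 x≢0 r) , avoids-next below (λ _ n≡ → at-t zᶜ≡1 ∘ subst (λ c → (z * y) ^ c ≡ 1#) (unique n≡))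

    opaque
      g : Fin (suc n)
      g = proj₁ (avoids-primes-below (suc n))

      g≢0 : g ≢ 0#
      g≢0 = proj₁ (proj₂ (avoids-primes-below (suc n)))

      g-avoids-primes : AvoidsPrimesBelow (suc n) g
      g-avoids-primes = proj₂ (proj₂ (avoids-primes-below (suc n)))

    gⁿ≡1 : g ^ n ≡ 1#
    gⁿ≡1 = fermat g≢0

    -- g has power 1 at e = gcd(d, n). If e < n, then e divides n / ℓ for a prime ℓ, and g^(n / ℓ) =
    -- 1 contradicts the choice of g.
    g-order : ∀ {d} → g ^ d ≡ 1# → n ∣ d
    g-order {d} gᵈ≡1 with n ℕ.≤? gcd d n
    ... | yes n≤e = subst (_∣ d) (ℕ.≤-antisym (∣⇒≤ (gcd[m,n]∣n d n)) n≤e) (gcd[m,n]∣m d n)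
    ... | no  n≰e with ℓ , c , ℓ-prime , n≡ℓc , divides s c≡se ← proper-divisor (gcd[m,n]∣n d n) (ℕ.≰⇒> n≰e) =
      contradiction (subst (λ c → g ^ c ≡ 1#) (trans (ℕ.*-comm (gcd d n) s) (sym c≡se)) (^-*-≡1 g (gcd d n) s gᵉ≡1))
                    (g-avoids-primes (s≤s (∣⇒≤ (subst (ℓ ∣_) (sym n≡ℓc) (m∣m*n c)))) ℓ-prime n≡ℓc)
      where
      gᵉ≡1 : g ^ gcd d n ≡ 1#
      gᵉ≡1 = ^-gcd g (Bézout.identity (gcd-GCD d n)) gᵈ≡1 gⁿ≡1

    ^-injective-mod : ∀ {a b} → a ℕ.≤ b → g ^ a ≡ g ^ b → n ∣ b ℕ.∸ a
    ^-injective-mod {a} {b} a≤b gᵃ≡gᵇ = g-order (*-cancelˡ-≢0 (^-≢0 g≢0 a) (begin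
      g ^ a * g ^ (b ℕ.∸ a) ≡⟨ ^-homo-* g a (b ℕ.∸ a) ⟨
      g ^ (a ℕ.+ (b ℕ.∸ a)) ≡⟨ cong (g ^_) (ℕ.m+[n∸m]≡n a≤b) ⟩
      g ^ b ≡⟨ gᵃ≡gᵇ ⟨
      g ^ a ≡⟨ *-identityʳ _ ⟨
      g ^ a * 1# ∎))
      where open ≡-Reasoning

    ^-injective-≤ : ∀ {a b} → a ℕ.≤ b → b ℕ.< n → g ^ a ≡ g ^ b → a ≡ b
    ^-injective-≤ {a} {b} a≤b b<n eq = ℕ.≤-antisym a≤b
      (ℕ.m∸n≡0⇒m≤n (multiple-below (^-injective-mod a≤b eq) (ℕ.≤-<-trans (ℕ.m∸n≤m b a) b<n)))

    ^-injective : ∀ {a b} → a ℕ.< n → b ℕ.< n → g ^ a ≡ g ^ b → a ≡ b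
    ^-injective {a} {b} a<n b<n eq with ℕ.≤-total a b
    ... | inj₁ a≤b = ^-injective-≤ a≤b b<n eq
    ... | inj₂ b≤a = sym (^-injective-≤ b≤a a<n (sym eq))

    opaque
      -- Together with 0, the n distinct powers of g make up n + 1 elements, hence the whole field.
      discrete-log : ∀ {x} → x ≢ 0# → ∃ λ (e : Fin n) → x ≡ g ^ toℕ e
      discrete-log {x} x≢0 with injective⇒surjective f f-injective x
        where
        f : Fin (suc n) → Fin (suc n)
        f zero    = 0#
        f (suc e) = g ^ toℕ e
        f-injective : ∀ {i j} → f i ≡ f j → i ≡ j
        f-injective {zero}  {zero}  _  = refl
        f-injective {zero}  {suc j} eq = contradiction (sym eq) (^-≢0 g≢0 (toℕ j))
        f-injective {suc i} {zero}  eq = contradiction eq (^-≢0 g≢0 (toℕ i))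
        f-injective {suc i} {suc j} eq = cong suc (Fin.toℕ-injective (^-injective (Fin.toℕ<n i) (Fin.toℕ<n j) eq))
      ... | zero  , 0≡x = contradiction (sym 0≡x) x≢0
      ... | suc e , gᵉ≡x = e , sym gᵉ≡x

-- Cycle systems developed from a base cycle, and a criterion for their orthogonality.

module StarterSystems where
  open import Defs public using (SameEdge; CyclicSuc; Cycle; Edge; CycleSystem; ShareAtMostOneEdge; Orthogonal; PairwiseOrthogonal)
  open Counting
  open FiniteFields
  open import Data.Fin.Base as Fin using (Fin; zero; suc; fromℕ<; combine; remQuot)
  import Data.Fin.Properties as Fin
  open import Data.Integer.Base using (1ℤ)
  open import Data.Nat.Base as ℕ using (ℕ; zero; suc)
  import Data.Nat.Properties as ℕ
  open import Data.Product.Base using (_×_; _,_; ∃; ∃₂; proj₁; proj₂)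
  open import Data.Sum.Base using (_⊎_; inj₁; inj₂; [_,_]′)
  open import Function.Base using (_∘_)
  open import Relation.Binary.PropositionalEquality
  open import Relation.Nullary

  ShareAtMostOneEdge-sym : ∀ {k n} {C D : Cycle k n} → ShareAtMostOneEdge C D → ShareAtMostOneEdge D C
  ShareAtMostOneEdge-sym once Dxy Cxy Dxy′ Cxy′ = once Cxy Dxy Cxy′ Dxy′

  Orthogonal-sym : ∀ {k n} (𝒞 𝒟 : CycleSystem k n) → Orthogonal 𝒞 𝒟 → Orthogonal 𝒟 𝒞
  Orthogonal-sym 𝒞 𝒟 orthogonal d c = ShareAtMostOneEdge-sym {C = CycleSystem.cycle 𝒞 c} {D = CycleSystem.cycle 𝒟 d} (orthogonal c d)

  SameEdge-swap : ∀ {n} {x y u v : Fin n} → SameEdge x y u v → SameEdge y x u v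
  SameEdge-swap (inj₁ (x≡u , y≡v)) = inj₂ (y≡v , x≡u)
  SameEdge-swap (inj₂ (x≡v , y≡u)) = inj₁ (y≡u , x≡v)

  SameEdge-join : ∀ {n} {x y x′ y′ u v : Fin n} → SameEdge x y u v → SameEdge x′ y′ u v → SameEdge x y x′ y′
  SameEdge-join (inj₁ (refl , refl)) (inj₁ (refl , refl)) = inj₁ (refl , refl)
  SameEdge-join (inj₁ (refl , refl)) (inj₂ (refl , refl)) = inj₂ (refl , refl)
  SameEdge-join (inj₂ (refl , refl)) (inj₁ (refl , refl)) = inj₂ (refl , refl)
  SameEdge-join (inj₂ (refl , refl)) (inj₂ (refl , refl)) = inj₁ (refl , refl)

  cyclic-successor : ∀ {k} (i : Fin k) → ∃ (CyclicSuc i)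
  cyclic-successor {suc k} i with ℕ.m≤n⇒m<n∨m≡n (Fin.toℕ<n i)
  ... | inj₁ 1+i<k = fromℕ< 1+i<k , inj₁ (Fin.toℕ-fromℕ< 1+i<k)
  ... | inj₂ 1+i≡k = zero , inj₂ (1+i≡k , refl)

  module StarterSystem {k w} (𝔽 : FiniteField (suc (2 ℕ.* k ℕ.* w)))
    (1≢-1 : FiniteField.1# 𝔽 ≢ FiniteField.-_ 𝔽 (FiniteField.1# 𝔽)) where
    open FiniteField 𝔽
    open FieldProperties 𝔽

    private
      q : ℕ
      q = suc (2 ℕ.* k ℕ.* w)
      F : Set
      F = Fin q

    x≡-x⇒x≡0 : ∀ {x} → x ≡ - x → x ≡ 0#
    x≡-x⇒x≡0 {x} x≡-x = x*y≡0⇒y≡0 1+1≢0 (begin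
      (1# + 1#) * x ≡⟨ solve 1 (λ x → (con 1ℤ :+ con 1ℤ) :* x := x :- :- x) refl x ⟩
      x - - x ≡⟨ x≡y⇒x-y≡0 x≡-x ⟩
      0# ∎)
      where
      open ≡-Reasoning
      1+1≢0 : 1# + 1# ≢ 0#
      1+1≢0 eq = 1≢-1 (x-y≡0⇒x≡y _ _ (trans (solve 0 (con 1ℤ :- :- con 1ℤ := con 1ℤ :+ con 1ℤ) refl) eq))

    -- This justifies the encoding used from here on: equality up to sign is stated as equality of
    -- squares.
    square-injective : ∀ {x y} → x * x ≡ y * y → x ≡ y ⊎ x ≡ - y
    square-injective {x} {y} x²≡y² with x Fin.≟ y
    ... | yes x≡y = inj₁ x≡y
    ... | no  x≢y = inj₂ (x-y≡0⇒x≡y _ _ (trans (solve 2 (λ x y → x :- :- y := x :+ y) refl x y)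
      (x*y≡0⇒y≡0 (x≢y ∘ x-y≡0⇒x≡y _ _) (trans (solve 2 (λ x y → (x :- y) :* (x :+ y) := x :* x :- y :* y) refl x y) (x≡y⇒x-y≡0 x²≡y²)))))

    square-neg : ∀ x → - x * - x ≡ x * x
    square-neg = solve 1 (λ x → :- x :* :- x := x :* x) refl

    -- The cycles h j * (b 0 , … , b (k − 1)) + t, for j < w and t in the field, form a k-cycle system:
    -- the differences d i of b, multiplied by the h j, represent each nonzero element once up to sign.
    record Starter : Set where
      field
        b d         : Fin k → F
        h           : Fin w → F
        b-injective : ∀ {i j} → b i ≡ b j → i ≡ j
        b-step      : ∀ {i j} → CyclicSuc i j → b j ≡ b i + d i
        h≢0         : ∀ j → h j ≢ 0#
        d≢0         : ∀ i → d i ≢ 0#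
        separated   : ∀ {j j′ i i′} → (h j * d i) * (h j * d i) ≡ (h j′ * d i′) * (h j′ * d i′) → j ≡ j′ × i ≡ i′

      signed : Fin 2 → F → F
      signed zero    x = x
      signed (suc _) x = - x

      signed-square : ∀ s x → signed s x * signed s x ≡ x * x
      signed-square zero    x = refl
      signed-square (suc _) x = square-neg x

      signed-injective : ∀ {s s′ x} → x ≢ 0# → signed s x ≡ signed s′ x → s ≡ s′
      signed-injective {zero}     {zero}     x≢0 eq = refl
      signed-injective {zero}     {suc zero} x≢0 eq = contradiction (x≡-x⇒x≡0 eq) x≢0
      signed-injective {suc zero} {zero}     x≢0 eq = contradiction (x≡-x⇒x≡0 (sym eq)) x≢0
      signed-injective {suc zero} {suc zero} x≢0 eq = refl

      difference : Fin 2 → Fin w → Fin k → F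
      difference s j i = signed s (h j * d i)

      difference-injective : ∀ {s s′ j j′ i i′} → difference s j i ≡ difference s′ j′ i′ → s ≡ s′ × j ≡ j′ × i ≡ i′
      difference-injective {s} {s′} {j} {j′} {i} {i′} eq
        with refl , refl ← separated {j} {j′} {i} {i′} (trans (sym (signed-square s _)) (trans (cong₂ _*_ eq eq) (signed-square s′ _)))
        = signed-injective (*-≢0 (h≢0 j) (d≢0 i)) eq , refl , refl

      -- The 2kw signed differences are nonzero and pairwise different, so together with 0 they
      -- exhaust the q = 2kw + 1 field elements.
      difference-surjective : ∀ {x} → x ≢ 0# → ∃ λ s → ∃₂ λ j i → x ≡ difference s j i
      difference-surjective {x} x≢0 = hit (injective⇒surjective f f-injective x)
        where
        outer : Fin (2 ℕ.* k ℕ.* w) → Fin (2 ℕ.* k)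
        outer e = proj₁ (remQuot {2 ℕ.* k} w e)
        sign : Fin (2 ℕ.* k ℕ.* w) → Fin 2
        sign e = proj₁ (remQuot {2} k (outer e))
        index : Fin (2 ℕ.* k ℕ.* w) → Fin k
        index e = proj₂ (remQuot {2} k (outer e))
        multiplier : Fin (2 ℕ.* k ℕ.* w) → Fin w
        multiplier e = proj₂ (remQuot {2 ℕ.* k} w e)
        encode : ∀ e → combine (combine (sign e) (index e)) (multiplier e) ≡ e
        encode e = trans (cong (λ c → combine c (multiplier e)) (Fin.combine-remQuot {2} k (outer e))) (Fin.combine-remQuot {2 ℕ.* k} w e)
        f : F → F
        f zero    = 0#
        f (suc e) = difference (sign e) (multiplier e) (index e)
        difference≢0 : ∀ s j i → difference s j i ≢ 0#
        difference≢0 zero    j i = *-≢0 (h≢0 j) (d≢0 i)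
        difference≢0 (suc _) j i = -‿≢0 (*-≢0 (h≢0 j) (d≢0 i))
        f-injective : ∀ {e e′} → f e ≡ f e′ → e ≡ e′
        f-injective {zero}  {zero}   _  = refl
        f-injective {zero}  {suc e′} eq = contradiction (sym eq) (difference≢0 (sign e′) (multiplier e′) (index e′))
        f-injective {suc e} {zero}   eq = contradiction eq (difference≢0 (sign e) (multiplier e) (index e))
        f-injective {suc e} {suc e′} eq
          with s≡ , j≡ , i≡ ← difference-injective {sign e} {sign e′} {multiplier e} {multiplier e′} {index e} {index e′} eq
          = cong suc (trans (sym (encode e)) (trans (cong₂ combine (cong₂ combine s≡ i≡) j≡) (encode e′)))
        hit : (∃ λ e → f e ≡ x) → ∃ λ s → ∃₂ λ j i → x ≡ difference s j i
        hit (zero  , 0≡x) = contradiction (sym 0≡x) x≢0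
        hit (suc e , eq)  = sign e , multiplier e , index e , sym eq

      point : Fin w → F → Fin k → F
      point j t i = h j * b i + t

      translate : Fin w → F → Cycle k q
      translate j t = record
        { vertex   = point j t
        ; distinct = λ {i} {i′} eq → b-injective (*-cancelˡ-≢0 (h≢0 j) (+-cancelʳ t eq))
        }
        where
        +-cancelʳ : ∀ t {x y} → x + t ≡ y + t → x ≡ y
        +-cancelʳ t {x} {y} eq = trans (solve 2 (λ x t → x := x :+ t :- t) refl x t) (trans (cong (_- t) eq) (solve 2 (λ y t → y :+ t :- t := y) refl y t))

      point-step : ∀ j t {i i′} → CyclicSuc i i′ → point j t i′ ≡ point j t i + h j * d i
      point-step j t {i} {i′} i→i′ = trans (cong (λ z → h j * z + t) (b-step i→i′))
        (solve 4 (λ h b d t → h :* (b :+ d) :+ t := h :* b :+ t :+ h :* d) refl (h j) (b i) (d i) t)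

      edge-index : ∀ {j t x y} → Edge (translate j t) x y →
                   ∃ λ i → SameEdge x y (point j t i) (point j t i + h j * d i)
      edge-index {j} {t} {x} {y} (i , i′ , i→i′ , same) = i , subst (SameEdge x y (point j t i)) (point-step j t i→i′) same

      index-edge : ∀ {j t x y} i → SameEdge x y (point j t i) (point j t i + h j * d i) → Edge (translate j t) x y
      index-edge {j} {t} {x} {y} i same = i , proj₁ (cyclic-successor i) , i→i′ , subst (SameEdge x y (point j t i)) (sym (point-step j t i→i′)) same
        where
        i→i′ : CyclicSuc i (proj₁ (cyclic-successor i))
        i→i′ = proj₂ (cyclic-successor i)

      system : CycleSystem k q
      system = record
        { size      = w ℕ.* q
        ; cycle     = λ c → let j , t = remQuot {w} q c in translate j t
        ; partition = partition
        }
        where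
        Decomposes : F → F → Set
        Decomposes x y = ∃₂ λ j t → Edge (translate j t) x y × (∀ {j′ t′} → Edge (translate j′ t′) x y → j ≡ j′ × t ≡ t′)

        Edge-swap : ∀ {j t x y} → Edge (translate j t) x y → Edge (translate j t) y x
        Edge-swap (i , i′ , i→i′ , same) = i , i′ , i→i′ , SameEdge-swap same

        -- The difference y - x determines j and i, and then x determines t. A cycle that contains
        -- the edge in the opposite direction would represent y - x with the opposite sign.
        forward : ∀ {x y j i} → y ≡ x + h j * d i → Decomposes x y
        forward {x} {y} {j} {i} y≡x+ = j , t , index-edge i (inj₁ (x≡ , trans y≡x+ (cong (_+ h j * d i) x≡))) , unique
          where
          open ≡-Reasoning
          t = x - h j * b i
          x≡ : x ≡ point j t i
          x≡ = solve 2 (λ x a → x := a :+ (x :- a)) refl x (h j * b i)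
          unique : ∀ {j′ t′} → Edge (translate j′ t′) x y → j ≡ j′ × t ≡ t′
          unique {j′} {t′} e = [ same , opposite ]′ (proj₂ (edge-index {j′} {t′} e))
            where
            i′ : Fin k
            i′ = proj₁ (edge-index {j′} {t′} e)
            a = h j′ * d i′
            u = point j′ t′ i′
            step : ∀ {x′ y′} → x ≡ x′ → y ≡ y′ → h j * d i ≡ y′ - x′
            step {x′} {y′} x≡x′ y≡y′ = begin
              h j * d i ≡⟨ solve 2 (λ x a → a := x :+ a :- x) refl x (h j * d i) ⟩
              x + h j * d i - x ≡⟨ cong₂ _-_ (trans (sym y≡x+) y≡y′) x≡x′ ⟩
              y′ - x′ ∎
            translation : j ≡ j′ × i ≡ i′ → x ≡ u → t ≡ t′
            translation (j≡j′ , i≡i′) x≡u = begin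
              x - h j * b i ≡⟨ cong₂ (λ z s → z - s) x≡u (cong₂ (λ j i → h j * b i) j≡j′ i≡i′) ⟩
              u - h j′ * b i′ ≡⟨ solve 2 (λ a t → a :+ t :- a := t) refl (h j′ * b i′) t′ ⟩
              t′ ∎
            same : x ≡ u × y ≡ u + a → j ≡ j′ × t ≡ t′
            same (x≡u , y≡u+a) = proj₁ indices≡ , translation indices≡ x≡u
              where
              indices≡ : j ≡ j′ × i ≡ i′
              indices≡ = proj₂ (difference-injective {zero} {zero} {j} {j′} {i} {i′}
                (trans (step x≡u y≡u+a) (solve 2 (λ u a → u :+ a :- u := a) refl u a)))
            opposite : x ≡ u + a × y ≡ u → j ≡ j′ × t ≡ t′
            opposite (x≡u+a , y≡u) = contradiction (proj₁ (difference-injective {zero} {suc zero} {j} {j′} {i} {i′}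
              (trans (step x≡u+a y≡u) (solve 2 (λ u a → u :- (u :+ a) := :- a) refl u a)))) λ ()

        decompose : ∀ {x y} → x ≢ y → Decomposes x y
        decompose {x} {y} x≢y = by-sign (difference-surjective {y - x} (x≢y ∘ sym ∘ x-y≡0⇒x≡y y x))
          where
          reverse : Decomposes y x → Decomposes x y
          reverse (j , t , e , unique) = j , t , Edge-swap {j} {t} e , λ {j′} {t′} → unique ∘ Edge-swap {j′} {t′}
          by-sign : (∃ λ s → ∃₂ λ j i → y - x ≡ difference s j i) → Decomposes x y
          by-sign (zero , j , i , eq) = forward {x} {y} {j} {i} (trans (solve 2 (λ x y → y := x :+ (y :- x)) refl x y) (cong (x +_) eq))
          by-sign (suc _ , j , i , eq) = reverse (forward {y} {x} {j} {i}
            (trans (solve 2 (λ x y → x := y :- (y :- x)) refl x y)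
              (trans (cong (λ z → y - z) eq) (solve 2 (λ y a → y :- :- a := y :+ a) refl y (h j * d i)))))

        partition : ∀ {x y} → x ≢ y → _
        partition {x} {y} x≢y with j , t , e , unique ← decompose x≢y =
          combine j t
          , subst (λ { (j , t) → Edge (translate j t) x y }) (sym (Fin.remQuot-combine {w} j t)) e
          , λ {c} e′ → let j≡ , t≡ = unique {proj₁ (remQuot {w} q c)} {proj₂ (remQuot {w} q c)} e′ in trans (cong₂ (combine {w}) j≡ t≡) (Fin.combine-remQuot {w} q c)

    open Starter using (system)

    -- This is S.d i / S.d l ≠ ± T.d i′ / T.d l′ with denominators cleared. The case i′ = l′ is
    -- included, so the relation is not visibly symmetric in S and T.
    Independent : Starter → Starter → Set
    Independent S T = ∀ {i l i′ l′} → i ≢ l → (S.d i * T.d l′) * (S.d i * T.d l′) ≢ (S.d l * T.d i′) * (S.d l * T.d i′)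
      where
      module S = Starter S
      module T = Starter T

    -- Squaring the difference of a common edge removes its orientation and equates (h dᵢ)² with (h′
    -- d′ᵢ′)². Multiplying the equations of two common edges crosswise leaves the same factor (h
    -- h′)² on both sides; cancelling it gives the forbidden relation, unless both edges have the
    -- same index in the first cycle.
    independent⇒orthogonal : ∀ S T → Independent S T → Orthogonal (system S) (system T)
    independent⇒orthogonal S T independent c c′ {x} {y} {x′} {y′} Sxy Txy Sxy′ Txy′
      = result (S.edge-index {j} {t} Sxy) (T.edge-index {j′} {t′} Txy) (S.edge-index {j} {t} Sxy′) (T.edge-index {j′} {t′} Txy′)
      where
      module S = Starter S
      module T = Starter T
      open ≡-Reasoning
      j  = proj₁ (remQuot {w} q c)
      t  = proj₂ (remQuot {w} q c)
      j′ = proj₁ (remQuot {w} q c′)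
      t′ = proj₂ (remQuot {w} q c′)
      square-difference : ∀ {x y u a} → SameEdge x y u (u + a) → (y - x) * (y - x) ≡ a * a
      square-difference {u = u} {a} (inj₁ (refl , refl)) = solve 2 (λ u a → (u :+ a :- u) :* (u :+ a :- u) := a :* a) refl u a
      square-difference {u = u} {a} (inj₂ (refl , refl)) = solve 2 (λ u a → (u :- (u :+ a)) :* (u :- (u :+ a)) := a :* a) refl u a
      result : (∃ λ i → SameEdge x y (S.point j t i) (S.point j t i + S.h j * S.d i)) →
               (∃ λ i → SameEdge x y (T.point j′ t′ i) (T.point j′ t′ i + T.h j′ * T.d i)) →
               (∃ λ i → SameEdge x′ y′ (S.point j t i) (S.point j t i + S.h j * S.d i)) →
               (∃ λ i → SameEdge x′ y′ (T.point j′ t′ i) (T.point j′ t′ i + T.h j′ * T.d i)) → SameEdge x y x′ y′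
      result (i , Si) (i′ , Ti′) (l , Sl) (l′ , Tl′) with i Fin.≟ l
      ... | yes refl = SameEdge-join Si Sl
      ... | no  i≢l  = contradiction (*-cancelˡ-≢0 (*-≢0 hh′≢0 hh′≢0) (begin
        (S.h j * T.h j′) * (S.h j * T.h j′) * ((S.d i * T.d l′) * (S.d i * T.d l′))
          ≡⟨ regroup (S.h j) (T.h j′) (S.d i) (T.d l′) ⟩
        ((S.h j * S.d i) * (S.h j * S.d i)) * ((T.h j′ * T.d l′) * (T.h j′ * T.d l′))
          ≡⟨ cong₂ _*_ (trans (sym (square-difference Si)) (square-difference Ti′)) (trans (sym (square-difference Tl′)) (square-difference Sl)) ⟩
        ((T.h j′ * T.d i′) * (T.h j′ * T.d i′)) * ((S.h j * S.d l) * (S.h j * S.d l))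
          ≡⟨ *-comm _ _ ⟩
        ((S.h j * S.d l) * (S.h j * S.d l)) * ((T.h j′ * T.d i′) * (T.h j′ * T.d i′))
          ≡⟨ regroup (S.h j) (T.h j′) (S.d l) (T.d i′) ⟨
        (S.h j * T.h j′) * (S.h j * T.h j′) * ((S.d l * T.d i′) * (S.d l * T.d i′)) ∎)) (independent i≢l)
        where
        hh′≢0 : S.h j * T.h j′ ≢ 0#
        hh′≢0 = *-≢0 (S.h≢0 j) (T.h≢0 j′)
        regroup : ∀ h h′ d d′ → (h * h′) * (h * h′) * ((d * d′) * (d * d′)) ≡ ((h * d) * (h * d)) * ((h′ * d′) * (h′ * d′))
        regroup = solve 4 (λ h h′ d d′ → (h :* h′) :* (h :* h′) :* ((d :* d′) :* (d :* d′)) := ((h :* d) :* (h :* d)) :* ((h′ :* d′) :* (h′ :* d′))) refl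

-- Cosets of the subgroup of order 2w, and the two kinds of starters.

module CyclotomicStarters where
  open Counting
  open FiniteFields
  open PrimitiveRoots
  open StarterSystems
  open import Data.Fin.Base as Fin using (Fin; suc; toℕ; fromℕ<)
  import Data.Fin.Properties as Fin
  open import Data.Integer.Base using (1ℤ)
  open import Data.Nat.Base as ℕ using (ℕ; suc; NonZero; z<s)
  import Data.Nat.Properties as ℕ
  open import Data.Nat.DivMod using (_/_; _%_; m≡m%n+[m/n]*n; m%n<n)
  open import Data.Nat.Divisibility using (_∣_; *-cancelʳ-∣)
  open import Data.Nat.Solver using (module +-*-Solver)
  open import Data.Product.Base using (_×_; _,_; ∃; proj₁; proj₂)
  open import Data.Sum.Base using (inj₁; inj₂; [_,_]′)
  open import Function.Base using (_∘_)
  open import Relation.Binary.PropositionalEquality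
  open import Relation.Nullary
  open import Relation.Nullary.Decidable using (decidable-stable)

  Odd : ℕ → Set
  Odd n = ∃ λ m → n ≡ suc (2 ℕ.* m)

  open +-*-Solver using () renaming (solve to solveℕ; con to conℕ; _:*_ to _:×:_; _:=_ to _:≡:_; _:+_ to _:⊕:_)

  odd⇒>0 : ∀ {n} → Odd n → 0 ℕ.< n
  odd⇒>0 (_ , refl) = z<s

  module Cyclotomic {k w} (𝔽 : FiniteField (suc (2 ℕ.* k ℕ.* w)))
    (fermat : ∀ {x} → x ≢ FiniteField.0# 𝔽 → FiniteField._^_ 𝔽 x (2 ℕ.* k ℕ.* w) ≡ FiniteField.1# 𝔽)
    (1<k : 1 ℕ.< k) (k-odd : Odd k) (w-odd : Odd w) where
    open FiniteField 𝔽
    open FieldProperties 𝔽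

    F : Set
    F = Fin (suc (2 ℕ.* k ℕ.* w))

    n : ℕ
    n = 2 ℕ.* k ℕ.* w

    -- The map x ↦ x^κ has the subgroup of order κ as its kernel on nonzero elements. A coset is
    -- thus recorded by the kth root of unity x^κ, a power of ζ.
    κ : ℕ
    κ = 2 ℕ.* w

    kκ≡n : k ℕ.* κ ≡ n
    kκ≡n = solveℕ 2 (λ k w → k :×: (conℕ 2 :×: w) :≡: conℕ 2 :×: k :×: w) refl k w

    0<k : 0 ℕ.< k
    0<k = ℕ.<-trans z<s 1<k

    0<w : 0 ℕ.< w
    0<w = odd⇒>0 w-odd

    0<κ : 0 ℕ.< κ
    0<κ = ℕ.<-≤-trans 0<w (ℕ.m≤m+n w _)

    instance
      k≢0 : NonZero k
      k≢0 = ℕ.>-nonZero 0<k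
      w≢0 : NonZero w
      w≢0 = ℕ.>-nonZero 0<w
      κ≢0 : NonZero κ
      κ≢0 = ℕ.>-nonZero 0<κ

    0<n : 0 ℕ.< n
    0<n = subst (0 ℕ.<_) kκ≡n (ℕ.*-mono-≤ 0<k 0<κ)

    open PrimitiveRoot 𝔽 0<n fermat

    -- y = g^(kw) satisfies y² = 1 but y ≠ 1, so y = -1.
    1≢-1 : 1# ≢ - 1#
    1≢-1 1≡-1 = ℕ.<⇒≢ 0<kw (sym (^-injective kw<n 0<n y≡1))
      where
      y = g ^ (k ℕ.* w)
      0<kw : 0 ℕ.< k ℕ.* w
      0<kw = ℕ.*-mono-≤ 0<k 0<w
      kw<n : k ℕ.* w ℕ.< n
      kw<n = ℕ.*-monoˡ-< w (ℕ.m<m+n k (ℕ.<-≤-trans 0<k (ℕ.≤-reflexive (sym (ℕ.+-identityʳ k)))))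
      y²≡1 : y * y ≡ 1#
      y²≡1 = trans (sym (^-homo-* g (k ℕ.* w) (k ℕ.* w))) (trans (cong (g ^_)
        (solveℕ 2 (λ k w → k :×: w :⊕: k :×: w :≡: conℕ 2 :×: k :×: w) refl k w)) gⁿ≡1)
      y≡1 : y ≡ 1#
      y≡1 = decidable-stable (y Fin.≟ 1#) λ y≢1 → y≢1 (trans (x-y≡0⇒x≡y y (- 1#) (x*y≡0⇒y≡0 (y≢1 ∘ x-y≡0⇒x≡y y 1#)
        (trans (solve 1 (λ y → (y :- con 1ℤ) :* (y :- :- con 1ℤ) := y :* y :- con 1ℤ) refl y) (x≡y⇒x-y≡0 y²≡1)))) (sym 1≡-1))

    open StarterSystem {k} {w} 𝔽 1≢-1 public

    ^2≡square : ∀ x → x ^ 2 ≡ x * x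
    ^2≡square x = cong (x *_) (*-identityʳ x)

    square-^ : ∀ x m → (x * x) ^ m ≡ x ^ (2 ℕ.* m)
    square-^ x m = trans (cong (_^ m) (sym (^2≡square x))) (^-assocʳ x 2 m)

    neg-^-even : ∀ x m → (- x) ^ (2 ℕ.* m) ≡ x ^ (2 ℕ.* m)
    neg-^-even x m = trans (sym (square-^ (- x) m)) (trans (cong (_^ m) (square-neg x)) (square-^ x m))

    neg-^-odd : ∀ x {m} → Odd m → (- x) ^ m ≡ - (x ^ m)
    neg-^-odd x (m , refl) = trans (cong (- x *_) (neg-^-even x m)) (sym (-‿distribˡ-* x (x ^ (2 ℕ.* m))))

    0^κ≡0 : 0# ^ κ ≡ 0#
    0^κ≡0 = trans (cong (0# ^_) (sym (ℕ.suc-pred κ))) (zeroˡ (0# ^ ℕ.pred κ))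

    ^κ≢0⇒≢0 : ∀ {x} → x ^ κ ≢ 0# → x ≢ 0#
    ^κ≢0⇒≢0 xᵏ≢0 refl = xᵏ≢0 0^κ≡0

    ζ : F
    ζ = g ^ κ

    ζ≢0 : ζ ≢ 0#
    ζ≢0 = ^-≢0 g≢0 κ

    ζᵏ≡1 : ζ ^ k ≡ 1#
    ζᵏ≡1 = trans (^-assocʳ g κ k) (trans (cong (g ^_) (trans (ℕ.*-comm κ k) kκ≡n)) gⁿ≡1)

    ζ-injective : ∀ {i j} → i ℕ.< k → j ℕ.< k → ζ ^ i ≡ ζ ^ j → i ≡ j
    ζ-injective {i} {j} i<k j<k eq = ℕ.*-cancelˡ-≡ i j κ (^-injective (bound i<k) (bound j<k)
      (trans (sym (^-assocʳ g κ i)) (trans eq (^-assocʳ g κ j))))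
      where
      bound : ∀ {i} → i ℕ.< k → κ ℕ.* i ℕ.< n
      bound {i} i<k = subst (κ ℕ.* i ℕ.<_) (trans (ℕ.*-comm κ k) kκ≡n) (ℕ.*-monoʳ-< κ i<k)

    ζ-mod : ∀ e → ζ ^ e ≡ ζ ^ (e % k)
    ζ-mod e = begin
      ζ ^ e ≡⟨ cong (ζ ^_) (m≡m%n+[m/n]*n e k) ⟩
      ζ ^ (e % k ℕ.+ e / k ℕ.* k) ≡⟨ ^-homo-* ζ (e % k) _ ⟩
      ζ ^ (e % k) * ζ ^ (e / k ℕ.* k) ≡⟨ cong (λ z → ζ ^ (e % k) * ζ ^ z) (ℕ.*-comm (e / k) k) ⟩
      ζ ^ (e % k) * ζ ^ (k ℕ.* (e / k)) ≡⟨ cong (ζ ^ (e % k) *_) (^-*-≡1 ζ k (e / k) ζᵏ≡1) ⟩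
      ζ ^ (e % k) * 1# ≡⟨ *-identityʳ _ ⟩
      ζ ^ (e % k) ∎
      where open ≡-Reasoning

    opaque
      class-exists : ∀ x → ∃ λ (i : Fin k) → x ≢ 0# → x ^ κ ≡ ζ ^ toℕ i
      class-exists x with x Fin.≟ 0#
      ... | yes x≡0 = fromℕ< 0<k , contradiction x≡0
      ... | no  x≢0 = fromℕ< (m%n<n (toℕ e) k) , λ _ → begin
        x ^ κ ≡⟨ cong (_^ κ) (proj₂ (discrete-log x≢0)) ⟩
        (g ^ toℕ e) ^ κ ≡⟨ ^-assocʳ g (toℕ e) κ ⟩
        g ^ (toℕ e ℕ.* κ) ≡⟨ cong (g ^_) (ℕ.*-comm (toℕ e) κ) ⟩
        g ^ (κ ℕ.* toℕ e) ≡⟨ ^-assocʳ g κ (toℕ e) ⟨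
        ζ ^ toℕ e ≡⟨ ζ-mod (toℕ e) ⟩
        ζ ^ (toℕ e % k) ≡⟨ cong (ζ ^_) (Fin.toℕ-fromℕ< (m%n<n (toℕ e) k)) ⟨
        ζ ^ toℕ (fromℕ< (m%n<n (toℕ e) k)) ∎
        where
        open ≡-Reasoning
        e : Fin n
        e = proj₁ (discrete-log x≢0)

    -- The class of 0 is arbitrary.
    class : F → Fin k
    class x = proj₁ (class-exists x)

    ^κ≡class : ∀ {x} → x ≢ 0# → x ^ κ ≡ ζ ^ toℕ (class x)
    ^κ≡class {x} = proj₂ (class-exists x)

    class-element : ℕ → Fin κ → F
    class-element i j = g ^ (i ℕ.+ k ℕ.* toℕ j)

    class-element-^κ : ∀ i j → class-element i j ^ κ ≡ ζ ^ i
    class-element-^κ i j = begin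
      (g ^ (i ℕ.+ k ℕ.* toℕ j)) ^ κ ≡⟨ ^-assocʳ g (i ℕ.+ k ℕ.* toℕ j) κ ⟩
      g ^ ((i ℕ.+ k ℕ.* toℕ j) ℕ.* κ) ≡⟨ cong (g ^_) (solveℕ 4 (λ i k j κ → (i :⊕: k :×: j) :×: κ :≡: κ :×: i :⊕: k :×: κ :×: j) refl i k (toℕ j) κ) ⟩
      g ^ (κ ℕ.* i ℕ.+ k ℕ.* κ ℕ.* toℕ j) ≡⟨ ^-homo-* g (κ ℕ.* i) _ ⟩
      g ^ (κ ℕ.* i) * g ^ (k ℕ.* κ ℕ.* toℕ j) ≡⟨ cong₂ _*_ (sym (^-assocʳ g κ i)) (^-*-≡1 g (k ℕ.* κ) (toℕ j) (trans (cong (g ^_) kκ≡n) gⁿ≡1)) ⟩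
      ζ ^ i * 1# ≡⟨ *-identityʳ _ ⟩
      ζ ^ i ∎
      where
      open ≡-Reasoning

    class-element-injective : ∀ {i} → i ℕ.< k → ∀ {j j′} → class-element i j ≡ class-element i j′ → j ≡ j′
    class-element-injective {i} i<k {j} {j′} eq =
      Fin.toℕ-injective (ℕ.*-cancelˡ-≡ _ _ k (ℕ.+-cancelˡ-≡ i _ _ (^-injective (bound j) (bound j′) eq)))
      where
      bound : ∀ j → i ℕ.+ k ℕ.* toℕ j ℕ.< n
      bound j = begin-strict
        i ℕ.+ k ℕ.* toℕ j <⟨ ℕ.+-monoˡ-< _ i<k ⟩
        k ℕ.+ k ℕ.* toℕ j ≡⟨ ℕ.*-suc k (toℕ j) ⟨
        k ℕ.* suc (toℕ j) ≤⟨ ℕ.*-monoʳ-≤ k (Fin.toℕ<n j) ⟩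
        k ℕ.* κ ≡⟨ kκ≡n ⟩
        n ∎
        where open ℕ.≤-Reasoning

    opaque
      -- If u = g^e, then u^κ = 1 says that n = kκ divides eκ, so k divides e.
      κth-root : ∀ {u} → u ≢ 0# → u ^ κ ≡ 1# → ∃ λ j → u ≡ class-element 0 j
      κth-root {u} u≢0 uᵏ≡1 = fromℕ< j<κ , trans u≡gᵉ (cong (g ^_)
        (trans (_∣_.equality k∣e) (trans (ℕ.*-comm j k) (cong (k ℕ.*_) (sym (Fin.toℕ-fromℕ< j<κ))))))
        where
        e : Fin n
        e = proj₁ (discrete-log u≢0)
        u≡gᵉ : u ≡ g ^ toℕ e
        u≡gᵉ = proj₂ (discrete-log u≢0)
        k∣e : k ∣ toℕ e
        k∣e = *-cancelʳ-∣ κ (subst (_∣ toℕ e ℕ.* κ) (sym kκ≡n)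
          (g-order (trans (sym (^-assocʳ g (toℕ e) κ)) (trans (cong (_^ κ) (sym u≡gᵉ)) uᵏ≡1))))
        j : ℕ
        j = _∣_.quotient k∣e
        j<κ : j ℕ.< κ
        j<κ = ℕ.*-cancelʳ-< k j κ (subst (ℕ._< κ ℕ.* k) (_∣_.equality k∣e) (ℕ.<-≤-trans (Fin.toℕ<n e) (ℕ.≤-reflexive (trans (sym kκ≡n) (ℕ.*-comm k κ)))))

    -- The base cycle (1, ζ, ..., ζ^(k - 1)) closes up because ζ^k = 1. To separate the products,
    -- the kth power of (g^j ζ^i)² forgets i and leaves g^(2kj), which determines j < w. What
    -- remains is ζ^i up to sign, and since k is odd the kth power excludes the sign.
    power-starter : Starter
    power-starter = record
      { b           = λ i → ζ ^ toℕ i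
      ; d           = λ i → ζ ^ toℕ i * (ζ - 1#)
      ; h           = λ j → g ^ toℕ j
      ; b-injective = λ {i} {j} eq → Fin.toℕ-injective (ζ-injective (Fin.toℕ<n i) (Fin.toℕ<n j) eq)
      ; b-step      = step
      ; h≢0         = λ j → ^-≢0 g≢0 (toℕ j)
      ; d≢0         = λ i → *-≢0 (^-≢0 ζ≢0 (toℕ i)) ζ-1≢0
      ; separated   = separated
      }
      where
      open ≡-Reasoning
      ζ-1≢0 : ζ - 1# ≢ 0#
      ζ-1≢0 eq = contradiction (ζ-injective 1<k 0<k (trans (*-identityʳ ζ) (x-y≡0⇒x≡y ζ 1# eq))) λ ()
      next : ∀ i → ζ ^ suc i ≡ ζ ^ i + ζ ^ i * (ζ - 1#)
      next i = solve 2 (λ z y → z :* y := y :+ y :* (z :- con 1ℤ)) refl ζ (ζ ^ i)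
      step : ∀ {i j : Fin k} → CyclicSuc i j → ζ ^ toℕ j ≡ ζ ^ toℕ i + ζ ^ toℕ i * (ζ - 1#)
      step {i} (inj₁ j≡1+i)           = trans (cong (ζ ^_) j≡1+i) (next (toℕ i))
      step {i} (inj₂ (1+i≡k , j≡0))   = trans (cong (ζ ^_) j≡0) (trans (sym ζᵏ≡1) (trans (cong (ζ ^_) (sym 1+i≡k)) (next (toℕ i))))
      ζⁱᵏ≡1 : ∀ i → (ζ ^ i) ^ k ≡ 1#
      ζⁱᵏ≡1 i = trans (^-assocʳ ζ i k) (trans (cong (ζ ^_) (ℕ.*-comm i k)) (^-*-≡1 ζ k i ζᵏ≡1))
      kth-power : ∀ j i → ((g ^ j * ζ ^ i) * (g ^ j * ζ ^ i)) ^ k ≡ g ^ (j ℕ.* (2 ℕ.* k))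
      kth-power j i = begin
        ((g ^ j * ζ ^ i) * (g ^ j * ζ ^ i)) ^ k ≡⟨ ^-distrib-* (g ^ j * ζ ^ i) (g ^ j * ζ ^ i) k ⟩
        (g ^ j * ζ ^ i) ^ k * (g ^ j * ζ ^ i) ^ k ≡⟨ cong (λ z → z * z) (trans (^-distrib-* (g ^ j) (ζ ^ i) k) (trans (cong ((g ^ j) ^ k *_) (ζⁱᵏ≡1 i)) (*-identityʳ _))) ⟩
        (g ^ j) ^ k * (g ^ j) ^ k ≡⟨ ^-distrib-* (g ^ j) (g ^ j) k ⟨
        (g ^ j * g ^ j) ^ k ≡⟨ square-^ (g ^ j) k ⟩
        (g ^ j) ^ (2 ℕ.* k) ≡⟨ ^-assocʳ g j (2 ℕ.* k) ⟩
        g ^ (j ℕ.* (2 ℕ.* k)) ∎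
      separated : ∀ {j j′ : Fin w} {i i′ : Fin k} →
        (g ^ toℕ j * (ζ ^ toℕ i * (ζ - 1#))) * (g ^ toℕ j * (ζ ^ toℕ i * (ζ - 1#))) ≡
        (g ^ toℕ j′ * (ζ ^ toℕ i′ * (ζ - 1#))) * (g ^ toℕ j′ * (ζ ^ toℕ i′ * (ζ - 1#))) → j ≡ j′ × i ≡ i′
      separated {j} {j′} {i} {i′} eq = j≡j′ , i≡i′
        where
        regroup : ∀ h y → (h * (y * (ζ - 1#))) * (h * (y * (ζ - 1#))) ≡ ((ζ - 1#) * (ζ - 1#)) * ((h * y) * (h * y))
        regroup h y = solve 3 (λ h y c → (h :* (y :* c)) :* (h :* (y :* c)) := (c :* c) :* ((h :* y) :* (h :* y))) refl h y (ζ - 1#)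
        squares : (g ^ toℕ j * ζ ^ toℕ i) * (g ^ toℕ j * ζ ^ toℕ i) ≡ (g ^ toℕ j′ * ζ ^ toℕ i′) * (g ^ toℕ j′ * ζ ^ toℕ i′)
        squares = *-cancelˡ-≢0 (*-≢0 ζ-1≢0 ζ-1≢0) (trans (sym (regroup (g ^ toℕ j) (ζ ^ toℕ i))) (trans eq (regroup (g ^ toℕ j′) (ζ ^ toℕ i′))))
        bound : ∀ (j : Fin w) → toℕ j ℕ.* (2 ℕ.* k) ℕ.< n
        bound j = subst (toℕ j ℕ.* (2 ℕ.* k) ℕ.<_) (ℕ.*-comm w (2 ℕ.* k)) (ℕ.*-monoˡ-< (2 ℕ.* k) {{ℕ.m*n≢0 2 k}} (Fin.toℕ<n j))
        j≡j′ : j ≡ j′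
        j≡j′ = Fin.toℕ-injective (ℕ.*-cancelʳ-≡ _ _ (2 ℕ.* k) {{ℕ.m*n≢0 2 k}} (^-injective (bound j) (bound j′)
          (trans (sym (kth-power (toℕ j) (toℕ i))) (trans (cong (_^ k) squares) (kth-power (toℕ j′) (toℕ i′))))))
        opposite : ζ ^ toℕ i ≡ - (ζ ^ toℕ i′) → 1# ≡ - 1#
        opposite eq′ = begin
          1# ≡⟨ ζⁱᵏ≡1 (toℕ i) ⟨
          (ζ ^ toℕ i) ^ k ≡⟨ cong (_^ k) eq′ ⟩
          (- (ζ ^ toℕ i′)) ^ k ≡⟨ neg-^-odd (ζ ^ toℕ i′) k-odd ⟩
          - ((ζ ^ toℕ i′) ^ k) ≡⟨ cong -_ (ζⁱᵏ≡1 (toℕ i′)) ⟩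
          - 1# ∎
        i≡i′ : i ≡ i′
        i≡i′ = [ Fin.toℕ-injective ∘ ζ-injective (Fin.toℕ<n i) (Fin.toℕ<n i′) , (λ eq′ → contradiction (opposite eq′) 1≢-1) ]′
          (square-injective (*-cancelˡ-≢0 (*-≢0 gʲ≢0 gʲ≢0) (trans (sym (interchange (ζ ^ toℕ i))) (trans squares
            (trans (cong (λ j → (g ^ toℕ j * ζ ^ toℕ i′) * (g ^ toℕ j * ζ ^ toℕ i′)) (sym j≡j′)) (interchange (ζ ^ toℕ i′)))))))
          where
          gʲ≢0 : g ^ toℕ j ≢ 0#
          gʲ≢0 = ^-≢0 g≢0 (toℕ j)
          interchange : ∀ y → (g ^ toℕ j * y) * (g ^ toℕ j * y) ≡ (g ^ toℕ j * g ^ toℕ j) * (y * y)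
          interchange y = solve 2 (λ h y → (h :* y) :* (h :* y) := (h :* h) :* (y :* y)) refl (g ^ toℕ j) y

    power-system : CycleSystem k (suc (2 ℕ.* k ℕ.* w))
    power-system = Starter.system power-starter

    -- One difference in each coset of the subgroup of order κ; the multipliers of the resulting starter
    -- are the wth roots of unity.
    record Base : Set where
      field
        b d         : Fin k → F
        b-injective : ∀ {i j} → b i ≡ b j → i ≡ j
        b-step      : ∀ {i j} → CyclicSuc i j → b j ≡ b i + d i
        d-class     : ∀ i → d i ^ κ ≡ ζ ^ toℕ i

      d≢0 : ∀ i → d i ≢ 0#
      d≢0 i = ^κ≢0⇒≢0 (λ dᵏ≡0 → ^-≢0 ζ≢0 (toℕ i) (trans (sym (d-class i)) dᵏ≡0))

      starter : Starter
      starter = record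
        { b           = b
        ; d           = d
        ; h           = h
        ; b-injective = b-injective
        ; b-step      = b-step
        ; h≢0         = h≢0
        ; d≢0         = d≢0
        ; separated   = separated
        }
        where
        open ≡-Reasoning
        h : Fin w → F
        h j = g ^ (2 ℕ.* k ℕ.* toℕ j)
        h≢0 : ∀ j → h j ≢ 0#
        h≢0 j = ^-≢0 g≢0 (2 ℕ.* k ℕ.* toℕ j)
        hʷ≡1 : ∀ j → h j ^ w ≡ 1#
        hʷ≡1 j = trans (^-assocʳ g (2 ℕ.* k ℕ.* toℕ j) w) (trans (cong (g ^_)
          (solveℕ 3 (λ a j w → a :×: j :×: w :≡: a :×: w :×: j) refl (2 ℕ.* k) (toℕ j) w)) (^-*-≡1 g n (toℕ j) gⁿ≡1))
        -- The wth power of the square is the κth power, which kills the multiplier and shows the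
        -- coset of d i.
        square-class : ∀ j i → ((h j * d i) * (h j * d i)) ^ w ≡ ζ ^ toℕ i
        square-class j i = begin
          ((h j * d i) * (h j * d i)) ^ w ≡⟨ square-^ (h j * d i) w ⟩
          (h j * d i) ^ κ ≡⟨ ^-distrib-* (h j) (d i) κ ⟩
          h j ^ κ * d i ^ κ ≡⟨ cong₂ _*_ (trans (cong (h j ^_) (ℕ.*-comm 2 w)) (^-*-≡1 (h j) w 2 (hʷ≡1 j))) (d-class i) ⟩
          1# * ζ ^ toℕ i ≡⟨ *-identityˡ _ ⟩
          ζ ^ toℕ i ∎
        separated : ∀ {j j′ i i′} → (h j * d i) * (h j * d i) ≡ (h j′ * d i′) * (h j′ * d i′) → j ≡ j′ × i ≡ i′
        separated {j} {j′} {i} {i′} eq = j≡j′ , i≡i′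
          where
          i≡i′ : i ≡ i′
          i≡i′ = Fin.toℕ-injective (ζ-injective (Fin.toℕ<n i) (Fin.toℕ<n i′) (trans (sym (square-class j i)) (trans (cong (_^ w) eq) (square-class j′ i′))))
          interchange : ∀ j → (h j * d i) * (h j * d i) ≡ (d i * d i) * (h j * h j)
          interchange j = solve 2 (λ h d → (h :* d) :* (h :* d) := (d :* d) :* (h :* h)) refl (h j) (d i)
          bound : ∀ (j : Fin w) → 2 ℕ.* k ℕ.* toℕ j ℕ.< n
          bound j = ℕ.*-monoʳ-< (2 ℕ.* k) {{ℕ.m*n≢0 2 k}} (Fin.toℕ<n j)
          -- The wth power of a multiplier is 1, while an odd power preserves the sign.
          opposite : h j ≡ - h j′ → 1# ≡ - 1#
          opposite eq′ = begin
            1# ≡⟨ hʷ≡1 j ⟨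
            h j ^ w ≡⟨ cong (_^ w) eq′ ⟩
            (- h j′) ^ w ≡⟨ neg-^-odd (h j′) w-odd ⟩
            - (h j′ ^ w) ≡⟨ cong -_ (hʷ≡1 j′) ⟩
            - 1# ∎
          j≡j′ : j ≡ j′
          j≡j′ = [ (λ eq′ → Fin.toℕ-injective (ℕ.*-cancelˡ-≡ _ _ (2 ℕ.* k) {{ℕ.m*n≢0 2 k}} (^-injective (bound j) (bound j′) eq′)))
                 , (λ eq′ → contradiction (opposite eq′) 1≢-1) ]′
            (square-injective (*-cancelˡ-≢0 (*-≢0 (d≢0 i) (d≢0 i)) (trans (sym (interchange j)) (trans eq
              (trans (cong (λ i → (h j′ * d i) * (h j′ * d i)) (sym i≡i′)) (interchange j′))))))

-- Greedy construction of pairwise independent base cycles.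

module GreedyConstruction where
  open Counting
  open FiniteFields
  open PrimitiveRoots
  open StarterSystems
  open CyclotomicStarters
  open import Data.Fin.Base as Fin using (zero; suc; Fin; toℕ; combine; fromℕ<; remQuot)
  open import Data.List.Base as List using (List; []; _∷_; _++_; map; length; cartesianProductWith; tabulate; allFin)
  open import Data.List.Properties using (length-++; length-map; length-tabulate)
  open import Data.List.Membership.Propositional using (_∈_; _∉_)
  open import Data.List.Membership.Propositional.Properties using (∈-++⁺ˡ; ∈-++⁺ʳ; ∈-map⁺; ∈-tabulate⁺; ∈-allFin; ∈-cartesianProductWith⁺; ∈-map⁻)
  open import Data.Nat.Base as ℕ using (ℕ; zero; suc; z≤n; z<s; NonZero; s≤s)
  import Data.Nat.Properties as ℕ
  open import Data.Nat.Solver using (module +-*-Solver)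
  open import Data.Sum.Base using (inj₁; inj₂; [_,_]′)
  open import Relation.Binary.PropositionalEquality
  open import Relation.Nullary
  import Data.Fin.Properties as Fin
  open import Data.Integer.Base using (0ℤ; 1ℤ)
  open import Data.Product.Base using (_×_; _,_; ∃; proj₁; proj₂; Σ-syntax)
  open import Function.Base using (_∘_)
  open import Data.List.Relation.Unary.Any using (here)
  open import Relation.Binary.Definitions using (tri<; tri≈; tri>; Tri)

  private
    module ℕSolver = +-*-Solver

  length-cartesianProductWith : ∀ {a b c} {A : Set a} {B : Set b} {C : Set c} (f : A → B → C) xs ys →
                                length (cartesianProductWith f xs ys) ≡ length xs ℕ.* length ys
  length-cartesianProductWith f []       ys = refl
  length-cartesianProductWith f (x ∷ xs) ys = trans (length-++ (map (f x) ys))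
    (cong₂ ℕ._+_ (length-map (f x) ys) (length-cartesianProductWith f xs ys))

  spread : ∀ {a} {A : Set a} → ℕ → (ℕ → List A) → List A
  spread zero    f = []
  spread (suc j) f = f j ++ spread j f

  length-spread : ∀ {a} {A : Set a} j (f : ℕ → List A) {ℓ} → (∀ i → length (f i) ≡ ℓ) → length (spread j f) ≡ j ℕ.* ℓ
  length-spread zero    f |f|≡ℓ = refl
  length-spread (suc j) f |f|≡ℓ = trans (length-++ (f j)) (cong₂ ℕ._+_ (|f|≡ℓ j) (length-spread j f |f|≡ℓ))

  ∈-spread : ∀ {a} {A : Set a} {j} (f : ℕ → List A) {i x} → i ℕ.< j → x ∈ f i → x ∈ spread j f
  ∈-spread {j = suc j} f i<1+j x∈fi with ℕ.m≤n⇒m<n∨m≡n (ℕ.s≤s⁻¹ i<1+j)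
  ... | inj₁ i<j  = ∈-++⁺ʳ (f j) (∈-spread f i<j x∈fi)
  ... | inj₂ refl = ∈-++⁺ˡ x∈fi

  module Estimates (k w : ℕ) (3≤k : 3 ℕ.≤ k) (4k⁴<w : 4 ℕ.* k ℕ.^ 4 ℕ.< w) where
    open ℕ.≤-Reasoning
    open ℕSolver
    open import Data.Nat.Base

    12k³≤w : 12 * (k * (k * k)) ≤ w
    12k³≤w = begin
      12 * (k * (k * k)) ≡⟨ solve 1 (λ k → con 12 :* (k :* (k :* k)) := con 4 :* (con 3 :* (k :* (k :* k)))) refl k ⟩
      4 * (3 * (k * (k * k))) ≤⟨ ℕ.*-monoʳ-≤ 4 (ℕ.*-monoˡ-≤ (k * (k * k)) 3≤k) ⟩
      4 * (k * (k * (k * k))) ≡⟨ solve 1 (λ k → con 4 :* (k :* (k :* (k :* k))) := con 4 :* (k :^ 4)) refl k ⟩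
      4 * k ^ 4 ≤⟨ ℕ.<⇒≤ 4k⁴<w ⟩
      w ∎

    0<w : 0 < w
    0<w = ℕ.≤-<-trans z≤n 4k⁴<w

    -- T stands for a cell size and 2w for k times the mean q / k² of the cells, up to 1 / k. On
    -- both sides the main term is 8k²w². What is left would be w² + 4kw ≤ 10k³w + 5k², but the
    -- right side is at most 12k³w ≤ w².
    few-solutions-impossible : ∀ {T δ C} → k * T + δ ≡ 2 * w → k * T ≤ w → C ≤ 5 * suc (2 * k * w) + 2 * w * (2 * w) →
      ¬ (2 * k * (k * T + δ) * suc (2 * k * w) + δ * δ ≤ k * k * C + k * k * ((k * T + δ) * (k * T + δ)))
    few-solutions-impossible {T} {δ} {C} kT+δ≡2w kT≤w C≤ moment = ℕ.<-irrefl refl (begin-strict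
      2 * k * (2 * w) * q + w * w ≤⟨ ℕ.+-monoʳ-≤ (2 * k * (2 * w) * q) (ℕ.*-mono-≤ w≤δ w≤δ) ⟩
      2 * k * (2 * w) * q + δ * δ ≡⟨ cong (λ s → 2 * k * s * q + δ * δ) kT+δ≡2w ⟨
      2 * k * (k * T + δ) * q + δ * δ ≤⟨ moment ⟩
      k * k * C + k * k * ((k * T + δ) * (k * T + δ)) ≡⟨ cong (λ s → k * k * C + k * k * (s * s)) kT+δ≡2w ⟩
      k * k * C + k * k * (2 * w * (2 * w)) ≤⟨ ℕ.+-monoˡ-≤ _ (ℕ.*-monoʳ-≤ (k * k) C≤) ⟩
      k * k * (5 * q + 2 * w * (2 * w)) + k * k * (2 * w * (2 * w))
        ≡⟨ solve 2 (λ k w → k :* k :* (con 5 :* (con 1 :+ con 2 :* k :* w) :+ con 2 :* w :* (con 2 :* w)) :+ k :* k :* (con 2 :* w :* (con 2 :* w))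
                         := con 8 :* (k :* k) :* (w :* w) :+ con 10 :* (k :* (k :* k)) :* w :+ k :* k :* con 5) refl k w ⟩
      8 * (k * k) * (w * w) + 10 * (k * (k * k)) * w + k * k * 5
        ≤⟨ ℕ.+-monoʳ-≤ (8 * (k * k) * (w * w) + 10 * (k * (k * k)) * w) (ℕ.*-monoʳ-≤ (k * k) 5≤2kw) ⟩
      8 * (k * k) * (w * w) + 10 * (k * (k * k)) * w + k * k * (2 * k * w)
        ≡⟨ solve 2 (λ k w → con 8 :* (k :* k) :* (w :* w) :+ con 10 :* (k :* (k :* k)) :* w :+ k :* k :* (con 2 :* k :* w)
                         := con 8 :* (k :* k) :* (w :* w) :+ con 12 :* (k :* (k :* k)) :* w) refl k w ⟩
      8 * (k * k) * (w * w) + 12 * (k * (k * k)) * w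
        ≤⟨ ℕ.+-monoʳ-≤ (8 * (k * k) * (w * w)) (ℕ.*-monoˡ-≤ w 12k³≤w) ⟩
      8 * (k * k) * (w * w) + w * w
        <⟨ ℕ.m<m+n _ (ℕ.<-≤-trans z<s (ℕ.*-monoʳ-≤ 2 5≤2kw)) ⟩
      8 * (k * k) * (w * w) + w * w + 2 * (2 * k * w)
        ≡⟨ solve 2 (λ k w → con 8 :* (k :* k) :* (w :* w) :+ w :* w :+ con 2 :* (con 2 :* k :* w)
                         := con 2 :* k :* (con 2 :* w) :* (con 1 :+ con 2 :* k :* w) :+ w :* w) refl k w ⟩
      2 * k * (2 * w) * q + w * w ∎)
      where
      q = suc (2 * k * w)
      w≤δ : w ≤ δ
      w≤δ = ℕ.+-cancelˡ-≤ w w δ (begin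
        w + w ≡⟨ cong (w +_) (sym (ℕ.+-identityʳ w)) ⟩
        2 * w ≡⟨ kT+δ≡2w ⟨
        k * T + δ ≤⟨ ℕ.+-monoˡ-≤ δ kT≤w ⟩
        w + δ ∎)
      5≤2kw : 5 ≤ 2 * k * w
      5≤2kw = begin
        5 ≤⟨ ℕ.n≤1+n 5 ⟩
        6 * 1 ≤⟨ ℕ.*-mono-≤ (ℕ.*-monoʳ-≤ 2 3≤k) 0<w ⟩
        2 * k * w ∎

    -- The last vertex avoids K + 1 earlier vertices, K ℓ values for each of its two edges, and ℓ
    -- values for the ratio of these two edges. For r > 0, K + 1 ≤ 3ℓ bounds the total by (2K + 4) ℓ
    -- = 2kℓ = 4k³r; a cell has more than w / k elements, whence the constant 4k⁴. For r = 0 only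
    -- the earlier vertices count, and 12k³ ≤ w is enough.
    few-excluded : ∀ {K} r → k ≡ suc (suc K) → r * (4 * k ^ 4) < w → let ℓ = r * (k * (k * 2)) in
                   k * (suc K + (K * ℓ + (K * ℓ + ℓ))) ≤ w
    few-excluded {K} zero    refl _ = begin
      k * (suc K + (K * 0 + (K * 0 + 0))) ≡⟨ cong (λ z → k * (suc K + (z + (z + 0)))) (ℕ.*-zeroʳ K) ⟩
      k * (suc K + 0) ≡⟨ cong (k *_) (ℕ.+-identityʳ (suc K)) ⟩
      k * suc K ≤⟨ ℕ.*-monoʳ-≤ k (ℕ.n≤1+n (suc K)) ⟩
      k * k ≤⟨ ℕ.m≤m+n (k * k) _ ⟩
      12 * (k * k) ≤⟨ ℕ.*-monoʳ-≤ 12 (ℕ.m≤n*m (k * k) k) ⟩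
      12 * (k * (k * k)) ≤⟨ 12k³≤w ⟩
      w ∎
    few-excluded {K} (suc r) refl 4k⁴r<w = begin
      k * (suc K + (K * ℓ + (K * ℓ + ℓ))) ≤⟨ ℕ.*-monoʳ-≤ k (ℕ.+-monoˡ-≤ (K * ℓ + (K * ℓ + ℓ)) 1+K≤3ℓ) ⟩
      k * (3 * ℓ + (K * ℓ + (K * ℓ + ℓ))) ≡⟨ solve 2 (λ K r → let k = con 2 :+ K; ℓ = r :* (k :* (k :* con 2)) in
                                                  k :* (con 3 :* ℓ :+ (K :* ℓ :+ (K :* ℓ :+ ℓ))) := r :* (con 4 :* (k :^ 4))) refl K (suc r) ⟩
      suc r * (4 * k ^ 4) ≤⟨ ℕ.<⇒≤ 4k⁴r<w ⟩
      w ∎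
      where
      ℓ = suc r * (k * (k * 2))
      1+K≤3ℓ : suc K ≤ 3 * ℓ
      1+K≤3ℓ = begin
        suc K ≤⟨ ℕ.n≤1+n (suc K) ⟩
        k ≤⟨ ℕ.m≤m*n k (k * 2) ⟩
        k * (k * 2) ≤⟨ ℕ.m≤m+n _ (r * (k * (k * 2))) ⟩
        ℓ ≤⟨ ℕ.m≤m+n ℓ _ ⟩
        3 * ℓ ∎

  -- An intermediate vertex has a full coset of 2w candidates and fewer exclusions, so the room
  -- required for the last vertex covers it.
  room-to-grow : ∀ k {w j K ℓ} .{{_ : NonZero k}} → 0 ℕ.< w → j ℕ.< K →
                 k ℕ.* (suc K ℕ.+ (K ℕ.* ℓ ℕ.+ (K ℕ.* ℓ ℕ.+ ℓ))) ℕ.≤ w → suc j ℕ.+ j ℕ.* ℓ ℕ.< 2 ℕ.* w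
  room-to-grow k {w} {j} {K} {ℓ} 0<w j<K room = begin-strict
    suc j ℕ.+ j ℕ.* ℓ ≤⟨ ℕ.+-mono-≤ j<K (ℕ.*-monoˡ-≤ ℓ (ℕ.<⇒≤ j<K)) ⟩
    K ℕ.+ K ℕ.* ℓ ≤⟨ ℕ.+-mono-≤ (ℕ.n≤1+n K) (ℕ.m≤m+n (K ℕ.* ℓ) _) ⟩
    suc K ℕ.+ (K ℕ.* ℓ ℕ.+ (K ℕ.* ℓ ℕ.+ ℓ)) ≤⟨ ℕ.m≤n*m _ k ⟩
    k ℕ.* (suc K ℕ.+ (K ℕ.* ℓ ℕ.+ (K ℕ.* ℓ ℕ.+ ℓ))) ≤⟨ room ⟩
    w <⟨ ℕ.m<m+n w (ℕ.<-≤-trans 0<w (ℕ.m≤m+n w 0)) ⟩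
    2 ℕ.* w ∎
    where open ℕ.≤-Reasoning

  module Greedy {k w} (𝔽 : FiniteField (suc (2 ℕ.* k ℕ.* w)))
    (fermat : ∀ {x} → x ≢ FiniteField.0# 𝔽 → FiniteField._^_ 𝔽 x (2 ℕ.* k ℕ.* w) ≡ FiniteField.1# 𝔽)
    (1<k : 1 ℕ.< k) (k-odd : Odd k) (w-odd : Odd w)
    (3≤k : 3 ℕ.≤ k) (4k⁴<w : 4 ℕ.* k ℕ.^ 4 ℕ.< w) where
    open FiniteField 𝔽
    open FieldProperties 𝔽
    open Cyclotomic {k} {w} 𝔽 fermat 1<k k-odd w-odd
    open Estimates k w 3≤k 4k⁴<w using (few-solutions-impossible; few-excluded)

    q : ℕ
    q = suc n

    ^κ≡1-ratio : ∀ {x y} → y ≢ 0# → x ^ κ ≡ y ^ κ → (x * y ⁻¹) ^ κ ≡ 1#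
    ^κ≡1-ratio {x} {y} y≢0 eq = begin
      (x * y ⁻¹) ^ κ ≡⟨ ^-distrib-* x (y ⁻¹) κ ⟩
      x ^ κ * (y ⁻¹) ^ κ ≡⟨ cong (_* (y ⁻¹) ^ κ) eq ⟩
      y ^ κ * (y ⁻¹) ^ κ ≡⟨ ^-distrib-* y (y ⁻¹) κ ⟨
      (y * y ⁻¹) ^ κ ≡⟨ cong (_^ κ) (*-inverseʳ y≢0) ⟩
      1# ^ κ ≡⟨ 1^n≡1 κ ⟩
      1# ∎
      where open ≡-Reasoning

    ratio-* : ∀ {x y} → y ≢ 0# → x ≡ x * y ⁻¹ * y
    ratio-* {x} {y} y≢0 = begin
      x ≡⟨ *-identityʳ x ⟨
      x * 1# ≡⟨ cong (x *_) (*-inverseʳ y≢0) ⟨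
      x * (y * y ⁻¹) ≡⟨ solve 3 (λ x y i → x :* (y :* i) := x :* i :* y) refl x y (y ⁻¹) ⟩
      x * y ⁻¹ * y ∎
      where open ≡-Reasoning

    ≡*⇒≡*⁻¹ : ∀ {x y z} → y ≢ 0# → x * y ≡ z → x ≡ z * y ⁻¹
    ≡*⇒≡*⁻¹ {x} {y} {z} y≢0 xy≡z = trans (ratio-* y≢0) (trans (solve 3 (λ x i y → x :* i :* y := x :* y :* i) refl x (y ⁻¹) y) (cong (_* y ⁻¹) xy≡z))

    module _ {s : F} (s≢0 : s ≢ 0#) where

      -- For s the last vertex placed, the two classes of the edges from s to y and from y back to
      -- 0.
      cell : F → Fin (k ℕ.* k)
      cell y = combine (class y) (class (y - s))

      open Fibres cell

      κth-roots : List F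
      κth-roots = tabulate (class-element 0)

      solution : F → F → F × F
      solution u v = let y′ = (s - v * s) * (u - v) ⁻¹ in u * y′ , y′

      -- The source of 5q + κ²: the diagonal, and four lines where y or y′ is 0 or s. On these lines
      -- a class is that of 0, which carries no information, so all their pairs are counted.
      collision-cover : List (F × F)
      collision-cover = map (λ y → y , y) (allFin q) ++ map (0# ,_) (allFin q) ++ map (s ,_) (allFin q) ++
                        map (_, 0#) (allFin q) ++ map (_, s) (allFin q) ++ cartesianProductWith solution κth-roots κth-roots

      solution-unique : ∀ {y y′ u v} → y ≢ y′ → y ≡ u * y′ → y - s ≡ v * (y′ - s) → (y , y′) ≡ solution u v
      solution-unique {y} {y′} {u} {v} y≢y′ y≡uy′ y-s≡v[y′-s] = cong₂ _,_ (trans y≡uy′ (cong (u *_) y′≡)) y′≡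
        where
        open ≡-Reasoning
        linear : y′ * (u - v) ≡ s - v * s
        linear = begin
          y′ * (u - v) ≡⟨ solve 4 (λ y′ u v s → y′ :* (u :- v) := (u :* y′ :- s) :- v :* (y′ :- s) :+ (s :- v :* s)) refl y′ u v s ⟩
          (u * y′ - s) - v * (y′ - s) + (s - v * s) ≡⟨ cong₂ (λ a b → (a - s) - b + (s - v * s)) (sym y≡uy′) (sym y-s≡v[y′-s]) ⟩
          (y - s) - (y - s) + (s - v * s) ≡⟨ solve 2 (λ a b → a :- a :+ b := b) refl (y - s) (s - v * s) ⟩
          s - v * s ∎
        -- If u = v, the linear equation reduces to s = v s, so u = v = 1 and y = y′.
        u-v≢0 : u - v ≢ 0#
        u-v≢0 eq = y≢y′ (begin
          y ≡⟨ y≡uy′ ⟩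
          u * y′ ≡⟨ cong (_* y′) u≡1 ⟩
          1# * y′ ≡⟨ *-identityˡ y′ ⟩
          y′ ∎)
          where
          u≡v : u ≡ v
          u≡v = x-y≡0⇒x≡y u v eq
          u≡1 : u ≡ 1#
          u≡1 = sym (*-cancelˡ-≢0 s≢0 (begin
            s * 1# ≡⟨ solve 2 (λ s v → s :* con 1ℤ := s :- v :* s :+ v :* s) refl s v ⟩
            s - v * s + v * s ≡⟨ cong (_+ v * s) linear ⟨
            y′ * (u - v) + v * s ≡⟨ cong (λ z → y′ * z + v * s) eq ⟩
            y′ * 0# + v * s ≡⟨ solve 3 (λ y s v → y :* con 0ℤ :+ v :* s := s :* v) refl y′ s v ⟩
            s * v ≡⟨ cong (s *_) u≡v ⟨
            s * u ∎))
        y′≡ : y′ ≡ (s - v * s) * (u - v) ⁻¹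
        y′≡ = ≡*⇒≡*⁻¹ u-v≢0 linear

      same-class-^κ : ∀ {x x′} → x ≢ 0# → x′ ≢ 0# → class x ≡ class x′ → x ^ κ ≡ x′ ^ κ
      same-class-^κ {x} {x′} x≢0 x′≢0 eq = trans (^κ≡class {x} x≢0) (trans (cong (λ i → ζ ^ toℕ i) eq) (sym (^κ≡class {x′} x′≢0)))

      same-class-ratio : ∀ {x x′} → x ≢ 0# → x′ ≢ 0# → class x ≡ class x′ → ∃ λ j → x * x′ ⁻¹ ≡ class-element 0 j
      same-class-ratio {x} {x′} x≢0 x′≢0 eq = κth-root {x * x′ ⁻¹} (λ xx′⁻¹≡0 → x≢0 (trans (ratio-* {x} {x′} x′≢0) (trans (cong (_* x′) xx′⁻¹≡0) (zeroˡ x′))))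
          (^κ≡1-ratio {x} {x′} x′≢0 (same-class-^κ x≢0 x′≢0 eq))

      ratio-in-κth-roots : ∀ {x x′} → x ≢ 0# → x′ ≢ 0# → class x ≡ class x′ → x * x′ ⁻¹ ∈ κth-roots
      ratio-in-κth-roots {x} {x′} x≢0 x′≢0 eq = let j , x/x′≡ = same-class-ratio x≢0 x′≢0 eq in
        subst (_∈ κth-roots) (sym x/x′≡) (∈-tabulate⁺ {f = class-element 0} j)

      -- Two elements y ≢ y′ in the same cell satisfy y = u y′ and y − s = v (y′ − s) with κth roots of
      -- unity u and v, and these two equations determine y′ and y.
      collision-solved : ∀ {y y′} → y ≢ 0# → y ≢ s → y′ ≢ 0# → y′ ≢ s → y ≢ y′ → cell y ≡ cell y′ →
                         (y , y′) ∈ cartesianProductWith solution κth-roots κth-roots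
      collision-solved {y} {y′} y≢0 y≢s y′≢0 y′≢s y≢y′ eq =
        subst (_∈ cartesianProductWith solution κth-roots κth-roots) (sym (solution-unique {y} {y′} {y * y′ ⁻¹} {(y - s) * (y′ - s) ⁻¹} y≢y′ (ratio-* y′≢0) (ratio-* y′-s≢0)))
          (∈-cartesianProductWith⁺ solution (ratio-in-κth-roots y≢0 y′≢0 (proj₁ classes≡)) (ratio-in-κth-roots y-s≢0 y′-s≢0 (proj₂ classes≡)))
        where
        classes≡ : class y ≡ class y′ × class (y - s) ≡ class (y′ - s)
        classes≡ = Fin.combine-injective (class y) (class (y - s)) (class y′) (class (y′ - s)) eq
        y-s≢0 : y - s ≢ 0#
        y-s≢0 = y≢s ∘ x-y≡0⇒x≡y y s
        y′-s≢0 : y′ - s ≢ 0#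
        y′-s≢0 = y′≢s ∘ x-y≡0⇒x≡y y′ s

      collisions≤ : collisions ℕ.≤ 5 ℕ.* q ℕ.+ κ ℕ.* κ
      collisions≤ = ℕ.≤-trans (count₂-cover (λ y y′ → cell y Fin.≟ cell y′) collision-cover covered) (ℕ.≤-reflexive |cover|)
        where
        covered : ∀ y y′ → cell y ≡ cell y′ → (y , y′) ∈ collision-cover
        covered y y′ eq with y Fin.≟ y′
        ... | yes y≡y′ = ∈-++⁺ˡ (subst (λ z → (y , z) ∈ map (λ y → y , y) (allFin q)) y≡y′ (∈-map⁺ (λ y → y , y) (∈-allFin y)))
        ... | no  y≢y′ = ∈-++⁺ʳ (map (λ y → y , y) (allFin q)) (by-left (y Fin.≟ 0#) (y Fin.≟ s) (y′ Fin.≟ 0#) (y′ Fin.≟ s))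
          where
          by-left : Dec (y ≡ 0#) → Dec (y ≡ s) → Dec (y′ ≡ 0#) → Dec (y′ ≡ s) → (y , y′) ∈ map (0# ,_) (allFin q) ++ map (s ,_) (allFin q) ++ map (_, 0#) (allFin q) ++ map (_, s) (allFin q) ++ cartesianProductWith solution κth-roots κth-roots
          by-left (yes y≡0) _ _ _ = ∈-++⁺ˡ (subst (λ z → (z , y′) ∈ map (0# ,_) (allFin q)) (sym y≡0) (∈-map⁺ (0# ,_) (∈-allFin y′)))
          by-left (no _) (yes y≡s) _ _ = ∈-++⁺ʳ (map (0# ,_) (allFin q)) (∈-++⁺ˡ (subst (λ z → (z , y′) ∈ map (s ,_) (allFin q)) (sym y≡s) (∈-map⁺ (s ,_) (∈-allFin y′))))
          by-left (no y≢0) (no y≢s) y′≟0 y′≟s = ∈-++⁺ʳ (map (0# ,_) (allFin q)) (∈-++⁺ʳ (map (s ,_) (allFin q)) (by-right y′≟0 y′≟s))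
            where
            by-right : Dec (y′ ≡ 0#) → Dec (y′ ≡ s) → (y , y′) ∈ map (_, 0#) (allFin q) ++ map (_, s) (allFin q) ++ cartesianProductWith solution κth-roots κth-roots
            by-right (yes y′≡0) _ = ∈-++⁺ˡ (subst (λ z → (y , z) ∈ map (_, 0#) (allFin q)) (sym y′≡0) (∈-map⁺ (_, 0#) (∈-allFin y)))
            by-right (no _) (yes y′≡s) = ∈-++⁺ʳ (map (_, 0#) (allFin q)) (∈-++⁺ˡ (subst (λ z → (y , z) ∈ map (_, s) (allFin q)) (sym y′≡s) (∈-map⁺ (_, s) (∈-allFin y))))
            by-right (no y′≢0) (no y′≢s) = ∈-++⁺ʳ (map (_, 0#) (allFin q)) (∈-++⁺ʳ (map (_, s) (allFin q)) (collision-solved y≢0 y≢s y′≢0 y′≢s y≢y′ eq))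
        _+++_ : (F → F × F) → List (F × F) → List (F × F)
        f +++ zs = map f (allFin q) ++ zs
        |+++| : ∀ f {zs m} → length zs ≡ m → length (f +++ zs) ≡ q ℕ.+ m
        |+++| f |zs|≡m = trans (length-++ (map f (allFin q)))
          (cong₂ ℕ._+_ (trans (length-map f (allFin q)) (length-tabulate {n = q} (λ i → i))) |zs|≡m)
        |solutions| : length (cartesianProductWith solution κth-roots κth-roots) ≡ κ ℕ.* κ
        |solutions| = trans (length-cartesianProductWith solution κth-roots κth-roots)
          (cong₂ ℕ._*_ (length-tabulate (class-element 0)) (length-tabulate (class-element 0)))
        |cover| : length collision-cover ≡ 5 ℕ.* q ℕ.+ κ ℕ.* κ
        |cover| = trans
          (|+++| (λ y → y , y) (|+++| (0# ,_) (|+++| (s ,_) (|+++| (_, 0#) (|+++| (_, s) |solutions|)))))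
          (ℕSolver.solve 2 (λ q c → q ℕSolver.:+ (q ℕSolver.:+ (q ℕSolver.:+ (q ℕSolver.:+ (q ℕSolver.:+ c)))) ℕSolver.:= ℕSolver.con 5 ℕSolver.:* q ℕSolver.:+ c) refl q (κ ℕ.* κ))

      many-in-cell : ∀ i → w ℕ.< k ℕ.* fibre i
      many-in-cell i = ℕ.≰⇒> λ kT≤w →
        let δ , kT+δ≡κ = ℕ.m≤n⇒∃[o]m+o≡n (ℕ.≤-trans kT≤w (ℕ.m≤m+n w _))
        in few-solutions-impossible {fibre i} {δ} {collisions} kT+δ≡κ kT≤w collisions≤ (second-moment k i δ)

    step : (ℕ → F) → ℕ → F
    step b i = b (suc i) - b i

    -- A path is kept as a function on all of ℕ; only its values up to the current end have a
    -- meaning.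
    extend : (ℕ → F) → ℕ → F → ℕ → F
    extend b j x i with i ℕ.≤? j
    ... | yes _ = b i
    ... | no  _ = x

    extend-old : ∀ b {j} x {i} → i ℕ.≤ j → extend b j x i ≡ b i
    extend-old b {j} x {i} i≤j with i ℕ.≤? j
    ... | yes _   = refl
    ... | no  i≰j = contradiction i≤j i≰j

    extend-new : ∀ b j x → extend b j x (suc j) ≡ x
    extend-new b j x with suc j ℕ.≤? j
    ... | yes 1+j≤j = contradiction 1+j≤j ℕ.1+n≰n
    ... | no  _     = refl

    step-old : ∀ b {j} x {i} → i ℕ.< j → step (extend b j x) i ≡ step b i
    step-old b x i<j = cong₂ _-_ (extend-old b x i<j) (extend-old b x (ℕ.<⇒≤ i<j))

    step-new : ∀ b j x → step (extend b j x) j ≡ x - b j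
    step-new b j x = cong₂ _-_ (extend-new b j x) (extend-old b x ℕ.≤-refl)

    Distinct : ℕ → (ℕ → F) → Set
    Distinct j b = ∀ i i′ → i ℕ.< i′ → i′ ℕ.≤ j → b i ≢ b i′

    distinct-extend : ∀ {b j x} → Distinct j b → (∀ {i} → i ℕ.≤ j → x ≢ b i) → Distinct (suc j) (extend b j x)
    distinct-extend {b} {j} {x} distinct x≢b i i′ i<i′ i′≤1+j eq = [ old , new ]′ (ℕ.m≤n⇒m<n∨m≡n i′≤1+j)
      where
      old : ¬ i′ ℕ.< suc j
      old i′<1+j = distinct i i′ i<i′ i′≤j (trans (sym (extend-old b x (ℕ.≤-trans (ℕ.<⇒≤ i<i′) i′≤j))) (trans eq (extend-old b x i′≤j)))
        where
        i′≤j : i′ ℕ.≤ j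
        i′≤j = ℕ.s≤s⁻¹ i′<1+j
      new : i′ ≢ suc j
      new refl = x≢b (ℕ.s≤s⁻¹ i<i′) (trans (sym (extend-new b j x)) (trans (sym eq) (extend-old b x (ℕ.s≤s⁻¹ i<i′))))

    -- L is a list of forbidden ratios of two differences.
    module _ (L : List F) where

      -- Only the later difference is tested against the earlier one. In the application L contains
      -- the quotients in both orders, so this covers either order of the two indices.
      record Path (j : ℕ) (b : ℕ → F) : Set where
        field
          step-class : ∀ {i} → i ℕ.< j → step b i ^ κ ≡ ζ ^ i
          step-fresh : ∀ {i i′} → i ℕ.< i′ → i′ ℕ.< j → step b i′ ∉ map (step b i *_) L

      open Path

      path-extend : ∀ {b j x} → Path j b → (x - b j) ^ κ ≡ ζ ^ j → (∀ {i} → i ℕ.< j → x - b j ∉ map (step b i *_) L) →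
                    Path (suc j) (extend b j x)
      path-extend {b} {j} {x} path x-class x-fresh = record { step-class = class′ ; step-fresh = fresh′ }
        where
        class′ : ∀ {i} → i ℕ.< suc j → step (extend b j x) i ^ κ ≡ ζ ^ i
        class′ {i} i<1+j = [ (λ i<j → trans (cong (_^ κ) (step-old b x i<j)) (step-class path i<j))
                           , (λ { refl → trans (cong (_^ κ) (step-new b j x)) x-class }) ]′ (ℕ.m≤n⇒m<n∨m≡n (ℕ.s≤s⁻¹ i<1+j))
        fresh′ : ∀ {i i′} → i ℕ.< i′ → i′ ℕ.< suc j → step (extend b j x) i′ ∉ map (step (extend b j x) i *_) L
        fresh′ {i} {i′} i<i′ i′<1+j = [
            (λ i′<j → subst₂ (λ s t → s ∉ map (t *_) L) (sym (step-old b x i′<j)) (sym (step-old b x (ℕ.<-trans i<i′ i′<j))) (step-fresh path i<i′ i′<j))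
          , (λ { refl → subst₂ (λ s t → s ∉ map (t *_) L) (sym (step-new b j x)) (sym (step-old b x i<i′)) (x-fresh i<i′) }) ]′
          (ℕ.m≤n⇒m<n∨m≡n (ℕ.s≤s⁻¹ i′<1+j))

      ℓ : ℕ
      ℓ = length L

      visited : (ℕ → F) → ℕ → List F
      visited b j = spread (suc j) (λ i → b i ∷ [])

      ∉-visited : ∀ {b j x} → x ∉ visited b j → ∀ {i} → i ℕ.≤ j → x ≢ b i
      ∉-visited {b} x∉ {i} i≤j refl = x∉ (∈-spread (λ i → b i ∷ []) (s≤s i≤j) (here refl))

      length-visited : ∀ b j → length (visited b j) ≡ suc j
      length-visited b j = trans (length-spread (suc j) (λ i → b i ∷ []) (λ _ → refl)) (ℕ.*-identityʳ (suc j))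

      -- `f` turns a forbidden difference into the vertex that would cause it: a translation for the
      -- edge into the new vertex, negation for the edge from it back to 0.
      excluded : (F → F) → (ℕ → F) → ℕ → List F
      excluded f b j = spread j (λ i → map (λ ρ → f (step b i * ρ)) L)

      ∉-excluded : ∀ (f f⁻¹ : F → F) b {j x} → (∀ y → f (f⁻¹ y) ≡ y) → x ∉ excluded f b j → ∀ {i} → i ℕ.< j → f⁻¹ x ∉ map (step b i *_) L
      ∉-excluded f f⁻¹ b {j} {x} inverse x∉ {i} i<j in-map with ρ , ρ∈L , f⁻¹x≡ ← ∈-map⁻ (step b i *_) in-map =
        x∉ (∈-spread {j = j} (λ i → map (λ ρ → f (step b i * ρ)) L) i<j
          (subst (_∈ map (λ ρ → f (step b i * ρ)) L) (trans (cong f (sym f⁻¹x≡)) (inverse x)) (∈-map⁺ (λ ρ → f (step b i * ρ)) ρ∈L)))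

      length-excluded : ∀ f b j → length (excluded f b j) ≡ j ℕ.* ℓ
      length-excluded f b j = length-spread j (λ i → map (λ ρ → f (step b i * ρ)) L) (λ i → length-map _ L)

      shift-inverse : ∀ c y → c + (y - c) ≡ y
      shift-inverse c y = solve 2 (λ c y → c :+ (y :- c) := y) refl c y

      grow : ∀ {j b} → j ℕ.< k → suc j ℕ.+ j ℕ.* ℓ ℕ.< κ → Path j b → Distinct j b →
             ∃ λ x → Path (suc j) (extend b j x) × Distinct (suc j) (extend b j x)
      grow {j} {b} j<k room path distinct = grown (avoiding in-class? E (ℕ.<-≤-trans (subst (ℕ._< κ) (sym |E|) room) many))
        where
        InClass : F → Set
        InClass x = (x - b j) ^ κ ≡ ζ ^ j
        in-class? : ∀ x → Dec (InClass x)
        in-class? x = (x - b j) ^ κ Fin.≟ ζ ^ j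
        E : List F
        E = visited b j ++ excluded (b j +_) b j
        |E| : length E ≡ suc j ℕ.+ j ℕ.* ℓ
        |E| = trans (length-++ (visited b j)) (cong₂ ℕ._+_ (length-visited b j) (length-excluded (b j +_) b j))
        element : Fin κ → F
        element m = b j + class-element j m
        element-step : ∀ m → element m - b j ≡ class-element j m
        element-step m = solve 2 (λ b c → b :+ c :- b := c) refl (b j) (class-element j m)
        many : κ ℕ.≤ count in-class?
        many = count-injection in-class? element
          (λ {m} {m′} eq → class-element-injective j<k (trans (sym (element-step m)) (trans (cong (_- b j) eq) (element-step m′))))
          (λ m → trans (cong (_^ κ) (element-step m)) (class-element-^κ j m))
        grown : (∃ λ x → InClass x × x ∉ E) → _
        grown (x , x-class , x∉E) = x
          , path-extend path x-class (∉-excluded (b j +_) (_- b j) b (shift-inverse (b j)) (x∉E ∘ ∈-++⁺ʳ (visited b j)))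
          , distinct-extend distinct (∉-visited (x∉E ∘ ∈-++⁺ˡ))

      module _ {K} (k≡2+K : k ≡ suc (suc K)) (0<K : 0 ℕ.< K) (room : k ℕ.* (suc K ℕ.+ (K ℕ.* ℓ ℕ.+ (K ℕ.* ℓ ℕ.+ ℓ))) ℕ.≤ w) where

        1+K<k : suc K ℕ.< k
        1+K<k = ℕ.≤-reflexive (sym k≡2+K)

        K<k : K ℕ.< k
        K<k = ℕ.<-trans (ℕ.n<1+n K) 1+K<k

        initial : ∀ j → j ℕ.≤ K → ∃ λ b → Path j b × Distinct j b × b 0 ≡ 0#
        initial zero    _   = (λ _ → 0#) , record { step-class = λ () ; step-fresh = λ _ () } , (λ _ _ i<i′ i′≤0 _ → contradiction (ℕ.<-≤-trans i<i′ i′≤0) λ ()) , refl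
        initial (suc j) j<K = next (initial j (ℕ.<⇒≤ j<K))
          where
          room′ : suc j ℕ.+ j ℕ.* ℓ ℕ.< κ
          room′ = room-to-grow k {w} {j} {K} {ℓ} {{k≢0}} 0<w j<K room
          append : ∀ b → b 0 ≡ 0# → (∃ λ x → Path (suc j) (extend b j x) × Distinct (suc j) (extend b j x)) →
                   ∃ λ b → Path (suc j) b × Distinct (suc j) b × b 0 ≡ 0#
          append b b₀≡0 (x , path , distinct) = extend b j x , path , distinct , trans (extend-old b {j} x {0} z≤n) b₀≡0
          next : (∃ λ b → Path j b × Distinct j b × b 0 ≡ 0#) → ∃ λ b → Path (suc j) b × Distinct (suc j) b × b 0 ≡ 0#
          next (b , path , distinct , b₀≡0) = append b b₀≡0 (grow (ℕ.<-trans j<K K<k) room′ path distinct)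

        closed : ∃ λ b → Path k b × Distinct (suc K) b × b 0 ≡ 0# × b k ≡ 0#
        closed = close (initial K ℕ.≤-refl)
          where
          close : (∃ λ b → Path K b × Distinct K b × b 0 ≡ 0#) → ∃ λ b → Path k b × Distinct (suc K) b × b 0 ≡ 0# × b k ≡ 0#
          close (b , path , distinct , b₀≡0) = closing (avoiding in-cell? E (ℕ.*-cancelˡ-< k _ _ (ℕ.≤-<-trans (subst (λ e → k ℕ.* e ℕ.≤ w) (sym |E|) room) (many-in-cell s≢0 target))))
            where
            s : F
            s = b K
            -- This uses K > 0, that is, k ≥ 3: otherwise s would be the starting vertex 0 itself.
            s≢0 : s ≢ 0#
            s≢0 s≡0 = distinct 0 K 0<K ℕ.≤-refl (trans b₀≡0 (sym s≡0))
            target : Fin (k ℕ.* k)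
            -- The closing difference is -x, but κ is even, so x and -x have the same class. The two
            -- differences still missing have indices K and K + 1.
            target = combine (fromℕ< 1+K<k) (fromℕ< K<k)
            InCell : F → Set
            InCell x = cell s≢0 x ≡ target
            in-cell? : ∀ x → Dec (InCell x)
            in-cell? x = cell s≢0 x Fin.≟ target
            -- The solution x of -x = (x - s) ρ, for which the two new differences have ratio ρ. For
            -- ρ = -1 there is none, as s ≠ 0, and the value of `last` does not matter.
            last : F → F
            last ρ = s * ρ * (1# + ρ) ⁻¹
            E : List F
            E = visited b K ++ excluded (s +_) b K ++ excluded -_ b K ++ map last L
            |E| : length E ≡ suc K ℕ.+ (K ℕ.* ℓ ℕ.+ (K ℕ.* ℓ ℕ.+ ℓ))
            |E| = trans (length-++ (visited b K)) (cong₂ ℕ._+_ (length-visited b K)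
                 (trans (length-++ (excluded (s +_) b K)) (cong₂ ℕ._+_ (length-excluded (s +_) b K)
                 (trans (length-++ (excluded -_ b K)) (cong₂ ℕ._+_ (length-excluded -_ b K) (length-map last L))))))
            closing : (∃ λ x → InCell x × x ∉ E) → ∃ λ b → Path k b × Distinct (suc K) b × b 0 ≡ 0# × b k ≡ 0#
            closing (x , in-cell , x∉E) = b₂
              , subst (λ k → Path k b₂) (sym k≡2+K) (path-extend path₁ x-class₂ x-fresh₂)
              , (λ i i′ i<i′ i′≤ → distinct₁ i i′ i<i′ i′≤ ∘ λ eq → trans (sym (extend-old b₁ 0# (ℕ.≤-trans (ℕ.<⇒≤ i<i′) i′≤))) (trans eq (extend-old b₁ 0# i′≤)))
              , trans (extend-old b₁ {suc K} 0# {0} z≤n) (trans (extend-old b {K} x {0} z≤n) b₀≡0)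
              , trans (cong b₂ k≡2+K) (extend-new b₁ (suc K) 0#)
              where
              open ≡-Reasoning
              x≢b : ∀ {i} → i ℕ.≤ K → x ≢ b i
              x≢b = ∉-visited (x∉E ∘ ∈-++⁺ˡ)
              x≢0 : x ≢ 0#
              x≢0 x≡0 = x≢b z≤n (trans x≡0 (sym b₀≡0))
              x-s≢0 : x - s ≢ 0#
              x-s≢0 = x≢b ℕ.≤-refl ∘ x-y≡0⇒x≡y x s
              classes : class x ≡ fromℕ< 1+K<k × class (x - s) ≡ fromℕ< K<k
              classes = Fin.combine-injective (class x) (class (x - s)) _ _ in-cell
              x-class : x ^ κ ≡ ζ ^ suc K
              x-class = trans (^κ≡class x≢0) (cong (ζ ^_) (trans (cong toℕ (proj₁ classes)) (Fin.toℕ-fromℕ< 1+K<k)))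
              x-s-class : (x - s) ^ κ ≡ ζ ^ K
              x-s-class = trans (^κ≡class x-s≢0) (cong (ζ ^_) (trans (cong toℕ (proj₂ classes)) (Fin.toℕ-fromℕ< K<k)))
              b₁ : ℕ → F
              b₁ = extend b K x
              path₁ : Path (suc K) b₁
              path₁ = path-extend path x-s-class (∉-excluded (s +_) (_- s) b (shift-inverse s) (x∉E ∘ ∈-++⁺ʳ (visited b K) ∘ ∈-++⁺ˡ))
              distinct₁ : Distinct (suc K) b₁
              distinct₁ = distinct-extend distinct x≢b
              -- Setting b k = 0 = b 0 makes the closing edge an ordinary step, at index K + 1 = k -
              -- 1; distinctness is claimed only up to K + 1.
              b₂ : ℕ → F
              b₂ = extend b₁ (suc K) 0#
              0-b₁≡-x : 0# - b₁ (suc K) ≡ - x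
              0-b₁≡-x = trans (+-identityˡ _) (cong -_ (extend-new b K x))
              x-class₂ : (0# - b₁ (suc K)) ^ κ ≡ ζ ^ suc K
              x-class₂ = trans (cong (_^ κ) 0-b₁≡-x) (trans (neg-^-even x w) x-class)
              -x∉old : ∀ {i} → i ℕ.< K → - x ∉ map (step b i *_) L
              -x∉old = ∉-excluded -_ -_ b ⁻¹-involutive (x∉E ∘ ∈-++⁺ʳ (visited b K) ∘ ∈-++⁺ʳ (excluded (s +_) b K) ∘ ∈-++⁺ˡ)
              -x∉last : - x ∉ map ((x - s) *_) L
              -x∉last in-map with ρ , ρ∈L , -x≡ ← ∈-map⁻ ((x - s) *_) in-map =
                x∉E (∈-++⁺ʳ (visited b K) (∈-++⁺ʳ (excluded (s +_) b K) (∈-++⁺ʳ (excluded -_ b K)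
                  (subst (_∈ map last L) (sym x≡last) (∈-map⁺ last ρ∈L)))))
                where
                x[1+ρ]≡sρ : x * (1# + ρ) ≡ s * ρ
                x[1+ρ]≡sρ = begin
                  x * (1# + ρ) ≡⟨ solve 3 (λ x s r → x :* (con 1ℤ :+ r) := s :* r :+ ((x :- s) :* r :- :- x)) refl x s ρ ⟩
                  s * ρ + ((x - s) * ρ - - x) ≡⟨ cong (λ z → s * ρ + (z - - x)) -x≡ ⟨
                  s * ρ + (- x - - x) ≡⟨ solve 2 (λ a x → a :+ (:- x :- :- x) := a) refl (s * ρ) x ⟩
                  s * ρ ∎
                1+ρ≢0 : 1# + ρ ≢ 0#
                1+ρ≢0 1+ρ≡0 = 1≢0 (begin
                  1# ≡⟨ +-identityʳ 1# ⟨
                  1# + 0# ≡⟨ cong (λ z → 1# + z) (x*y≡0⇒y≡0 s≢0 (trans (sym x[1+ρ]≡sρ) (trans (cong (x *_) 1+ρ≡0) (zeroʳ x)))) ⟨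
                  1# + ρ ≡⟨ 1+ρ≡0 ⟩
                  0# ∎)
                x≡last : x ≡ last ρ
                x≡last = ≡*⇒≡*⁻¹ 1+ρ≢0 x[1+ρ]≡sρ
              x-fresh₂ : ∀ {i} → i ℕ.< suc K → 0# - b₁ (suc K) ∉ map (step b₁ i *_) L
              x-fresh₂ {i} i<1+K = subst (_∉ map (step b₁ i *_) L) (sym 0-b₁≡-x) ([
                  (λ i<K → subst (λ t → - x ∉ map (t *_) L) (sym (step-old b x i<K)) (-x∉old i<K))
                , (λ { refl → subst (λ t → - x ∉ map (t *_) L) (sym (step-new b K x)) -x∉last }) ]′ (ℕ.m≤n⇒m<n∨m≡n (ℕ.s≤s⁻¹ i<1+K)))

        base-avoiding : Σ[ B ∈ Base ] (∀ {i i′} → i Fin.< i′ → Base.d B i′ ∉ map (Base.d B i *_) L)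
        base-avoiding = from-closed closed
          where
          from-closed : (∃ λ b → Path k b × Distinct (suc K) b × b 0 ≡ 0# × b k ≡ 0#) →
                        Σ[ B ∈ Base ] (∀ {i i′} → i Fin.< i′ → Base.d B i′ ∉ map (Base.d B i *_) L)
          from-closed (b , path , distinct , b₀≡0 , bₖ≡0) = record
            { b           = b ∘ toℕ
            ; d           = step b ∘ toℕ
            ; b-injective = λ {i} {j} → injective i j
            ; b-step      = λ {i} {j} → b-step i j
            ; d-class     = λ i → step-class path (Fin.toℕ<n i)
            } , λ {i} {i′} i<i′ → step-fresh path i<i′ (Fin.toℕ<n i′)
            where
            at-most : ∀ (i : Fin k) → toℕ i ℕ.≤ suc K
            at-most i = ℕ.s≤s⁻¹ (subst (toℕ i ℕ.<_) k≡2+K (Fin.toℕ<n i))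
            injective : ∀ (i j : Fin k) → b (toℕ i) ≡ b (toℕ j) → i ≡ j
            injective i j eq with Fin.<-cmp i j
            ... | tri< i<j _ _ = contradiction eq (distinct (toℕ i) (toℕ j) i<j (at-most j))
            ... | tri≈ _ i≡j _ = i≡j
            ... | tri> _ _ j<i = contradiction (sym eq) (distinct (toℕ j) (toℕ i) j<i (at-most i))
            b-step : ∀ (i j : Fin k) → CyclicSuc i j → b (toℕ j) ≡ b (toℕ i) + step b (toℕ i)
            b-step i j (inj₁ j≡1+i)         = trans (cong b j≡1+i) (sym (shift-inverse (b (toℕ i)) (b (suc (toℕ i)))))
            b-step i j (inj₂ (1+i≡k , j≡0)) = trans (cong b j≡0) (trans b₀≡0 (trans (sym bₖ≡0) (trans (cong b (sym 1+i≡k)) (sym (shift-inverse (b (toℕ i)) (b (suc (toℕ i))))))))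

    ≡*-ratio : ∀ {a c u v} → v ≢ 0# → a * u ≡ c * v → c ≡ a * (u * v ⁻¹)
    ≡*-ratio {a} {c} {u} {v} v≢0 au≡cv = trans (≡*⇒≡*⁻¹ v≢0 (sym au≡cv)) (*-assoc a u (v ⁻¹))

    module _ {r} (Bs : Fin r → Base) where
      private
        module B t = Base (Bs t)

      quotient-of-differences : Fin r → Fin k → Fin k → F
      quotient-of-differences t i l = B.d t i * B.d t l ⁻¹

      signed-quotient : Fin r → Fin k → Fin k → Fin 2 → F
      signed-quotient t i l zero    = quotient-of-differences t i l
      signed-quotient t i l (suc _) = - quotient-of-differences t i l

      decode : Fin (r ℕ.* (k ℕ.* (k ℕ.* 2))) → F
      decode e = let t , e₁ = remQuot {r} (k ℕ.* (k ℕ.* 2)) e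
                     i , e₂ = remQuot {k} (k ℕ.* 2) e₁
                     l , σ  = remQuot {k} 2 e₂
                 in signed-quotient t i l σ

      ratios : List F
      ratios = tabulate decode

      signed-quotient∈ratios : ∀ t i l σ → signed-quotient t i l σ ∈ ratios
      signed-quotient∈ratios t i l σ = subst (_∈ ratios) decode≡ (∈-tabulate⁺ {f = decode} e)
        where
        e₂ : Fin (k ℕ.* 2)
        e₂ = combine l σ
        e₁ : Fin (k ℕ.* (k ℕ.* 2))
        e₁ = combine i e₂
        e : Fin (r ℕ.* (k ℕ.* (k ℕ.* 2)))
        e = combine t e₁
        decode≡ : decode e ≡ signed-quotient t i l σ
        decode≡ = begin
          decode e
            ≡⟨ cong (λ { (t , e₁) → let i , e₂ = remQuot {k} (k ℕ.* 2) e₁; l , σ = remQuot {k} 2 e₂ in signed-quotient t i l σ }) (Fin.remQuot-combine t e₁) ⟩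
          (let i , e₂ = remQuot {k} (k ℕ.* 2) e₁; l , σ = remQuot {k} 2 e₂ in signed-quotient t i l σ)
            ≡⟨ cong (λ { (i , e₂) → let l , σ = remQuot {k} 2 e₂ in signed-quotient t i l σ }) (Fin.remQuot-combine i e₂) ⟩
          (let l , σ = remQuot {k} 2 e₂ in signed-quotient t i l σ)
            ≡⟨ cong (λ { (l , σ) → signed-quotient t i l σ }) (Fin.remQuot-combine l σ) ⟩
          signed-quotient t i l σ ∎
          where open ≡-Reasoning

      -- Taking square roots gives c = ± a · (B.d t i / B.d t l), which is why `ratios` holds both
      -- signs and has length 2k²r.
      proportional : ∀ t i l {a c} → (a * B.d t i) * (a * B.d t i) ≡ (c * B.d t l) * (c * B.d t l) → c ∈ map (a *_) ratios
      proportional t i l {a} {c} eq = [ same , opposite ]′ (square-injective eq)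
        where
        open ≡-Reasoning
        multiple : ∀ {ρ} → c ≡ a * ρ → ρ ∈ ratios → c ∈ map (a *_) ratios
        multiple c≡aρ ρ∈ratios = subst (_∈ map (a *_) ratios) (sym c≡aρ) (∈-map⁺ (a *_) ρ∈ratios)
        same : a * B.d t i ≡ c * B.d t l → c ∈ map (a *_) ratios
        same eq′ = multiple (≡*-ratio (B.d≢0 t l) eq′) (signed-quotient∈ratios t i l zero)
        opposite : a * B.d t i ≡ - (c * B.d t l) → c ∈ map (a *_) ratios
        opposite eq′ = multiple (begin
          c ≡⟨ ⁻¹-involutive c ⟨
          - - c ≡⟨ cong -_ (≡*-ratio (B.d≢0 t l) (trans eq′ (-‿distribˡ-* c (B.d t l)))) ⟩
          - (a * quotient-of-differences t i l) ≡⟨ -‿distribʳ-* a (quotient-of-differences t i l) ⟩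
          a * - quotient-of-differences t i l ∎) (signed-quotient∈ratios t i l (suc zero))

      IndependentOfAll : Base → Set
      IndependentOfAll B = ∀ t → Independent (Base.starter B) (B.starter t)

      opaque
        independent-base : r ℕ.* (4 ℕ.* k ℕ.^ 4) ℕ.< w → Σ[ B ∈ Base ] IndependentOfAll B
        independent-base 4k⁴r<w = from-fresh (base-avoiding ratios k≡2+K 0<K room)
          where
          K : ℕ
          K = proj₁ (ℕ.m≤n⇒∃[o]m+o≡n 1<k)
          k≡2+K : k ≡ suc (suc K)
          k≡2+K = sym (proj₂ (ℕ.m≤n⇒∃[o]m+o≡n 1<k))
          0<K : 0 ℕ.< K
          0<K = ℕ.s≤s⁻¹ (ℕ.s≤s⁻¹ (subst (3 ℕ.≤_) k≡2+K 3≤k))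
          room : k ℕ.* (suc K ℕ.+ (K ℕ.* length ratios ℕ.+ (K ℕ.* length ratios ℕ.+ length ratios))) ℕ.≤ w
          room = subst (λ ℓ → k ℕ.* (suc K ℕ.+ (K ℕ.* ℓ ℕ.+ (K ℕ.* ℓ ℕ.+ ℓ))) ℕ.≤ w) (sym (length-tabulate decode)) (few-excluded {K} r k≡2+K 4k⁴r<w)
          from-fresh : Σ[ B ∈ Base ] (∀ {i i′} → i Fin.< i′ → Base.d B i′ ∉ map (Base.d B i *_) ratios) → Σ[ B ∈ Base ] IndependentOfAll B
          from-fresh (B , fresh) = B , independent
            where
            independent : IndependentOfAll B
            independent t {i} {l} {i′} {l′} i≢l eq with Fin.<-cmp i l
            ... | tri< i<l _ _ = fresh i<l (proportional t l′ i′ eq)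
            ... | tri≈ _ i≡l _ = i≢l i≡l
            ... | tri> _ _ l<i = fresh l<i (proportional t i′ l′ (sym eq))

    -- The newest base receives index 0. `Independent` is then known exactly for i < j, the newer
    -- base on the left; the other order is recovered from the symmetry of orthogonality.
    independent-bases : ∀ r → (∀ {t} → t ℕ.< r → t ℕ.* (4 ℕ.* k ℕ.^ 4) ℕ.< w) →
                        Σ[ Bs ∈ (Fin r → Base) ] (∀ {i j} → i Fin.< j → Independent (Base.starter (Bs i)) (Base.starter (Bs j)))
    independent-bases zero    _     = (λ ()) , λ { {()} }
    independent-bases (suc r) small = prepend (independent-bases r (small ∘ ℕ.m<n⇒m<1+n))
      where
      prepend : Σ[ Bs ∈ (Fin r → Base) ] (∀ {i j} → i Fin.< j → Independent (Base.starter (Bs i)) (Base.starter (Bs j))) →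
                Σ[ Bs ∈ (Fin (suc r) → Base) ] (∀ {i j} → i Fin.< j → Independent (Base.starter (Bs i)) (Base.starter (Bs j)))
      prepend (Bs , independent) = Bs′ , independent′
        where
        B : Base
        B = proj₁ (independent-base Bs (small (ℕ.n<1+n r)))
        independent-of-all : IndependentOfAll Bs B
        independent-of-all = proj₂ (independent-base Bs (small (ℕ.n<1+n r)))
        Bs′ : Fin (suc r) → Base
        Bs′ zero    = B
        Bs′ (suc t) = Bs t
        independent′ : ∀ {i j} → i Fin.< j → Independent (Base.starter (Bs′ i)) (Base.starter (Bs′ j))
        independent′ {zero}  {suc j} _   = independent-of-all j
        independent′ {suc i} {suc j} i<j = independent (ℕ.s<s⁻¹ i<j)

    orthogonal-systems : ∀ r → (∀ {t} → t ℕ.< r → t ℕ.* (4 ℕ.* k ℕ.^ 4) ℕ.< w) →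
                         Σ[ 𝒮 ∈ (Fin r → CycleSystem k (suc (2 ℕ.* k ℕ.* w))) ] PairwiseOrthogonal 𝒮
    orthogonal-systems r small = from-bases (independent-bases r small)
      where
      from-bases : Σ[ Bs ∈ (Fin r → Base) ] (∀ {i j} → i Fin.< j → Independent (Base.starter (Bs i)) (Base.starter (Bs j))) →
                   Σ[ 𝒮 ∈ (Fin r → CycleSystem k (suc (2 ℕ.* k ℕ.* w))) ] PairwiseOrthogonal 𝒮
      from-bases (Bs , independent) = 𝒮 , λ {i} {j} → orthogonal {i} {j}
        where
        𝒮 : Fin r → CycleSystem k (suc (2 ℕ.* k ℕ.* w))
        𝒮 t = Starter.system (Base.starter (Bs t))
        orthogonal-< : ∀ {i j} → i Fin.< j → Orthogonal (𝒮 i) (𝒮 j)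
        orthogonal-< {i} {j} i<j = independent⇒orthogonal (Base.starter (Bs i)) (Base.starter (Bs j)) (independent i<j)
        orthogonal : PairwiseOrthogonal 𝒮
        orthogonal {i} {j} i≢j = by-order (Fin.<-cmp i j)
          where
          by-order : Tri (i Fin.< j) (i ≡ j) (j Fin.< i) → Orthogonal (𝒮 i) (𝒮 j)
          by-order (tri< i<j _ _) = orthogonal-< i<j
          by-order (tri≈ _ i≡j _) = contradiction i≡j i≢j
          by-order (tri> _ _ j<i) = Orthogonal-sym (𝒮 j) (𝒮 i) (orthogonal-< j<i)

-- The number of systems and the ceiling.

module OrthogonalFamilies where
  open FiniteFields
  open PrimitiveRoots
  open StarterSystems
  open CyclotomicStarters
  open GreedyConstruction
  open GaloisFields
  open import Data.Fin.Base using (Fin; zero; suc)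
  open import Data.Integer.Base as ℤ using (+_) renaming (_≤_ to _≤ℤ_)
  import Data.Integer.Properties as ℤ
  import Data.Integer.DivMod as ℤ
  open import Data.Nat.Base as ℕ using (ℕ; _+_; _*_; _^_; _≤_; NonZero; zero; suc; _<_; z<s)
  import Data.Nat.Properties as ℕ
  open import Data.Nat.DivMod using (m%n<n; m≡m%n+[m/n]*n; m/n*n≤m)
  open import Data.Nat.Divisibility using (_∣_; divides)
  open import Data.Product.Base using (_×_; Σ-syntax; ∃-syntax; _,_)
  open import Data.Rational.Unnormalised using (_/_; ceiling)
  open import Data.Sum.Base using (_⊎_; inj₁; inj₂; [_,_]′)
  open import Relation.Binary.PropositionalEquality
  open import Relation.Nullary

  -- The ceiling of w / m is minus the floor of -w / m. From -N m ≤ -w < (floor + 1) m it follows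
  -- that -N < floor + 1, hence -N ≤ floor.
  ceiling-≤ : ∀ {w m N} .{{_ : NonZero m}} → w ≤ N * m → ceiling (+ w / m) ≤ℤ + N
  ceiling-≤ {w} {suc m-1} {N} w≤Nm = subst (ℤ.- floor ≤ℤ_) (ℤ.neg-involutive (+ N)) (ℤ.neg-mono-≤ -N≤floor)
    where
    m : ℕ
    m = suc m-1
    floor : ℤ.ℤ
    floor = (ℤ.- (+ w)) ℤ./ (+ m)
    floor/ℕ : floor ≡ (ℤ.- (+ w)) ℤ./ℕ m
    floor/ℕ = ℤ.div-pos-is-/ℕ (ℤ.- (+ w)) m
    -Nm<[1+floor]m : (ℤ.- (+ N)) ℤ.* (+ m) ℤ.< ℤ.suc floor ℤ.* (+ m)
    -Nm<[1+floor]m = ℤ.≤-<-trans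
      (subst (_≤ℤ ℤ.- (+ w)) (trans (cong ℤ.-_ (ℤ.pos-* N m)) (ℤ.neg-distribˡ-* (+ N) (+ m))) (ℤ.neg-mono-≤ (ℤ.+≤+ w≤Nm)))
      (subst (λ f → ℤ.- (+ w) ℤ.< ℤ.suc f ℤ.* (+ m)) (sym floor/ℕ) (ℤ.n<s[n/ℕd]*d (ℤ.- (+ w)) m))
    -N≤floor : ℤ.- (+ N) ≤ℤ floor
    -N≤floor = subst (ℤ.- (+ N) ≤ℤ_) (ℤ.pred-suc floor) (ℤ.i<j⇒i≤pred[j] (ℤ.*-cancelʳ-<-nonNeg {ℤ.- (+ N)} {ℤ.suc floor} (+ m) -Nm<[1+floor]m))

  odd-or-even : ∀ n → Odd n ⊎ 2 ∣ n
  odd-or-even zero          = inj₂ (divides 0 refl)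
  odd-or-even (suc zero)    = inj₁ (0 , refl)
  odd-or-even (suc (suc n)) = [ (λ { (m , n≡) → inj₁ (suc m , cong (λ n → suc (suc n)) (trans n≡ (sym (ℕ.+-suc m (m + 0))))) })
                              , (λ { (divides m n≡) → inj₂ (divides (suc m) (cong (λ n → suc (suc n)) n≡)) }) ]′ (odd-or-even n)

  OrthogonalSystems : ℕ → ℕ → ℕ → Set
  OrthogonalSystems k q N = Σ[ 𝒮 ∈ (Fin N → CycleSystem k q) ] PairwiseOrthogonal 𝒮

  single-system : ∀ {k q} → CycleSystem k q → OrthogonalSystems k q 1
  single-system S = (λ _ → S) , λ { {zero} {zero} 0≢0 → contradiction refl 0≢0 }

  orthogonal-systems : ∀ {k w} → 3 ≤ k → Odd k → Odd w → GaloisField (suc (2 * k * w)) →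
                       ∃[ N ] w ≤ N * (4 * k ^ 4) × OrthogonalSystems k (suc (2 * k * w)) N
  orthogonal-systems {k} {w} 3≤k k-odd w-odd (𝔽 , x^q≡x) = by-size (w ℕ.≤? 4 * k ^ 4)
    where
    open ℕ.≤-Reasoning
    instance
      k≢0 : NonZero k
      k≢0 = ℕ.>-nonZero (ℕ.<-≤-trans z<s 3≤k)
      w≢0 : NonZero w
      w≢0 = ℕ.>-nonZero (odd⇒>0 w-odd)
      4k⁴≢0 : NonZero (4 * k ^ 4)
      4k⁴≢0 = ℕ.m*n≢0 4 (k ^ 4) {{_}} {{ℕ.m^n≢0 k 4}}
    w-1 : ℕ
    w-1 = ℕ.pred w
    -- One more than this quotient is ⌈w / 4k⁴⌉. It is large enough for the bound w ≤ N · 4k⁴ and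
    -- still small enough that every t < N satisfies t · 4k⁴ < w, as the greedy step demands.
    ⌊w-1/4k⁴⌋ : ℕ
    ⌊w-1/4k⁴⌋ = w-1 ℕ./ (4 * k ^ 4)
    w≤ : w ≤ suc ⌊w-1/4k⁴⌋ * (4 * k ^ 4)
    w≤ = begin
      w ≡⟨ ℕ.suc-pred w ⟨
      suc w-1 ≡⟨ cong suc (m≡m%n+[m/n]*n w-1 (4 * k ^ 4)) ⟩
      suc (w-1 ℕ.% (4 * k ^ 4)) + ⌊w-1/4k⁴⌋ * (4 * k ^ 4) ≤⟨ ℕ.+-monoˡ-≤ _ (m%n<n w-1 (4 * k ^ 4)) ⟩
      4 * k ^ 4 + ⌊w-1/4k⁴⌋ * (4 * k ^ 4) ∎
    small : ∀ {t} → t < suc ⌊w-1/4k⁴⌋ → t * (4 * k ^ 4) < w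
    small {t} t≤ = begin-strict
      t * (4 * k ^ 4) ≤⟨ ℕ.*-monoˡ-≤ (4 * k ^ 4) (ℕ.s≤s⁻¹ t≤) ⟩
      ⌊w-1/4k⁴⌋ * (4 * k ^ 4) ≤⟨ m/n*n≤m w-1 (4 * k ^ 4) ⟩
      w-1 <⟨ ℕ.≤-reflexive (ℕ.suc-pred w) ⟩
      w ∎
    by-size : Dec (w ≤ 4 * k ^ 4) → ∃[ N ] w ≤ N * (4 * k ^ 4) × OrthogonalSystems k (suc (2 * k * w)) N
    by-size (yes w≤4k⁴) = 1 , subst (w ≤_) (sym (ℕ.*-identityˡ (4 * k ^ 4))) w≤4k⁴ ,
      single-system (Cyclotomic.power-system {k} {w} 𝔽 (FieldProperties.little-fermat 𝔽 (2 * k * w) x^q≡x) (ℕ.<⇒≤ 3≤k) k-odd w-odd)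
    by-size (no  w≰4k⁴) = suc ⌊w-1/4k⁴⌋ , w≤ ,
      Greedy.orthogonal-systems {k} {w} 𝔽 (FieldProperties.little-fermat 𝔽 (2 * k * w) x^q≡x) (ℕ.<⇒≤ 3≤k) k-odd w-odd 3≤k (ℕ.≰⇒> w≰4k⁴) (suc ⌊w-1/4k⁴⌋) small

open import Defs
open import Data.Fin using (Fin)
open import Data.Integer using (+_) renaming (_≤_ to _≤ℤ_)
open import Data.Nat using (ℕ; _+_; _*_; _^_; _≤_; NonZero)
open import Data.Nat.Divisibility using (_∣_)
open import Data.Product using (_×_; Σ-syntax; ∃-syntax)
open import Data.Rational.Unnormalised using (_/_; ceiling)
open import Relation.Nullary using (¬_)

open CyclotomicStarters using (Odd)
open GaloisFields using (GaloisField; galois-field)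
open OrthogonalFamilies
open import Data.Nat using (suc)
open import Data.Nat.Divisibility using (∣m⇒∣m*n; ∣n⇒∣m*n)
open import Data.Nat.Properties using (+-comm)
open import Data.Product using (_,_)
open import Data.Sum using ([_,_]′)
open import Function using (id)
open import Relation.Binary.PropositionalEquality using (_≡_; sym; trans; subst)
open import Relation.Nullary using (contradiction)

theorem1p16 : ∀ (k w : ℕ) .{{_ : NonZero k}} .{{_ : NonZero w}} → 3 ≤ k → ¬ (2 ∣ k * w) →
    IsPrimePower (2 * k * w + 1) →
    ∃[ N ] (ceiling (+ w / (4 * k ^ 4)) ≤ℤ + N) ×
    Σ[ 𝒮 ∈ (Fin N → CycleSystem k (2 * k * w + 1)) ] PairwiseOrthogonal 𝒮
theorem1p16 k w 3≤k 2∤kw (p , m , p-prime , 0<m , q≡p^m) = conclude (orthogonal-systems 3≤k k-odd w-odd field-of-order-q)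
  where
  q≡1+2kw : 2 * k * w + 1 ≡ suc (2 * k * w)
  q≡1+2kw = +-comm (2 * k * w) 1
  field-of-order-q : GaloisField (suc (2 * k * w))
  field-of-order-q = subst GaloisField (trans (sym q≡p^m) q≡1+2kw) (galois-field p-prime 0<m)
  k-odd : Odd k
  k-odd = [ id , (λ 2∣k → contradiction (∣m⇒∣m*n w 2∣k) 2∤kw) ]′ (odd-or-even k)
  w-odd : Odd w
  w-odd = [ id , (λ 2∣w → contradiction (∣n⇒∣m*n k 2∣w) 2∤kw) ]′ (odd-or-even w)
  conclude : ∃[ N ] w ≤ N * (4 * k ^ 4) × OrthogonalSystems k (suc (2 * k * w)) N →
             ∃[ N ] (ceiling (+ w / (4 * k ^ 4)) ≤ℤ + N) × OrthogonalSystems k (2 * k * w + 1) N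
  conclude (N , w≤N*4k⁴ , systems) = N , ceiling-≤ w≤N*4k⁴ , subst (λ q → OrthogonalSystems k q N) (sym q≡1+2kw) systems
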